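{- For every partition $\lambda\vdash n$, \[ \sum_{\mathcal{T}\in\mathrm{SYT}_\pm(\lambda)} q^{\operatorname{maj}(\mathcal{T})}t^{\operatorname{neg}(\mathcal{T})}=[n]_q!\prod_{(r,c)\in\lambda}\frac{q^{r-1}+tq^{c-1}}{[h(r,c)]_q}, \] where $[k]_q=1+q+\cdots+q^{k-1}$ and $[n]_q!=[1]_q[2]_q\cdots[n]_q$.
   Context: Partitions are drawn in English notation; $(r,c)\in\lambda$ denotes the cell in row $r$, column $c$, and $h(r,c)$ is its hook length (number of cells weakly to the right in its row plus weakly below in its column, counting the cell once). $\mathrm{SYT}_\pm(\lambda)$ is the set of standard Young tableaux of shape $\lambda$ (entries $1,\dots,n$) with each cell marked positive or negative; $\mathrm{Neg}(\mathcal{T})$ is the set of entries in negative cells, $\operatorname{neg}(\mathcal{T})=|\mathrm{Neg}(\mathcal{T})|$. $\mathrm{Des}(\mathcal{T})$ is the set of $i\in[n-1]$ such that either ($i+1\notin\mathrm{Neg}(\mathcal{T})$ and $i+1$ is in a strictly lower row than $i$) or ($i\in\mathrm{Neg}(\mathcal{T})$ and $i+1$ is not in a strictly lower row than $i$); $\operatorname{maj}(\mathcal{T})=\sum_{i\in\mathrm{Des}(\mathcal{T})}i$. -}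

module Defs where

open import Algebra.Bundles using (CommutativeRing)
open import Data.Fin.Base using (Fin; toℕ) renaming (zero to fzero; suc to fsuc)
import Data.Fin.Properties as Fin
open import Data.List.Base
  using (List; []; _∷_; map; foldr; filter; length; lookup; upTo; concatMap; allFin;
         cartesianProduct; cartesianProductWith)
open import Data.List.Membership.Propositional using (_∈_)
open import Data.List.Membership.Propositional.Properties
  using (∈-filter⁺; ∈-filter⁻; ∈-allFin; ∈-cartesianProduct⁺; ∈-cartesianProductWith⁺)
open import Data.List.Relation.Unary.All using (All; []; _∷_)
open import Data.List.Relation.Unary.Any using (here; there)
open import Data.List.Relation.Unary.AllPairs using ([]; _∷_)
open import Data.List.Relation.Unary.Linked using (Linked)
open import Data.List.Relation.Unary.Unique.Propositional using (Unique)
import Data.List.Relation.Unary.Unique.Propositional.Properties as Unique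
open import Data.Nat.Base using (ℕ; zero; suc; _∸_; _<_; _≤_; _≥_)
open import Data.Nat.ListAction using (sum)
import Data.Nat.Properties as ℕ
open import Data.Product.Base using (Σ; _×_; _,_; proj₁; proj₂; ∃; ∃₂)
open import Data.Product.Properties using (≡-dec)
open import Data.Sign.Base using (Sign)
import Data.Sign.Properties as Sign
open import Data.Sum.Base using (_⊎_)
open import Data.Vec.Base using (Vec; []; _∷_)
import Data.Vec.Base as Vec
import Data.Vec.Properties as Vec
open import Function.Bundles using (_⇔_; mk⇔)
open import Function.Definitions using (Bijective)
open import Relation.Binary.PropositionalEquality using (_≡_; refl)
open import Relation.Nullary using (Dec; ¬_)
open import Relation.Nullary.Decidable using (map′; _×-dec_; _⊎-dec_; _→-dec_; ¬?)
open import Relation.Unary using (Decidable)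

record Partition (n : ℕ) : Set where
  field
    parts      : List ℕ
    decreasing : Linked _≥_ parts
    positive   : All (0 <_) parts
    sum≡n      : sum parts ≡ n

open Partition public

record Cell (λs : List ℕ) : Set where
  constructor ⟨_,_⟩
  field
    rowIx : Fin (length λs)
    colIx : Fin (lookup λs rowIx)

-- Rows and columns are numbered from 1, rows downwards.
row col : ∀ {λs} → Cell λs → ℕ
row ⟨ r , _ ⟩ = suc (toℕ r)
col ⟨ _ , c ⟩ = suc (toℕ c)

cells : ∀ λs → List (Cell λs)
cells λs = concatMap (λ r → map ⟨ r ,_⟩ (allFin (lookup λs r))) (allFin (length λs))

_≟ᶜ_ : ∀ {λs} (x y : Cell λs) → Dec (x ≡ y)
⟨ r , c ⟩ ≟ᶜ ⟨ r′ , c′ ⟩ =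
  map′ (λ { refl → refl }) (λ { refl → refl }) (≡-dec Fin._≟_ Fin._≟_ (r , c) (r′ , c′))

∀cell? : ∀ {λs} {P : Cell λs → Set} → Decidable P → Dec (∀ x → P x)
∀cell? P? = map′ (λ p (⟨ r , c ⟩) → p r c) (λ p r c → p ⟨ r , c ⟩)
                 (Fin.all? λ r → Fin.all? λ c → P? ⟨ r , c ⟩)

∃cell? : ∀ {λs} {P : Cell λs → Set} → Decidable P → Dec (∃ P)
∃cell? P? = map′ (λ (r , c , p) → ⟨ r , c ⟩ , p) (λ (⟨ r , c ⟩ , p) → r , c , p)
                 (Fin.any? λ r → Fin.any? λ c → P? ⟨ r , c ⟩)

InHook : ∀ {λs} → Cell λs → Cell λs → Set
InHook x y = (row y ≡ row x × col x ≤ col y) ⊎ (col y ≡ col x × row x ≤ row y)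

inHook? : ∀ {λs} (x : Cell λs) → Decidable (InHook x)
inHook? x y = ((row y ℕ.≟ row x) ×-dec (col x ℕ.≤? col y))
         ⊎-dec ((col y ℕ.≟ col x) ×-dec (row x ℕ.≤? row y))

hook : ∀ {λs} → Cell λs → ℕ
hook {λs} x = length (filter (inHook? x) (cells λs))

-- One vector of values for each row of the diagram.
Filling : Set → List ℕ → Set
Filling A = All (Vec A)

_at_ : ∀ {A λs} → Filling A λs → Cell λs → A
(v ∷ T) at ⟨ fzero  , c ⟩ = Vec.lookup v c
(v ∷ T) at ⟨ fsuc r , c ⟩ = T at ⟨ r , c ⟩

vectors : ∀ {A : Set} → List A → ∀ k → List (Vec A k)
vectors as zero    = [] ∷ []
vectors as (suc k) = cartesianProductWith _∷_ as (vectors as k)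

fillings : ∀ {A : Set} → List A → ∀ λs → List (Filling A λs)
fillings as []       = [] ∷ []
fillings as (k ∷ λs) = cartesianProductWith _∷_ (vectors as k) (fillings as λs)

SignedFilling : ℕ → List ℕ → Set
SignedFilling n = Filling (Fin n × Sign)

module _ {n : ℕ} {λs : List ℕ} (T : SignedFilling n λs) where

  label : Cell λs → Fin n
  label x = proj₁ (T at x)

  -- The label k : Fin n stands for the entry k + 1 of {1, …, n}.
  entry : Cell λs → ℕ
  entry x = suc (toℕ (label x))

  sign : Cell λs → Sign
  sign x = proj₂ (T at x)

  record IsStandard : Set where
    constructor standard
    field
      bijective : Bijective _≡_ _≡_ label
      rows      : ∀ x y → row x ≡ row y → col x < col y → entry x < entry y
      columns   : ∀ x y → col x ≡ col y → row x < row y → entry x < entry y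

  isStandard? : Dec IsStandard
  isStandard? = map′
    (λ ((i , s) , r , c) → standard ((λ {x} {y} → i x y) , λ k → proj₁ (s k) , λ { refl → proj₂ (s k) }) r c)
    (λ (standard (i , s) r c) → ((λ x y → i {x} {y}) , λ k → proj₁ (s k) , proj₂ (s k) refl) , r , c)
    (((∀cell? λ x → ∀cell? λ y → (label x Fin.≟ label y) →-dec (x ≟ᶜ y))
      ×-dec (Fin.all? λ k → ∃cell? λ x → label x Fin.≟ k))
     ×-dec (∀cell? λ x → ∀cell? λ y →
              (row x ℕ.≟ row y) →-dec ((col x ℕ.<? col y) →-dec (entry x ℕ.<? entry y)))
     ×-dec (∀cell? λ x → ∀cell? λ y →
              (col x ℕ.≟ col y) →-dec ((row x ℕ.<? row y) →-dec (entry x ℕ.<? entry y))))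

  Neg : ℕ → Set
  Neg i = ∃ λ x → entry x ≡ i × sign x ≡ Sign.-

  neg? : Decidable Neg
  neg? i = ∃cell? λ x → (entry x ℕ.≟ i) ×-dec (sign x Sign.≟ Sign.-)

  -- Entry j lies in a strictly lower row than entry i.
  Lower : ℕ → ℕ → Set
  Lower i j = ∃₂ λ x y → entry x ≡ i × entry y ≡ j × row x < row y

  lower? : ∀ i j → Dec (Lower i j)
  lower? i j = ∃cell? λ x → ∃cell? λ y →
    (entry x ℕ.≟ i) ×-dec (entry y ℕ.≟ j) ×-dec (row x ℕ.<? row y)

  Descent : ℕ → Set
  Descent i = (¬ Neg (suc i) × Lower i (suc i)) ⊎ (Neg i × ¬ Lower i (suc i))

  descent? : Decidable Descent
  descent? i = (¬? (neg? (suc i)) ×-dec lower? i (suc i))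
         ⊎-dec (neg? i ×-dec ¬? (lower? i (suc i)))

[1‥_] : ℕ → List ℕ
[1‥ n ] = map suc (upTo n)

maj neg : ∀ {n λs} → SignedFilling n λs → ℕ
maj {n} T = sum (filter (descent? T) [1‥ n ∸ 1 ])
neg {n} T = length (filter (neg? T) [1‥ n ])

signs : List Sign
signs = Sign.+ ∷ Sign.- ∷ []

allSignedFillings : ∀ n λs → List (SignedFilling n λs)
allSignedFillings n = fillings (cartesianProduct (allFin n) signs)

SYT± : ∀ {n} (Λ : Partition n) → List (SignedFilling n (parts Λ))
SYT± {n} Λ = filter isStandard? (allSignedFillings n (parts Λ))

-- SYT± lists every standard signed filling exactly once.
private
  ∈-vectors : ∀ {A : Set} {as : List A} → (∀ a → a ∈ as) → ∀ {k} (v : Vec A k) → v ∈ vectors as k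
  ∈-vectors h []      = here refl
  ∈-vectors h (a ∷ v) = ∈-cartesianProductWith⁺ _∷_ (h a) (∈-vectors h v)

  ∈-fillings : ∀ {A : Set} {as : List A} → (∀ a → a ∈ as) → ∀ {λs} (T : Filling A λs) → T ∈ fillings as λs
  ∈-fillings h []      = here refl
  ∈-fillings h (v ∷ T) = ∈-cartesianProductWith⁺ _∷_ (∈-vectors h v) (∈-fillings h T)

  vectors! : ∀ {A : Set} {as : List A} → Unique as → ∀ k → Unique (vectors as k)
  vectors! u zero    = [] ∷ []
  vectors! u (suc k) = Unique.cartesianProductWith⁺ _∷_ Vec.∷-injective u (vectors! u k)

  fillings! : ∀ {A : Set} {as : List A} → Unique as → ∀ λs → Unique (fillings as λs)
  fillings! u []       = [] ∷ []
  fillings! u (k ∷ λs) =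
    Unique.cartesianProductWith⁺ _∷_ (λ { refl → refl , refl }) (vectors! u k) (fillings! u λs)

  ∈-signs : ∀ s → s ∈ signs
  ∈-signs Sign.+ = here refl
  ∈-signs Sign.- = there (here refl)

∈-SYT± : ∀ {n} (Λ : Partition n) {T} → T ∈ SYT± Λ ⇔ IsStandard T
∈-SYT± {n} Λ {T} = mk⇔
  (λ T∈ → proj₂ (∈-filter⁻ isStandard? {xs = allSignedFillings n (parts Λ)} T∈))
  (∈-filter⁺ isStandard? (∈-fillings (λ (k , s) → ∈-cartesianProduct⁺ (∈-allFin k) (∈-signs s)) T))

SYT±! : ∀ {n} (Λ : Partition n) → Unique (SYT± Λ)
SYT±! {n} Λ = Unique.filter⁺ isStandard?
  (fillings! (Unique.cartesianProduct⁺ (Unique.allFin⁺ n) (((λ ()) ∷ []) ∷ [] ∷ [])) (parts Λ))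

-- An identity of rational functions in q and t is read in an arbitrary commutative
-- ring, for elements q and t that make the denominators units; indeterminates are
-- the case R = ℚ(q, t).
module QAnalogues {a ℓ} (R : CommutativeRing a ℓ) where
  open CommutativeRing R
  open import Algebra.Properties.Semiring.Exp semiring public using (_^_)

  ∑ ∏ : ∀ {A : Set} → List A → (A → Carrier) → Carrier
  ∑ xs f = foldr (λ x s → f x + s) 0# xs
  ∏ xs f = foldr (λ x p → f x * p) 1# xs

  infix 8 ∑ ∏
  syntax ∑ xs (λ x → e) = ∑[ x ∈ xs ] e
  syntax ∏ xs (λ x → e) = ∏[ x ∈ xs ] e

  [_] : ℕ → Carrier → Carrier
  [ k ] q = ∑[ i ∈ upTo k ] (q ^ i)

  [_]! : ℕ → Carrier → Carrier
  [ n ]! q = ∏[ k ∈ [1‥ n ] ] ([ k ] q)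

-- Put p = 1 - q and h_m(x, y) = (x + y)(x + yq) ⋯ (x + yq^(m-1)) / [m]!, and let
-- J_λ(x, y) be the determinant of the h_{λ_i - i + j}(x, y). Column operations that strip
-- the first column of λ give J_λ(x, y) = ∏ (x q^(r-1) + y q^(c-1)) / [h(r, c)].
--
-- A standard signed tableau is a word recording the row and the sign of each entry. Removing
-- the largest entries up to the last descent removes first a vertical strip (negative
-- entries), then a horizontal strip (positive ones), so the generating function is governed
-- by Pieri rules: subtracting one cell from a row of the determinant is a shift of that row,
-- and the entries satisfy
--   h_m(1, t) = h_m(1, qt) + p t h_{m-1}(1, qt),  h_m(1, qt) = h_m(q, qt) + p h_{m-1}(1, qt).
-- Hence words whose last letter is a positive (negative) entry in row i are counted by the
-- determinant in which the rows above the i-th come from h(q, qt) (from h(1, t)) and the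
-- others from h(1, qt); a cell that is not removable contributes a determinant with two
-- equal rows. The sum over all words telescopes to [n]! J_λ(1, t).
--
-- The argument divides by [k] and cancels p, so it is carried out for q = z in R[[z]]. Both
-- sides of the identity, multiplied by the hooks, are polynomials in z, to be evaluated at q.

module Submission where

open import Defs
open import Algebra.Bundles using (CommutativeRing)
import Algebra.Properties.CommutativeSemigroup as CommutativeSemigroup
import Algebra.Properties.Group as GroupProperties
import Algebra.Properties.Ring as RingProperties
import Algebra.Properties.Semiring.Exp as Exp
import Algebra.Solver.Ring.NaturalCoefficients.Default as Solver
open import Data.Bool.Base as Bool using (Bool; true; false; if_then_else_)
open import Data.Bool.Properties using (∧-identityʳ)
open import Data.Empty using (⊥-elim)
open import Data.Fin.Base as Fin using (Fin; toℕ; fromℕ<) renaming (zero to fzero; suc to fsuc)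
import Data.Fin.Properties as Fin
open import Data.List.Base
  using (List; []; _∷_; map; foldr; filter; _++_; length; lookup; tabulate; allFin; concatMap;
         cartesianProduct; upTo; applyUpTo)
open import Data.List.Properties
  using (++-assoc; map-++; map-∘; map-tabulate; length-map; length-++; length-tabulate; upTo-∷ʳ; filter-++;
         tabulate-lookup; concatMap-map; map-concatMap; concatMap-cong)
open import Data.List.Membership.Propositional using (_∈_; find; lose)
open import Data.List.Membership.Propositional.Properties
  using (∈-filter⁺; ∈-filter⁻; ∈-allFin; ∈-lookup; ∈-map⁺; ∈-map⁻; ∈-concatMap⁺; ∈-concatMap⁻;
         ∈-cartesianProduct⁺; ∈-cartesianProduct⁻)
open import Data.List.Relation.Unary.All as All using (All; []; _∷_)
import Data.List.Relation.Unary.All.Properties as All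
open import Data.List.Relation.Unary.AllPairs using (AllPairs; []; _∷_)
open import Data.List.Relation.Unary.Any using (here; there)
open import Data.List.Relation.Unary.Linked using (Linked)
open import Data.List.Relation.Unary.Linked.Properties using (Linked⇒AllPairs)
open import Data.List.Relation.Unary.Unique.Propositional using (Unique)
import Data.List.Relation.Unary.Unique.Propositional.Properties as Unique
open import Data.Nat.Base as ℕ
  using (ℕ; zero; suc; pred; _∸_; _<ᵇ_; _≡ᵇ_; _≤_; _<_; _≥_; z≤n; s≤s)
open import Data.Nat.ListAction using (sum)
open import Data.Nat.ListAction.Properties using (sum-++)
import Data.Nat.Properties as ℕ
open import Data.Product.Base using (_×_; _,_; proj₁; proj₂; ∃; ∃₂)
open import Data.Sign.Base as Sign using (Sign)
import Data.Sign.Properties as Sign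
open import Data.Sum.Base using (inj₁; inj₂)
open import Data.Vec.Base as Vec using (Vec; []; _∷_)
open import Data.Vec.Functional using (Vector; updateAt)
open import Data.Vec.Functional.Properties using (updateAt-updates; updateAt-minimal)
import Data.Vec.Properties as Vec
open import Function.Base using (_∘_)
open import Function.Bundles using (Equivalence)
open import Level using (_⊔_)
open import Relation.Binary.PropositionalEquality as ≡ using (_≡_; _≢_)
import Relation.Binary.Reasoning.Setoid as SetoidReasoning
open import Relation.Nullary using (Dec; yes; no; does; ¬_; contradiction)
open import Relation.Nullary.Decidable using (_×-dec_; _→-dec_; dec-true; dec-false)
open import Relation.Unary using (Decidable)

-- Determinants

-- What makes the telescoping close: whether n is a descent depends on the letters of n and n + 1,
-- so the induction keeps one extra letter on top of the words of a shape of size n. Relative to an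
-- extra letter in row i, the factor 1 or q^n earned by the letter of n is, for each sign, constant
-- in its row or a step function jumping at row i. Write B_i and C_i for the mixed determinants of
-- the positive and the negative case. Summation by parts of B_j - B_(j+1) and C_(j+1) - C_j against
-- these steps leaves boundary values at 0, i and the number of rows ℓ only. At 0 all rows of both
-- determinants come from h(1, qt), so B_0 = C_0. At ℓ they come from h(q, qt) and from h(1, t), so
-- homogeneity gives B_ℓ = q^n C_ℓ. What survives is (1 - q^n) times the determinant sought; as 1 -
-- q^n = p [n], cancelling p yields the next factor of [n]!.

module Determinant {a ℓ} (R : CommutativeRing a ℓ) where
  open CommutativeRing R
  open RingProperties ring using (-1*x≈-x)
  open SetoidReasoning setoid
  open Solver commutativeSemiring using (solve; _:+_; _:*_; _:=_)

  Row : Set a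
  Row = ℕ → Carrier

  Form : Set a
  Form = List Row → Carrier

  infixr 6 _∧_
  -- Exterior product with a linear functional: a signed sum over the row that f consumes, the other
  -- rows passing to ω in their order. Forms act on lists of any length, so that no row count has to
  -- be carried along.
  _∧_ : (Row → Carrier) → Form → Form
  (f ∧ ω) []       = 0#
  (f ∧ ω) (r ∷ rs) = f r * ω rs + - 1# * (f ∧ λ rs′ → ω (r ∷ rs′)) rs

  column : ℕ → Row → Carrier
  column k r = r k

  -- The columns are numbered k - 1, …, 0 from left to right, and the form vanishes
  -- unless it is given exactly k rows.
  det : ℕ → Form
  det zero    []      = 1#
  det zero    (_ ∷ _) = 0#
  det (suc k) rs      = (column k ∧ det k) rs

  private
    x+-1*x : ∀ {x y} → x ≈ y → x + - 1# * y ≈ 0#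
    x+-1*x {x} {y} x≈y = trans (+-congˡ (trans (-1*x≈-x y) (-‿cong (sym x≈y)))) (-‿inverseʳ x)

    0-0 : ∀ {x y} → x ≈ 0# → y ≈ 0# → ∀ c → x + c * y ≈ 0#
    0-0 x≈0 y≈0 c = trans (+-cong x≈0 (trans (*-congˡ y≈0) (zeroʳ c))) (+-identityˡ 0#)

  ∧-cong : ∀ {f g ω ω′} → (∀ r → f r ≈ g r) → (∀ rs → ω rs ≈ ω′ rs) →
           ∀ rs → (f ∧ ω) rs ≈ (g ∧ ω′) rs
  ∧-cong f≈g ω≈ω′ []       = refl
  ∧-cong f≈g ω≈ω′ (r ∷ rs) =
    +-cong (*-cong (f≈g r) (ω≈ω′ rs)) (*-congˡ (∧-cong f≈g (λ rs′ → ω≈ω′ (r ∷ rs′)) rs))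

  ∧-linearʳ : ∀ f c {ω χ ψ} → (∀ rs → ω rs ≈ χ rs + c * ψ rs) →
              ∀ rs → (f ∧ ω) rs ≈ (f ∧ χ) rs + c * (f ∧ ψ) rs
  ∧-linearʳ f c h []       = sym (0-0 refl refl c)
  ∧-linearʳ f c h (r ∷ rs) = trans
    (+-cong (*-congˡ (h rs)) (*-congˡ (∧-linearʳ f c (λ rs′ → h (r ∷ rs′)) rs)))
    (solve 7 (λ c n f a b x y →
      f :* (a :+ c :* b) :+ n :* (x :+ c :* y) := f :* a :+ n :* x :+ c :* (f :* b :+ n :* y))
      refl c (- 1#) (f r) _ _ _ _)

  ∧-linearˡ : ∀ ω c d {f g h} → (∀ r → f r ≈ c * g r + d * h r) →
              ∀ rs → (f ∧ ω) rs ≈ c * (g ∧ ω) rs + d * (h ∧ ω) rs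
  ∧-linearˡ ω c d eq []       = sym (0-0 (zeroʳ c) refl d)
  ∧-linearˡ ω c d eq (r ∷ rs) = trans
    (+-cong (*-congʳ (eq r)) (*-congˡ (∧-linearˡ _ c d eq rs)))
    (solve 8 (λ c d n g h w x y →
      (c :* g :+ d :* h) :* w :+ n :* (c :* x :+ d :* y)
        := c :* (g :* w :+ n :* x) :+ d :* (h :* w :+ n :* y))
      refl c d (- 1#) _ _ (ω rs) _ _)

  ∧-scaleʳ : ∀ f c {ω χ} → (∀ rs → ω rs ≈ c * χ rs) → ∀ rs → (f ∧ ω) rs ≈ c * (f ∧ χ) rs
  ∧-scaleʳ f c h []       = sym (zeroʳ c)
  ∧-scaleʳ f c h (r ∷ rs) = trans
    (+-cong (*-congˡ (h rs)) (*-congˡ (∧-scaleʳ f c (λ rs′ → h (r ∷ rs′)) rs)))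
    (solve 5 (λ c n f a x → f :* (c :* a) :+ n :* (c :* x) := c :* (f :* a :+ n :* x))
      refl c (- 1#) (f r) _ _)

  ∧-zeroʳ : ∀ f {ω} → (∀ rs → ω rs ≈ 0#) → ∀ rs → (f ∧ ω) rs ≈ 0#
  ∧-zeroʳ f h []       = refl
  ∧-zeroʳ f h (r ∷ rs) =
    0-0 (trans (*-congˡ (h rs)) (zeroʳ _)) (∧-zeroʳ f (λ rs′ → h (r ∷ rs′)) rs) _

  -- The term in which the outer factor consumes the head row cancels the one in which the inner
  -- factor does; in the remaining terms the head passes into ω and induction applies. This holds in
  -- characteristic 2 as well.
  f∧f∧ω≈0 : ∀ f ω rs → (f ∧ f ∧ ω) rs ≈ 0#
  f∧f∧ω≈0 f ω []       = refl
  f∧f∧ω≈0 f ω (r ∷ rs) = x+-1*x (sym (begin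
    (f ∧ λ rs′ → f r * ω rs′ + - 1# * (f ∧ ωᵣ) rs′) rs ≈⟨ ∧-linearʳ f (- 1#) (λ _ → refl) rs ⟩
    (f ∧ λ rs′ → f r * ω rs′) rs + - 1# * (f ∧ f ∧ ωᵣ) rs
      ≈⟨ +-cong (∧-scaleʳ f (f r) (λ _ → refl) rs) (*-congˡ (f∧f∧ω≈0 f ωᵣ rs)) ⟩
    f r * (f ∧ ω) rs + - 1# * 0#                        ≈⟨ +-congˡ (zeroʳ _) ⟩
    f r * (f ∧ ω) rs + 0#                               ≈⟨ +-identityʳ _ ⟩
    f r * (f ∧ ω) rs ∎))
    where ωᵣ = λ rs′ → ω (r ∷ rs′)

  ∧-map : ∀ {f g : Row → Carrier} {ω} (φ : Row → Row) → (∀ r → f (φ r) ≈ g r) →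
          ∀ rs → (f ∧ ω) (map φ rs) ≈ (g ∧ λ rs′ → ω (map φ rs′)) rs
  ∧-map φ h []       = refl
  ∧-map φ h (r ∷ rs) = +-cong (*-congʳ (h r)) (*-congˡ (∧-map φ h rs))

  -- Equal rows are taken adjacent: this is what arises when a cell that is not removable is taken
  -- off a row.
  Alternating Multilinear : Form → Set _
  Alternating ω = ∀ ps r rs → ω (ps ++ r ∷ r ∷ rs) ≈ 0#
  Multilinear ω = ∀ c {u v w : Row} → (∀ k → u k ≈ v k + c * w k) → ∀ ps rs →
                  ω (ps ++ u ∷ rs) ≈ ω (ps ++ v ∷ rs) + c * ω (ps ++ w ∷ rs)

  ∧-alternating : ∀ f {ω} → Alternating ω → Alternating (f ∧ ω)
  ∧-alternating f {ω} alt [] r rs = x+-1*x (sym (begin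
    f r * ω (r ∷ rs) + - 1# * (f ∧ λ rs′ → ω (r ∷ r ∷ rs′)) rs
      ≈⟨ +-congˡ (trans (*-congˡ (∧-zeroʳ f (alt [] r) rs)) (zeroʳ _)) ⟩
    f r * ω (r ∷ rs) + 0# ≈⟨ +-identityʳ _ ⟩
    f r * ω (r ∷ rs) ∎))
  ∧-alternating f alt (p ∷ ps) r rs =
    0-0 (trans (*-congˡ (alt ps r rs)) (zeroʳ _)) (∧-alternating f (λ ps′ → alt (p ∷ ps′)) ps r rs) _

  ∧-multilinear : ∀ f → (∀ c {u v w : Row} → (∀ k → u k ≈ v k + c * w k) → f u ≈ f v + c * f w) →
                  ∀ {ω} → Multilinear ω → Multilinear (f ∧ ω)
  ∧-multilinear f lin {ω} ml c {u} {v} {w} eq [] rs = trans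
    (+-cong (*-congʳ (lin c eq)) (*-congˡ (∧-linearʳ f c (ml c eq []) rs)))
    (solve 7 (λ c n a b x y o →
      (a :+ c :* b) :* o :+ n :* (x :+ c :* y) := a :* o :+ n :* x :+ c :* (b :* o :+ n :* y))
      refl c (- 1#) (f v) (f w) _ _ (ω rs))
  ∧-multilinear f lin ml c eq (p ∷ ps) rs = trans
    (+-cong (*-congˡ (ml c eq ps rs))
            (*-congˡ (∧-multilinear f lin (λ c eq ps′ → ml c eq (p ∷ ps′)) c eq ps rs)))
    (solve 7 (λ c n f a b x y →
      f :* (a :+ c :* b) :+ n :* (x :+ c :* y) := f :* a :+ n :* x :+ c :* (f :* b :+ n :* y))
      refl c (- 1#) (f p) _ _ _ _)

  det-alternating : ∀ k → Alternating (det k)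
  det-alternating zero    []      r rs = refl
  det-alternating zero    (_ ∷ _) r rs = refl
  det-alternating (suc k) = ∧-alternating (column k) (det-alternating k)

  det-multilinear : ∀ k → Multilinear (det k)
  det-multilinear zero    c eq []      rs = sym (0-0 refl refl c)
  det-multilinear zero    c eq (_ ∷ _) rs = sym (0-0 refl refl c)
  det-multilinear (suc k) = ∧-multilinear (column k) (λ c eq → eq k) (det-multilinear k)

  -- A zero row u equals u + (-1) u, so linearity turns the determinant D into D - D.
  det-zeroRow : ∀ k ps {u} rs → (∀ j → u j ≈ 0#) → det k (ps ++ u ∷ rs) ≈ 0#
  det-zeroRow k ps {u} rs u≈0 = begin
    det k (ps ++ u ∷ rs) ≈⟨ det-multilinear k (- 1#) (λ j → trans (u≈0 j) (sym (x+-1*x refl))) ps rs ⟩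
    det k (ps ++ u ∷ rs) + - 1# * det k (ps ++ u ∷ rs) ≈⟨ x+-1*x refl ⟩
    0# ∎

  det-scaleRow : ∀ k c {u w} → (∀ j → u j ≈ c * w j) → ∀ ps rs →
                 det k (ps ++ u ∷ rs) ≈ c * det k (ps ++ w ∷ rs)
  det-scaleRow k c {u} {w} eq ps rs = begin
    det k (ps ++ u ∷ rs)
      ≈⟨ det-multilinear k c (λ j → trans (eq j) (sym (+-identityˡ _))) ps rs ⟩
    det k (ps ++ (λ _ → 0#) ∷ rs) + c * det k (ps ++ w ∷ rs)
      ≈⟨ +-congʳ (det-zeroRow k ps rs (λ _ → refl)) ⟩
    0# + c * det k (ps ++ w ∷ rs) ≈⟨ +-identityˡ _ ⟩
    c * det k (ps ++ w ∷ rs) ∎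

  det-scaleRows : ∀ k {b} {B : Set b} {u w : B → Row} (c : B → Carrier) →
                  (∀ x j → u x j ≈ c x * w x j) → ∀ ps xs →
                  det k (ps ++ map u xs) ≈ foldr (λ x z → c x * z) 1# xs * det k (ps ++ map w xs)
  det-scaleRows k c eq ps []       = sym (*-identityˡ _)
  det-scaleRows k {u = u} {w} c eq ps (x ∷ xs) = begin
    det k (ps ++ u x ∷ map u xs)
      ≈⟨ det-scaleRow k (c x) (eq x) ps (map u xs) ⟩
    c x * det k (ps ++ w x ∷ map u xs)
      ≡⟨ ≡.cong (λ l → c x * det k l) (≡.sym (++-assoc ps (w x ∷ []) (map u xs))) ⟩
    c x * det k ((ps ++ w x ∷ []) ++ map u xs)
      ≈⟨ *-congˡ (det-scaleRows k c eq (ps ++ w x ∷ []) xs) ⟩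
    c x * (_ * det k ((ps ++ w x ∷ []) ++ map w xs))
      ≈⟨ sym (*-assoc _ _ _) ⟩
    c x * _ * det k ((ps ++ w x ∷ []) ++ map w xs)
      ≡⟨ ≡.cong (λ l → c x * foldr (λ x z → c x * z) 1# xs * det k l) (++-assoc ps (w x ∷ []) (map w xs)) ⟩
    c x * _ * det k (ps ++ w x ∷ map w xs) ∎

  det-cong : ∀ k {b} {B : Set b} {u w : B → Row} → (∀ x j → u x j ≈ w x j) → ∀ xs →
             det k (map u xs) ≈ det k (map w xs)
  det-cong k {u = u} {w} eq xs = begin
    det k (map u xs)                                    ≈⟨ det-scaleRows k (λ _ → 1#) (λ x j → trans (eq x j) (sym (*-identityˡ _))) [] xs ⟩
    foldr (λ _ z → 1# * z) 1# xs * det k (map w xs)     ≈⟨ *-congʳ (ones xs) ⟩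
    1# * det k (map w xs)                               ≈⟨ *-identityˡ _ ⟩
    det k (map w xs) ∎
    where
    ones : ∀ xs → foldr (λ _ z → 1# * z) 1# xs ≈ 1#
    ones []       = refl
    ones (_ ∷ xs) = trans (*-identityˡ _) (ones xs)

  leftNeighbour : (ℕ → Carrier) → Row → Row
  leftNeighbour γ r zero    = 0#
  leftNeighbour γ r (suc k) = γ (suc k) * r k

  ∏< : ℕ → (ℕ → Carrier) → Carrier
  ∏< zero    f = 1#
  ∏< (suc k) f = f k * ∏< k f

  -- The multiples of column k - 1 added to column k contribute a minor with two equal columns.
  det-columns : ∀ k (α γ : ℕ → Carrier) rs →
    det k (map (λ r j → α j * r j + leftNeighbour γ r j) rs) ≈ ∏< k α * det k rs
  det-columns zero    α γ []       = sym (*-identityˡ _)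
  det-columns zero    α γ (_ ∷ _)  = sym (zeroʳ _)
  det-columns (suc k) α γ rs = begin
    (column k ∧ det k) (map B rs) ≈⟨ ∧-map B (λ _ → refl) rs ⟩
    ((λ r → B r k) ∧ λ rs′ → det k (map B rs′)) rs ≈⟨ ∧-scaleʳ _ (∏< k α) (det-columns k α γ) rs ⟩
    ∏< k α * ((λ r → B r k) ∧ det k) rs ≈⟨ *-congˡ (expand k rs) ⟩
    ∏< k α * (α k * det (suc k) rs) ≈⟨ solve 3 (λ a b c → a :* (b :* c) := b :* a :* c) refl _ _ _ ⟩
    α k * ∏< k α * det (suc k) rs ∎
    where
    B : Row → Row
    B r j = α j * r j + leftNeighbour γ r j

    expand : ∀ k rs → ((λ r → B r k) ∧ det k) rs ≈ α k * det (suc k) rs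
    expand zero    rs = begin
      ((λ r → B r 0) ∧ det 0) rs
        ≈⟨ ∧-linearˡ (det 0) (α 0) 0# (λ r → +-congˡ (sym (zeroˡ (column 0 r)))) rs ⟩
      α 0 * det 1 rs + 0# * (column 0 ∧ det 0) rs ≈⟨ +-congˡ (zeroˡ _) ⟩
      α 0 * det 1 rs + 0# ≈⟨ +-identityʳ _ ⟩
      α 0 * det 1 rs ∎
    expand (suc k) rs = begin
      ((λ r → B r (suc k)) ∧ det (suc k)) rs
        ≈⟨ ∧-linearˡ (det (suc k)) (α (suc k)) (γ (suc k)) {h = column k} (λ r → refl) rs ⟩
      α (suc k) * det (suc (suc k)) rs + γ (suc k) * (column k ∧ det (suc k)) rs
        ≈⟨ 0-0′ (f∧f∧ω≈0 (column k) (det k) rs) ⟩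
      α (suc k) * det (suc (suc k)) rs ∎
      where
      0-0′ : ∀ {x y c} → y ≈ 0# → x + c * y ≈ x
      0-0′ y≈0 = trans (+-congˡ (trans (*-congˡ y≈0) (zeroʳ _))) (+-identityʳ _)

  unitRow : Row
  unitRow zero    = 1#
  unitRow (suc _) = 0#

  -- Column 0 is the rightmost one, so the 1 sits in the bottom right corner: expansion along the
  -- last row has sign + and deletes that column.
  det-lastRow : ∀ k rs → det (suc k) (rs ++ unitRow ∷ []) ≈ det k (map (λ r j → r (suc j)) rs)
  det-lastRow zero    []       = trans (+-congˡ (zeroʳ _)) (trans (+-identityʳ _) (*-identityˡ _))
  det-lastRow zero    (r ∷ rs) =
    0-0 (trans (*-congˡ (det-zeroRow′ rs)) (zeroʳ _)) (∧-zeroʳ (column 0) (λ _ → refl) (rs ++ unitRow ∷ [])) _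
    where
    det-zeroRow′ : ∀ rs → det 0 (rs ++ unitRow ∷ []) ≈ 0#
    det-zeroRow′ []      = refl
    det-zeroRow′ (_ ∷ _) = refl
  det-lastRow (suc k) rs = begin
    (column (suc k) ∧ det (suc k)) (rs ++ unitRow ∷ [])
      ≈⟨ drop (det (suc k)) rs ⟩
    (column (suc k) ∧ λ rs′ → det (suc k) (rs′ ++ unitRow ∷ [])) rs
      ≈⟨ ∧-cong (λ _ → refl) (det-lastRow k) rs ⟩
    (column (suc k) ∧ λ rs′ → det k (map (λ r j → r (suc j)) rs′)) rs
      ≈⟨ sym (∧-map {f = column k} (λ r j → r (suc j)) (λ _ → refl) rs) ⟩
    (column k ∧ det k) (map (λ r j → r (suc j)) rs) ∎
    where
    drop : ∀ ω rs → (column (suc k) ∧ ω) (rs ++ unitRow ∷ []) ≈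
                    (column (suc k) ∧ λ rs′ → ω (rs′ ++ unitRow ∷ [])) rs
    drop ω []       = 0-0 (zeroˡ _) refl _
    drop ω (r ∷ rs) = +-congˡ (*-congˡ (drop (λ rs′ → ω (r ∷ rs′)) rs))

-- The Jacobi–Trudi determinant as a product over hooks

-- Partitions, possibly with empty rows, built from the empty one by appending an
-- empty row at the bottom and by prepending a full column.
data Staircase : List ℕ → Set where
  []       : Staircase []
  emptyRow : ∀ {xs} → Staircase xs → Staircase (xs ++ 0 ∷ [])
  fullCol  : ∀ {xs} → Staircase xs → Staircase (map suc xs)

-- Induction on how the tail was built: a bottom empty row commutes with adding a top row, and a
-- full column of the tail extends to the new row, which is at least as long.
staircase-∷ : ∀ {x xs} → Staircase xs → All (_≤ x) xs → Staircase (x ∷ xs)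
staircase-∷ {zero}  []                        _  = emptyRow []
staircase-∷ {suc x} []                        _  = fullCol (staircase-∷ [] [])
staircase-∷         (emptyRow {xs} s)         ≤x = emptyRow (staircase-∷ s (init xs ≤x))
  where
  init : ∀ {x} xs → All (_≤ x) (xs ++ 0 ∷ []) → All (_≤ x) xs
  init []       _          = []
  init (_ ∷ xs) (y≤ ∷ ≤x) = y≤ ∷ init xs ≤x
staircase-∷ {zero}  (fullCol {[]} _)          _  = emptyRow []
staircase-∷ {zero}  (fullCol {_ ∷ _} _)       (() ∷ _)
staircase-∷ {suc x} (fullCol {xs} s)          ≤x = fullCol (staircase-∷ s (lower xs ≤x))
  where
  lower : ∀ {x} xs → All (_≤ suc x) (map suc xs) → All (_≤ x) xs
  lower []       _              = []
  lower (_ ∷ xs) (s≤s y≤ ∷ ≤x) = y≤ ∷ lower xs ≤x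

-- Height of column c, counted from 0. Applied to the rows below a cell of that column it is the leg
-- of the cell.
rowsLonger : ℕ → List ℕ → ℕ
rowsLonger c []       = 0
rowsLonger c (x ∷ xs) = (if c <ᵇ x then 1 else 0) ℕ.+ rowsLonger c xs

-- The numbers λ_i + ℓ - i for ℓ rows. They are hook lengths of the first column when no row is
-- empty, and in general the indices of the Toeplitz rows in the Jacobi-Trudi determinant.
firstColumnHooks : List ℕ → List ℕ
firstColumnHooks []       = []
firstColumnHooks (x ∷ xs) = (x ℕ.+ length xs) ∷ firstColumnHooks xs

module QNumbers {a ℓ} (R : CommutativeRing a ℓ) (q : CommutativeRing.Carrier R) where
  open CommutativeRing R
  open QAnalogues R
  open SetoidReasoning setoid
  open Solver commutativeSemiring using (solve; _:+_; _:*_; _:=_; con)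

  p : Carrier
  p = 1# + - q

  InvertsPositive : (ℕ → Carrier) → Set ℓ
  InvertsPositive inv = ∀ k → [ suc k ] q * inv k ≈ 1#

  PCancellative : Set (a ⊔ ℓ)
  PCancellative = ∀ {x y} → p * x ≈ p * y → x ≈ y

  p+q≈1 : p + q ≈ 1#
  p+q≈1 = trans (+-assoc 1# (- q) q) (trans (+-congˡ (-‿inverseˡ q)) (+-identityʳ 1#))

  [suc]≈ : ∀ k → [ suc k ] q ≈ 1# + q * [ k ] q
  [suc]≈ k = +-congˡ (shift k λ i → i)
    where
    shift : ∀ k f → ∑[ i ∈ applyUpTo (λ i → suc (f i)) k ] (q ^ i) ≈ q * ∑[ i ∈ applyUpTo f k ] (q ^ i)
    shift zero    f = sym (zeroʳ q)
    shift (suc k) f = trans (+-congˡ (shift k (λ i → f (suc i)))) (sym (distribˡ q _ _))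

  -- The identity 1 - q^k = p [k], arranged without subtraction so that the semiring solver can use
  -- it.
  p*[k]+q^k≈1 : ∀ k → p * [ k ] q + q ^ k ≈ 1#
  p*[k]+q^k≈1 zero    = trans (+-congʳ (zeroʳ p)) (+-identityˡ 1#)
  p*[k]+q^k≈1 (suc k) = begin
    p * [ suc k ] q + q * q ^ k        ≈⟨ +-congʳ (*-congˡ ([suc]≈ k)) ⟩
    p * (1# + q * [ k ] q) + q * q ^ k ≈⟨ solve 4 (λ p q u v → p :* (con 1 :+ q :* u) :+ q :* v := p :+ q :* (p :* u :+ v)) refl p q _ _ ⟩
    p + q * (p * [ k ] q + q ^ k)      ≈⟨ +-congˡ (trans (*-congˡ (p*[k]+q^k≈1 k)) (*-identityʳ q)) ⟩
    p + q                              ≈⟨ p+q≈1 ⟩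
    1# ∎

  [+]≈ : ∀ k m → [ k ℕ.+ m ] q ≈ [ k ] q + q ^ k * [ m ] q
  [+]≈ zero    m = trans (sym (*-identityˡ _)) (sym (+-identityˡ _))
  [+]≈ (suc k) m = begin
    [ suc (k ℕ.+ m) ] q                          ≈⟨ [suc]≈ (k ℕ.+ m) ⟩
    1# + q * [ k ℕ.+ m ] q                       ≈⟨ +-congˡ (*-congˡ ([+]≈ k m)) ⟩
    1# + q * ([ k ] q + q ^ k * [ m ] q)         ≈⟨ solve 4 (λ q u v w → con 1 :+ q :* (u :+ v :* w) := con 1 :+ q :* u :+ q :* v :* w) refl q _ _ _ ⟩
    1# + q * [ k ] q + q * q ^ k * [ m ] q       ≈⟨ +-congʳ (sym ([suc]≈ k)) ⟩
    [ suc k ] q + q * q ^ k * [ m ] q ∎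

  ∏↑ : ℕ → (ℕ → Carrier) → Carrier
  ∏↑ zero    f = 1#
  ∏↑ (suc k) f = f 0 * ∏↑ k (λ c → f (suc c))

  ∏↑-cong : ∀ k {f g} → (∀ c → f c ≈ g c) → ∏↑ k f ≈ ∏↑ k g
  ∏↑-cong zero    f≈g = refl
  ∏↑-cong (suc k) f≈g = *-cong (f≈g 0) (∏↑-cong k (λ c → f≈g (suc c)))

  hookProduct : List ℕ → Carrier
  hookProduct []       = 1#
  hookProduct (x ∷ xs) = ∏↑ x (λ c → [ (x ∸ c) ℕ.+ rowsLonger c xs ] q) * hookProduct xs

  contentProduct : Carrier → Carrier → List ℕ → Carrier
  contentProduct x y []       = 1#
  contentProduct x y (k ∷ ks) = ∏↑ k (λ c → x + y * q ^ c) * contentProduct (q * x) y ks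

module JacobiTrudi {a ℓ} (R : CommutativeRing a ℓ) (q : CommutativeRing.Carrier R)
  (inv : ℕ → CommutativeRing.Carrier R) ([suc]*inv≈1 : QNumbers.InvertsPositive R q inv) where

  open CommutativeRing R
  open QAnalogues R
  open QNumbers R q
  open Determinant R
  open Exp semiring using (^-homo-*)
  open SetoidReasoning setoid
  open Solver commutativeSemiring using (solve; _:+_; _:*_; _:=_; con)

  [suc]-cancel : ∀ k {u v} → [ suc k ] q * u ≈ [ suc k ] q * v → u ≈ v
  [suc]-cancel k {u} {v} eq = begin
    u                        ≈⟨ undo u ⟨
    inv k * ([ suc k ] q * u) ≈⟨ *-congˡ eq ⟩
    inv k * ([ suc k ] q * v) ≈⟨ undo v ⟩
    v ∎
    where
    undo : ∀ w → inv k * ([ suc k ] q * w) ≈ w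
    undo w = begin
      inv k * ([ suc k ] q * w) ≈⟨ solve 3 (λ i s w → i :* (s :* w) := s :* i :* w) refl _ _ _ ⟩
      [ suc k ] q * inv k * w   ≈⟨ *-congʳ ([suc]*inv≈1 k) ⟩
      1# * w                    ≈⟨ *-identityˡ w ⟩
      w ∎

  binomialProduct : Carrier → Carrier → ℕ → Carrier
  binomialProduct x y zero    = 1#
  binomialProduct x y (suc m) = (x + y) * binomialProduct x (q * y) m

  invFactorial : ℕ → Carrier
  invFactorial zero    = 1#
  invFactorial (suc m) = inv m * invFactorial m

  -- (1 - q)^m h_m of the super alphabet x, xq, xq², … / y, yq, yq², …, that is
  -- (x + y)(x + yq) ⋯ (x + yq^(m-1)) / [m]!.
  h : Carrier → Carrier → ℕ → Carrier
  h x y m = binomialProduct x y m * invFactorial m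

  private
    b-last : ∀ x y m → binomialProduct x y (suc m) ≈ (x + y * q ^ m) * binomialProduct x y m
    b-last x y zero    = *-congʳ (+-congˡ (sym (*-identityʳ y)))
    b-last x y (suc m) = begin
      (x + y) * binomialProduct x (q * y) (suc m) ≈⟨ *-congˡ (b-last x (q * y) m) ⟩
      (x + y) * ((x + q * y * q ^ m) * binomialProduct x (q * y) m)
        ≈⟨ solve 5 (λ x y q Q b → (x :+ y) :* ((x :+ q :* y :* Q) :* b) := (x :+ y :* (q :* Q)) :* ((x :+ y) :* b)) refl x y q _ _ ⟩
      (x + y * (q * q ^ m)) * ((x + y) * binomialProduct x (q * y) m) ∎

    b-scale : ∀ x y m → binomialProduct (q * x) (q * y) m ≈ q ^ m * binomialProduct x y m
    b-scale x y zero    = sym (*-identityˡ 1#)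
    b-scale x y (suc m) = begin
      (q * x + q * y) * binomialProduct (q * x) (q * (q * y)) m ≈⟨ *-congˡ (b-scale x (q * y) m) ⟩
      (q * x + q * y) * (q ^ m * binomialProduct x (q * y) m)
        ≈⟨ solve 5 (λ x y q Q b → (q :* x :+ q :* y) :* (Q :* b) := q :* Q :* ((x :+ y) :* b)) refl x y q _ _ ⟩
      q * q ^ m * ((x + y) * binomialProduct x (q * y) m) ∎

    [suc]*h : ∀ x y m {c b} → binomialProduct x y (suc m) ≈ c * b →
              [ suc m ] q * h x y (suc m) ≈ c * (b * invFactorial m)
    [suc]*h x y m {c} {b} eq = begin
      [ suc m ] q * (binomialProduct x y (suc m) * (inv m * invFactorial m))
        ≈⟨ *-congˡ (*-congʳ eq) ⟩
      [ suc m ] q * (c * b * (inv m * invFactorial m))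
        ≈⟨ solve 5 (λ s c b i f → s :* (c :* b :* (i :* f)) := s :* i :* (c :* (b :* f))) refl _ c b _ _ ⟩
      [ suc m ] q * inv m * (c * (b * invFactorial m)) ≈⟨ *-congʳ ([suc]*inv≈1 m) ⟩
      1# * (c * (b * invFactorial m)) ≈⟨ *-identityˡ _ ⟩
      c * (b * invFactorial m) ∎

    [suc]*h-first : ∀ x y m → [ suc m ] q * h x y (suc m) ≈ (x + y) * h x (q * y) m
    [suc]*h-first x y m = [suc]*h x y m refl

    [suc]*h-last : ∀ x y m → [ suc m ] q * h x y (suc m) ≈ (x + y * q ^ m) * h x y m
    [suc]*h-last x y m = [suc]*h x y m (b-last x y m)

  h-scale : ∀ x y m → h (q * x) (q * y) m ≈ q ^ m * h x y m
  h-scale x y m = trans (*-congʳ (b-scale x y m)) (*-assoc _ _ _)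

  -- Multiplied by `[ suc m ] q`, the left side is (x + y) `h′ m`. Splitting y by 1 = p [m+1] +
  -- q^(m+1) produces the last factor of `h′ (suc m)` and a correction that is itself divisible by
  -- [m+1].
  h-negative : ∀ x y m → h x y (suc m) ≈ h x (q * y) (suc m) + p * y * h x (q * y) m
  h-negative x y m = [suc]-cancel m (begin
    [ suc m ] q * h x y (suc m) ≈⟨ [suc]*h-first x y m ⟩
    (x + y) * h′ m
      ≈⟨ *-congʳ (+-congˡ (trans (sym (*-identityʳ y)) (*-congˡ (sym (p*[k]+q^k≈1 (suc m)))))) ⟩
    (x + y * (p * [ suc m ] q + q * q ^ m)) * h′ m
      ≈⟨ solve 7 (λ x y p q Q s h → (x :+ y :* (p :* s :+ q :* Q)) :* h :=
                   (x :+ q :* y :* Q) :* h :+ s :* (p :* y :* h)) refl x y p q _ _ _ ⟩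
    (x + q * y * q ^ m) * h′ m + [ suc m ] q * (p * y * h′ m)
      ≈⟨ +-congʳ (sym ([suc]*h-last x (q * y) m)) ⟩
    [ suc m ] q * h′ (suc m) + [ suc m ] q * (p * y * h′ m) ≈⟨ sym (distribˡ _ _ _) ⟩
    [ suc m ] q * (h′ (suc m) + p * y * h′ m) ∎)
    where h′ = h x (q * y)

  -- The same splitting, now of x and after peeling off the last factor instead of the first;
  -- homogeneity absorbs the power q^m that is left.
  h-positive : ∀ x y m → h x y (suc m) ≈ h (q * x) y (suc m) + p * x * h x y m
  h-positive x y m = [suc]-cancel m (begin
    [ suc m ] q * h x y (suc m) ≈⟨ [suc]*h-last x y m ⟩
    (x + y * q ^ m) * h x y m
      ≈⟨ *-congʳ (+-congʳ (trans (sym (*-identityʳ x)) (*-congˡ (sym (p*[k]+q^k≈1 (suc m)))))) ⟩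
    (x * (p * [ suc m ] q + q * q ^ m) + y * q ^ m) * h x y m
      ≈⟨ solve 7 (λ x y p q Q s h → (x :* (p :* s :+ q :* Q) :+ y :* Q) :* h :=
                   (q :* x :+ y) :* (Q :* h) :+ s :* (p :* x :* h)) refl x y p q _ _ _ ⟩
    (q * x + y) * (q ^ m * h x y m) + [ suc m ] q * (p * x * h x y m)
      ≈⟨ +-congʳ (*-congˡ (sym (h-scale x y m))) ⟩
    (q * x + y) * h (q * x) (q * y) m + [ suc m ] q * (p * x * h x y m)
      ≈⟨ +-congʳ (sym ([suc]*h-first (q * x) y m)) ⟩
    [ suc m ] q * h (q * x) y (suc m) + [ suc m ] q * (p * x * h x y m) ≈⟨ sym (distribˡ _ _ _) ⟩
    [ suc m ] q * (h (q * x) y (suc m) + p * x * h x y m) ∎)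

  -- The row (f (l - k))ₖ, where f is 0 at negative arguments.
  toeplitzRow : (ℕ → Carrier) → ℕ → Row
  toeplitzRow f l       zero    = f l
  toeplitzRow f zero    (suc k) = 0#
  toeplitzRow f (suc l) (suc k) = toeplitzRow f l k

  private
    row-+ : ∀ f k m j → toeplitzRow f (k ℕ.+ m) (k ℕ.+ j) ≡ toeplitzRow f m j
    row-+ f zero    m j = ≡.refl
    row-+ f (suc k) m j = row-+ f k m j

    row-< : ∀ f {l k} → l ℕ.< k → toeplitzRow f l k ≡ 0#
    row-< f {zero}  {suc k} _         = ≡.refl
    row-< f {suc l} {suc k} (s≤s l<k) = row-< f l<k

  -- The entrywise source of the column operations. Once the row index is lowered by one, the first
  -- term is a multiple of the entry for (x, qy) in the same column and the second a multiple of the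
  -- entry in the column to its right. For l = k + m one has [l] = [k] + q^k [m]; `h-negative`
  -- rewrites the part with [k] and `[suc]*h-first` the part with [m].
  row-peel : ∀ x y l k → [ l ] q * toeplitzRow (h x y) l k ≈
    (x * q ^ k + y) * toeplitzRow (h x (q * y)) l (suc k) + [ k ] q * toeplitzRow (h x (q * y)) l k
  row-peel x y l k with k ℕ.≤? l
  ... | no k≰l = begin
    [ l ] q * toeplitzRow (h x y) l k ≡⟨ ≡.cong ([ l ] q *_) (row-< _ l<k) ⟩
    [ l ] q * 0# ≈⟨ zeroʳ _ ⟩
    0# ≈⟨ sym (+-identityˡ 0#) ⟩
    0# + 0# ≈⟨ +-cong (sym (zeroʳ _)) (sym (zeroʳ _)) ⟩
    (x * q ^ k + y) * 0# + [ k ] q * 0#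
      ≡⟨ ≡.cong₂ (λ u v → (x * q ^ k + y) * u + [ k ] q * v) (row-< _ (ℕ.m<n⇒m<1+n l<k)) (row-< _ l<k) ⟨
    (x * q ^ k + y) * toeplitzRow h′ l (suc k) + [ k ] q * toeplitzRow h′ l k ∎
    where
    l<k = ℕ.≰⇒> k≰l
    h′  = h x (q * y)
  ... | yes k≤l with m , ≡.refl ← ℕ.m≤n⇒∃[o]m+o≡n k≤l = begin
    [ k ℕ.+ m ] q * toeplitzRow (h x y) (k ℕ.+ m) k
      ≡⟨ ≡.cong ([ k ℕ.+ m ] q *_) (at-k (h x y)) ⟩
    [ k ℕ.+ m ] q * h x y m ≈⟨ main m ⟩
    (x * q ^ k + y) * toeplitzRow h′ m 1 + [ k ] q * h′ m
      ≡⟨ ≡.cong₂ (λ u v → (x * q ^ k + y) * u + [ k ] q * v) at-suc-k (at-k h′) ⟨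
    (x * q ^ k + y) * toeplitzRow h′ (k ℕ.+ m) (suc k) + [ k ] q * toeplitzRow h′ (k ℕ.+ m) k ∎
    where
    h′ = h x (q * y)

    at-k : ∀ f → toeplitzRow f (k ℕ.+ m) k ≡ f m
    at-k f = ≡.trans (≡.cong (toeplitzRow f (k ℕ.+ m)) (≡.sym (ℕ.+-identityʳ k))) (row-+ f k m 0)

    at-suc-k : toeplitzRow h′ (k ℕ.+ m) (suc k) ≡ toeplitzRow h′ m 1
    at-suc-k = ≡.trans (≡.cong (toeplitzRow h′ (k ℕ.+ m)) (ℕ.+-comm 1 k)) (row-+ h′ k m 1)

    -- `toeplitzRow h′ m 1` is h′ at m - 1, with value 0 for m = 0, so one formula covers both
    -- cases.
    main : ∀ m → [ k ℕ.+ m ] q * h x y m ≈ (x * q ^ k + y) * toeplitzRow h′ m 1 + [ k ] q * h′ m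
    main zero    = begin
      [ k ℕ.+ 0 ] q * h x y 0 ≡⟨ ≡.cong (λ i → [ i ] q * h x y 0) (ℕ.+-identityʳ k) ⟩
      [ k ] q * h x y 0       ≈⟨ sym (+-identityˡ _) ⟩
      0# + [ k ] q * h x y 0  ≈⟨ +-congʳ (sym (zeroʳ _)) ⟩
      (x * q ^ k + y) * 0# + [ k ] q * h x y 0 ∎
    main (suc m) = begin
      [ k ℕ.+ suc m ] q * h x y (suc m) ≈⟨ *-congʳ ([+]≈ k (suc m)) ⟩
      ([ k ] q + q ^ k * [ suc m ] q) * h x y (suc m)
        ≈⟨ solve 4 (λ s Q r h → (s :+ Q :* r) :* h := s :* h :+ Q :* (r :* h)) refl _ _ _ _ ⟩
      [ k ] q * h x y (suc m) + q ^ k * ([ suc m ] q * h x y (suc m))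
        ≈⟨ +-cong (*-congˡ (h-negative x y m)) (*-congˡ ([suc]*h-first x y m)) ⟩
      [ k ] q * (h′ (suc m) + p * y * h′ m) + q ^ k * ((x + y) * h′ m)
        ≈⟨ solve 7 (λ x y p Q s g f → s :* (g :+ p :* y :* f) :+ Q :* ((x :+ y) :* f) :=
                     (x :* Q :+ y :* (p :* s :+ Q)) :* f :+ s :* g) refl x y p _ _ _ _ ⟩
      (x * q ^ k + y * (p * [ k ] q + q ^ k)) * h′ m + [ k ] q * h′ (suc m)
        ≈⟨ +-congʳ (*-congʳ (+-congˡ (trans (*-congˡ (p*[k]+q^k≈1 k)) (*-identityʳ y)))) ⟩
      (x * q ^ k + y) * h′ m + [ k ] q * h′ (suc m) ∎

  jacobiTrudi : (ℕ → Carrier) → List ℕ → Carrier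
  jacobiTrudi f xs = det (length xs) (map (toeplitzRow f) (firstColumnHooks xs))

  private
    hookProduct-emptyRow : ∀ xs → hookProduct (xs ++ 0 ∷ []) ≈ hookProduct xs
    hookProduct-emptyRow []       = *-identityˡ 1#
    hookProduct-emptyRow (x ∷ xs) = *-cong
      (∏↑-cong x (λ c → reflexive (≡.cong (λ i → [ (x ∸ c) ℕ.+ i ] q) (same c xs))))
      (hookProduct-emptyRow xs)
      where
      same : ∀ c xs → rowsLonger c (xs ++ 0 ∷ []) ≡ rowsLonger c xs
      same c []       = ≡.refl
      same c (x ∷ xs) = ≡.cong ((if c <ᵇ x then 1 else 0) ℕ.+_) (same c xs)

    contentProduct-emptyRow : ∀ x y xs → contentProduct x y (xs ++ 0 ∷ []) ≈ contentProduct x y xs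
    contentProduct-emptyRow x y []       = *-identityˡ 1#
    contentProduct-emptyRow x y (k ∷ ks) = *-congˡ (contentProduct-emptyRow (q * x) y ks)

    ∏[suc] : List ℕ → Carrier
    ∏[suc] = foldr (λ l z → [ suc l ] q * z) 1#

    -- The old cells move one column to the right and keep their arms and legs; the new first column
    -- contributes the hooks `suc l`.
    hookProduct-fullCol : ∀ xs → hookProduct (map suc xs) ≈ ∏[suc] (firstColumnHooks xs) * hookProduct xs
    hookProduct-fullCol []       = sym (*-identityˡ 1#)
    hookProduct-fullCol (x ∷ xs) = begin
      [ suc x ℕ.+ rowsLonger 0 (map suc xs) ] q * ∏↑ x (λ c → [ (x ∸ c) ℕ.+ rowsLonger (suc c) (map suc xs) ] q)
        * hookProduct (map suc xs)
        ≈⟨ *-cong (*-cong (reflexive (≡.cong (λ i → [ suc x ℕ.+ i ] q) (first xs)))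
                          (∏↑-cong x (λ c → reflexive (≡.cong (λ i → [ (x ∸ c) ℕ.+ i ] q) (others c xs)))))
                  (hookProduct-fullCol xs) ⟩
      [ suc x ℕ.+ length xs ] q * ∏↑ x (λ c → [ (x ∸ c) ℕ.+ rowsLonger c xs ] q)
        * (∏[suc] (firstColumnHooks xs) * hookProduct xs)
        ≈⟨ solve 4 (λ a b c d → a :* b :* (c :* d) := a :* c :* (b :* d)) refl _ _ _ _ ⟩
      _ * (∏↑ x _ * hookProduct xs) ∎
      where
      first : ∀ xs → rowsLonger 0 (map suc xs) ≡ length xs
      first []       = ≡.refl
      first (_ ∷ xs) = ≡.cong suc (first xs)

      others : ∀ c xs → rowsLonger (suc c) (map suc xs) ≡ rowsLonger c xs
      others c []       = ≡.refl
      others c (x ∷ xs) = ≡.cong ((if c <ᵇ x then 1 else 0) ℕ.+_) (others c xs)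

    contentProduct-fullCol : ∀ x y xs → contentProduct x y (map suc xs) ≈
      ∏↑ (length xs) (λ k → x * q ^ k + y) * contentProduct x (q * y) xs
    contentProduct-fullCol x y []       = sym (*-identityˡ 1#)
    contentProduct-fullCol x y (k ∷ ks) = begin
      (x + y * 1#) * ∏↑ k (λ c → x + y * (q * q ^ c)) * contentProduct (q * x) y (map suc ks)
        ≈⟨ *-cong (*-cong (solve 2 (λ x y → x :+ y :* con 1 := x :* con 1 :+ y) refl x y)
                          (∏↑-cong k λ c → solve 4 (λ x y q Q → x :+ y :* (q :* Q) := x :+ q :* y :* Q) refl x y q _))
                  (contentProduct-fullCol (q * x) y ks) ⟩
      (x * 1# + y) * ∏↑ k (λ c → x + q * y * q ^ c)
        * (∏↑ (length ks) (λ k → q * x * q ^ k + y) * contentProduct (q * x) (q * y) ks)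
        ≈⟨ *-congˡ (*-congʳ (∏↑-cong (length ks) λ k → solve 4 (λ x y q Q → q :* x :* Q :+ y := x :* (q :* Q) :+ y) refl x y q _)) ⟩
      (x * 1# + y) * ∏↑ k (λ c → x + q * y * q ^ c)
        * (∏↑ (length ks) (λ k → x * (q * q ^ k) + y) * contentProduct (q * x) (q * y) ks)
        ≈⟨ solve 4 (λ a b c d → a :* b :* (c :* d) := a :* c :* (b :* d)) refl _ _ _ _ ⟩
      _ * (∏↑ k _ * contentProduct (q * x) (q * y) ks) ∎

    ∏<≈∏↑ : ∀ k f → ∏< k f ≈ ∏↑ k f
    ∏<≈∏↑ zero    f = refl
    ∏<≈∏↑ (suc k) f = trans (*-congˡ (∏<≈∏↑ k f)) (last k f)
      where
      last : ∀ k f → f k * ∏↑ k f ≈ f 0 * ∏↑ k (λ c → f (suc c))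
      last zero    f = refl
      last (suc k) f = begin
        f (suc k) * (f 0 * ∏↑ k (λ c → f (suc c)))
          ≈⟨ solve 3 (λ a b c → a :* (b :* c) := b :* (a :* c)) refl _ _ _ ⟩
        f 0 * (f (suc k) * ∏↑ k (λ c → f (suc c))) ≈⟨ *-congˡ (last k (λ c → f (suc c))) ⟩
        f 0 * (f 1 * ∏↑ k (λ c → f (suc (suc c)))) ∎

    -- The new bottom row has index 0, so it is the unit row, and expansion removes it with the last
    -- column. All other indices went up by one, which the removed column undoes.
    jacobiTrudi-emptyRow : ∀ x y xs → jacobiTrudi (h x y) (xs ++ 0 ∷ []) ≈ jacobiTrudi (h x y) xs
    jacobiTrudi-emptyRow x y xs = begin
      det (length (xs ++ 0 ∷ [])) (map ρ (firstColumnHooks (xs ++ 0 ∷ [])))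
        ≡⟨ ≡.cong₂ (λ n ls → det n (map ρ ls)) (length-∷ʳ xs) (hooks xs) ⟩
      det (suc (length xs)) (map ρ (map suc ls ++ 0 ∷ []))
        ≡⟨ ≡.cong (det (suc (length xs))) (map-++ ρ (map suc ls) (0 ∷ [])) ⟩
      det (suc (length xs)) (map ρ (map suc ls) ++ ρ 0 ∷ [])
        ≈⟨ det-scaleRow (suc (length xs)) 1# {w = unitRow} unit (map ρ (map suc ls)) [] ⟩
      1# * det (suc (length xs)) (map ρ (map suc ls) ++ unitRow ∷ [])
        ≈⟨ *-identityˡ _ ⟩
      det (suc (length xs)) (map ρ (map suc ls) ++ unitRow ∷ [])
        ≈⟨ det-lastRow (length xs) (map ρ (map suc ls)) ⟩
      det (length xs) (map (λ r j → r (suc j)) (map ρ (map suc ls)))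
        ≡⟨ ≡.cong (det (length xs)) (≡.trans (≡.cong (map (λ r j → r (suc j))) (≡.sym (map-∘ ls))) (≡.sym (map-∘ ls))) ⟩
      det (length xs) (map ρ ls) ∎
      where
      ρ = toeplitzRow (h x y)
      ls  = firstColumnHooks xs

      length-∷ʳ : ∀ (xs : List ℕ) → length (xs ++ 0 ∷ []) ≡ suc (length xs)
      length-∷ʳ xs = ≡.trans (length-++ xs) (ℕ.+-comm (length xs) 1)

      hooks : ∀ xs → firstColumnHooks (xs ++ 0 ∷ []) ≡ map suc (firstColumnHooks xs) ++ 0 ∷ []
      hooks []       = ≡.refl
      hooks (x ∷ xs) = ≡.cong₂ _∷_ (≡.trans (≡.cong (x ℕ.+_) (length-∷ʳ xs)) (ℕ.+-suc x _)) (hooks xs)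

      unit : ∀ j → ρ 0 j ≈ 1# * unitRow j
      unit zero    = refl
      unit (suc j) = sym (zeroʳ 1#)

    -- The hooks of the new column serve as row multipliers: they make `row-peel` applicable to
    -- every entry. The column operations then discard the neighbour terms and pull out one linear
    -- factor per column.
    jacobiTrudi-fullCol : ∀ x y xs →
      ∏[suc] (firstColumnHooks xs) * jacobiTrudi (h x y) (map suc xs) ≈
      ∏↑ (length xs) (λ k → x * q ^ k + y) * jacobiTrudi (h x (q * y)) xs
    jacobiTrudi-fullCol x y xs = begin
      ∏[suc] ls * det (length (map suc xs)) (map (ρ y) (firstColumnHooks (map suc xs)))
        ≡⟨ ≡.cong₂ (λ n rs → ∏[suc] ls * det n rs) (length-map suc xs)
             (≡.trans (≡.cong (map (ρ y)) (hooks xs)) (≡.sym (map-∘ ls))) ⟩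
      ∏[suc] ls * det ℓ′ (map (λ l → ρ y (suc l)) ls)
        ≈⟨ sym (det-scaleRows ℓ′ (λ l → [ suc l ] q) (λ _ _ → refl) [] ls) ⟩
      det ℓ′ (map (λ l j → [ suc l ] q * ρ y (suc l) j) ls)
        ≈⟨ det-cong ℓ′ peel ls ⟩
      det ℓ′ (map (λ l j → (x * q ^ j + y) * ρ (q * y) l j + leftNeighbour (λ k → [ k ] q) (ρ (q * y) l) j) ls)
        ≡⟨ ≡.cong (det ℓ′) (map-∘ ls) ⟩
      det ℓ′ (map (λ r j → (x * q ^ j + y) * r j + leftNeighbour (λ k → [ k ] q) r j) (map (ρ (q * y)) ls))
        ≈⟨ det-columns ℓ′ _ _ (map (ρ (q * y)) ls) ⟩
      ∏< ℓ′ (λ k → x * q ^ k + y) * det ℓ′ (map (ρ (q * y)) ls)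
        ≈⟨ *-congʳ (∏<≈∏↑ ℓ′ _) ⟩
      ∏↑ ℓ′ (λ k → x * q ^ k + y) * det ℓ′ (map (ρ (q * y)) ls) ∎
      where
      ls    = firstColumnHooks xs
      ℓ′    = length xs
      ρ   = λ y → toeplitzRow (h x y)

      hooks : ∀ xs → firstColumnHooks (map suc xs) ≡ map suc (firstColumnHooks xs)
      hooks []       = ≡.refl
      hooks (x ∷ xs) = ≡.cong₂ _∷_ (≡.cong (λ n → suc (x ℕ.+ n)) (length-map suc xs)) (hooks xs)

      peel : ∀ l j → [ suc l ] q * ρ y (suc l) j ≈
             (x * q ^ j + y) * ρ (q * y) l j + leftNeighbour (λ k → [ k ] q) (ρ (q * y) l) j
      peel l zero    = trans (row-peel x y (suc l) 0) (+-congˡ (zeroˡ _))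
      peel l (suc j) = row-peel x y (suc l) (suc j)

  jacobiTrudi≈content/hook : ∀ {xs} → Staircase xs → ∀ x y →
                             jacobiTrudi (h x y) xs * hookProduct xs ≈ contentProduct x y xs
  jacobiTrudi≈content/hook []                x y = *-identityˡ 1#
  jacobiTrudi≈content/hook (emptyRow {xs} s) x y = begin
    jacobiTrudi (h x y) (xs ++ 0 ∷ []) * hookProduct (xs ++ 0 ∷ [])
      ≈⟨ *-cong (jacobiTrudi-emptyRow x y xs) (hookProduct-emptyRow xs) ⟩
    jacobiTrudi (h x y) xs * hookProduct xs ≈⟨ jacobiTrudi≈content/hook s x y ⟩
    contentProduct x y xs                   ≈⟨ contentProduct-emptyRow x y xs ⟨
    contentProduct x y (xs ++ 0 ∷ []) ∎
  jacobiTrudi≈content/hook (fullCol {xs} s)  x y = begin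
    jacobiTrudi (h x y) (map suc xs) * hookProduct (map suc xs)
      ≈⟨ *-congˡ (hookProduct-fullCol xs) ⟩
    jacobiTrudi (h x y) (map suc xs) * (∏[suc] ls * hookProduct xs)
      ≈⟨ solve 3 (λ a b c → a :* (b :* c) := b :* a :* c) refl _ _ _ ⟩
    ∏[suc] ls * jacobiTrudi (h x y) (map suc xs) * hookProduct xs
      ≈⟨ *-congʳ (jacobiTrudi-fullCol x y xs) ⟩
    ∏↑ (length xs) _ * jacobiTrudi (h x (q * y)) xs * hookProduct xs ≈⟨ *-assoc _ _ _ ⟩
    ∏↑ (length xs) _ * (jacobiTrudi (h x (q * y)) xs * hookProduct xs)
      ≈⟨ *-congˡ (jacobiTrudi≈content/hook s x (q * y)) ⟩
    ∏↑ (length xs) _ * contentProduct x (q * y) xs ≈⟨ contentProduct-fullCol x y xs ⟨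
    contentProduct x y (map suc xs) ∎
    where ls = firstColumnHooks xs

  -- Homogeneity of degree |λ| in (x, y): each prepended column contributes one factor q per row.
  -- The hooks introduced by `jacobiTrudi-fullCol` are units and cancel.
  jacobiTrudi-scale : ∀ {xs} → Staircase xs → ∀ x y →
                      jacobiTrudi (h (q * x) (q * y)) xs ≈ q ^ sum xs * jacobiTrudi (h x y) xs
  jacobiTrudi-scale []                x y = sym (*-identityˡ 1#)
  jacobiTrudi-scale (emptyRow {xs} s) x y = begin
    jacobiTrudi (h (q * x) (q * y)) (xs ++ 0 ∷ []) ≈⟨ jacobiTrudi-emptyRow (q * x) (q * y) xs ⟩
    jacobiTrudi (h (q * x) (q * y)) xs             ≈⟨ jacobiTrudi-scale s x y ⟩
    q ^ sum xs * jacobiTrudi (h x y) xs            ≈⟨ *-cong (reflexive (≡.cong (q ^_) sum≡)) (sym (jacobiTrudi-emptyRow x y xs)) ⟩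
    q ^ sum (xs ++ 0 ∷ []) * jacobiTrudi (h x y) (xs ++ 0 ∷ []) ∎
    where
    sum≡ : sum xs ≡ sum (xs ++ 0 ∷ [])
    sum≡ = ≡.sym (≡.trans (sum-++ xs (0 ∷ [])) (ℕ.+-identityʳ _))
  jacobiTrudi-scale (fullCol {xs} s)  x y = ∏[suc]-cancel ls (begin
    ∏[suc] ls * jacobiTrudi (h (q * x) (q * y)) (map suc xs)
      ≈⟨ jacobiTrudi-fullCol (q * x) (q * y) xs ⟩
    ∏↑ (length xs) (λ k → q * x * q ^ k + q * y) * jacobiTrudi (h (q * x) (q * (q * y))) xs
      ≈⟨ *-cong (columns (length xs) x) (jacobiTrudi-scale s x (q * y)) ⟩
    q ^ length xs * ∏↑ (length xs) (λ k → x * q ^ k + y) * (q ^ sum xs * jacobiTrudi (h x (q * y)) xs)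
      ≈⟨ solve 4 (λ a b c d → a :* b :* (c :* d) := a :* c :* (b :* d)) refl _ _ _ _ ⟩
    q ^ length xs * q ^ sum xs * (∏↑ (length xs) (λ k → x * q ^ k + y) * jacobiTrudi (h x (q * y)) xs)
      ≈⟨ *-cong (sym (trans (reflexive (≡.cong (q ^_) (sum≡ xs))) (^-homo-* q (length xs) (sum xs))))
                (sym (jacobiTrudi-fullCol x y xs)) ⟩
    q ^ sum (map suc xs) * (∏[suc] ls * jacobiTrudi (h x y) (map suc xs))
      ≈⟨ solve 3 (λ a b c → a :* (b :* c) := b :* (a :* c)) refl _ _ _ ⟩
    ∏[suc] ls * (q ^ sum (map suc xs) * jacobiTrudi (h x y) (map suc xs)) ∎)
    where
    ls = firstColumnHooks xs

    ∏[suc]-cancel : ∀ ls {u v} → ∏[suc] ls * u ≈ ∏[suc] ls * v → u ≈ v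
    ∏[suc]-cancel []       eq = trans (sym (*-identityˡ _)) (trans eq (*-identityˡ _))
    ∏[suc]-cancel (l ∷ ls) eq =
      ∏[suc]-cancel ls ([suc]-cancel l (trans (sym (*-assoc _ _ _)) (trans eq (*-assoc _ _ _))))

    sum≡ : ∀ xs → sum (map suc xs) ≡ length xs ℕ.+ sum xs
    sum≡ []       = ≡.refl
    sum≡ (x ∷ xs) = ≡.cong suc (≡.trans (≡.cong (x ℕ.+_) (sum≡ xs)) (CommutativeSemigroup.x∙yz≈y∙xz ℕ.+-commutativeSemigroup x (length xs) (sum xs)))

    columns : ∀ n x → ∏↑ n (λ k → q * x * q ^ k + q * y) ≈ q ^ n * ∏↑ n (λ k → x * q ^ k + y)
    columns zero    x = sym (*-identityˡ 1#)
    columns (suc n) x = begin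
      (q * x * 1# + q * y) * ∏↑ n (λ k → q * x * (q * q ^ k) + q * y)
        ≈⟨ *-congˡ (∏↑-cong n λ k → solve 4 (λ q x y Q → q :* x :* (q :* Q) :+ q :* y := q :* (q :* x) :* Q :+ q :* y) refl q x y _) ⟩
      (q * x * 1# + q * y) * ∏↑ n (λ k → q * (q * x) * q ^ k + q * y)
        ≈⟨ *-congˡ (columns n (q * x)) ⟩
      (q * x * 1# + q * y) * (q ^ n * ∏↑ n (λ k → q * x * q ^ k + y))
        ≈⟨ *-congˡ (*-congˡ (∏↑-cong n λ k → solve 4 (λ q x y Q → q :* x :* Q :+ y := x :* (q :* Q) :+ y) refl q x y _)) ⟩
      (q * x * 1# + q * y) * (q ^ n * ∏↑ n (λ k → x * (q * q ^ k) + y))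
        ≈⟨ solve 5 (λ q x y Q P → (q :* x :* con 1 :+ q :* y) :* (Q :* P) := q :* Q :* ((x :* con 1 :+ y) :* P)) refl q x y _ _ ⟩
      q * q ^ n * ((x * 1# + y) * ∏↑ n (λ k → x * (q * q ^ k) + y)) ∎

-- Words

Shape : ℕ → Set
Shape = Vector ℕ

dec : ∀ {ℓ} → Shape ℓ → Fin ℓ → Shape ℓ
dec μ i = updateAt μ i pred

size : ∀ {ℓ} → Shape ℓ → ℕ
size μ = sum (tabulate μ)

IsPartition : ∀ {ℓ} → Shape ℓ → Set
IsPartition μ = ∀ i j → i Fin.< j → μ j ≤ μ i

Removable : ∀ {ℓ} → Shape ℓ → Fin ℓ → Set
Removable μ i = 0 < μ i × (∀ j → i Fin.< j → μ j < μ i)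

removable? : ∀ {ℓ} (μ : Shape ℓ) → Decidable (Removable μ)
removable? μ i = (0 ℕ.<? μ i) ×-dec (Fin.all? λ j → (i Fin.<? j) →-dec (μ j ℕ.<? μ i))

dec-at : ∀ {ℓ} (μ : Shape ℓ) i → dec μ i i ≡ pred (μ i)
dec-at μ i = updateAt-updates i μ

dec-≢ : ∀ {ℓ} (μ : Shape ℓ) {i j} → j ≢ i → dec μ i j ≡ μ j
dec-≢ μ {i} {j} = updateAt-minimal j i μ

dec-≤ : ∀ {ℓ} (μ : Shape ℓ) i j → dec μ i j ≤ μ j
dec-≤ μ i j with j Fin.≟ i
... | yes ≡.refl rewrite dec-at μ i     = ℕ.pred[n]≤n
... | no  j≢i    rewrite dec-≢ μ j≢i = ℕ.≤-refl

dec-isPartition : ∀ {ℓ} {μ : Shape ℓ} {i} → IsPartition μ → Removable μ i → IsPartition (dec μ i)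
dec-isPartition {μ = μ} {i} part (_ , rem) j k j<k with j Fin.≟ i
... | no  j≢i rewrite dec-≢ μ j≢i = ℕ.≤-trans (dec-≤ μ i k) (part j k j<k)
... | yes ≡.refl rewrite dec-at μ i | dec-≢ μ {i} {k} (λ { ≡.refl → ℕ.<-irrefl ≡.refl j<k }) =
  ℕ.pred-mono-≤ (rem k j<k)

size-dec : ∀ {ℓ} (μ : Shape ℓ) i → 0 < μ i → size μ ≡ suc (size (dec μ i))
size-dec μ fzero 0<μ₀ with suc _ ← μ fzero = ≡.refl
size-dec μ (fsuc i) 0<μᵢ = ≡.trans (≡.cong (μ fzero ℕ.+_) (size-dec (λ j → μ (fsuc j)) i 0<μᵢ)) (ℕ.+-suc _ _)

size≡0 : ∀ {ℓ} (μ : Shape ℓ) → size μ ≡ 0 → ∀ i → μ i ≡ 0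
size≡0 μ eq fzero    = ℕ.m+n≡0⇒m≡0 (μ fzero) eq
size≡0 μ eq (fsuc i) = size≡0 (λ j → μ (fsuc j)) (ℕ.m+n≡0⇒n≡0 (μ fzero) eq) i

isPartition⇒staircase : ∀ {ℓ} (μ : Shape ℓ) → IsPartition μ → Staircase (tabulate μ)
isPartition⇒staircase {zero}  μ part = []
isPartition⇒staircase {suc ℓ} μ part = staircase-∷
  (isPartition⇒staircase (λ i → μ (fsuc i)) (λ i j i<j → part (fsuc i) (fsuc j) (s≤s i<j)))
  (All.tabulate⁺ (λ j → part fzero (fsuc j) (s≤s z≤n)))

Letter : ℕ → Set
Letter ℓ = Fin ℓ × Sign

-- A standard signed tableau is encoded by the rows and signs of its entries n, …, 1:
-- the head of a word describes the largest entry.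
words : ∀ {ℓ} → ℕ → Shape ℓ → List (List (Letter ℓ))
words zero    μ = [] ∷ []
words (suc n) μ = concatMap (λ a → map (a ∷_) (words n (dec μ (proj₁ a))))
                            (cartesianProduct (filter (removable? μ) (allFin _)) signs)

-- The arguments are the letters of k and of k + 1, in this order, opposite to their order in a
-- word.
isDescent : ∀ {ℓ} → Letter ℓ → Letter ℓ → Bool
isDescent (i , s) (j , s′) with toℕ i <ᵇ toℕ j | s | s′
... | true  | _      | Sign.+ = true
... | true  | _      | Sign.- = false
... | false | Sign.+ | _      = false
... | false | Sign.- | _      = true

-- A letter describes the entry that equals the length of the word from that letter on, hence the
-- contribution `length (a ∷ w)` of a descent at a.
majʷ negʷ : ∀ {ℓ} → List (Letter ℓ) → ℕ
majʷ []          = 0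
majʷ (a ∷ [])    = 0
majʷ (b ∷ a ∷ w) = (if isDescent a b then length (a ∷ w) else 0) ℕ.+ majʷ (a ∷ w)
negʷ []               = 0
negʷ ((_ , Sign.+) ∷ w) = negʷ w
negʷ ((_ , Sign.-) ∷ w) = suc (negʷ w)

-- Finite sums and products

module Sums {a ℓ} (R : CommutativeRing a ℓ) where
  open CommutativeRing R
  open QAnalogues R
  open Solver commutativeSemiring using (solve; _:+_; _:*_; _:=_)

  private variable A B : Set

  ∑-cong : ∀ (xs : List A) {f g} → (∀ x → f x ≈ g x) → ∑ xs f ≈ ∑ xs g
  ∑-cong []       f≈g = refl
  ∑-cong (x ∷ xs) f≈g = +-cong (f≈g x) (∑-cong xs f≈g)

  ∑-++ : ∀ (xs ys : List A) f → ∑ (xs ++ ys) f ≈ ∑ xs f + ∑ ys f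
  ∑-++ []       ys f = sym (+-identityˡ _)
  ∑-++ (x ∷ xs) ys f = trans (+-congˡ (∑-++ xs ys f)) (sym (+-assoc _ _ _))

  ∏-++ : ∀ (xs ys : List A) f → ∏ (xs ++ ys) f ≈ ∏ xs f * ∏ ys f
  ∏-++ []       ys f = sym (*-identityˡ _)
  ∏-++ (x ∷ xs) ys f = trans (*-congˡ (∏-++ xs ys f)) (sym (*-assoc _ _ _))

  ∑-map : ∀ (g : A → B) xs f → ∑ (map g xs) f ≈ ∑[ x ∈ xs ] f (g x)
  ∑-map g []       f = refl
  ∑-map g (x ∷ xs) f = +-congˡ (∑-map g xs f)

  ∏-map : ∀ (g : A → B) xs f → ∏ (map g xs) f ≈ ∏[ x ∈ xs ] f (g x)
  ∏-map g []       f = refl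
  ∏-map g (x ∷ xs) f = *-congˡ (∏-map g xs f)

  ∏-cong : ∀ (xs : List A) {f g} → (∀ x → f x ≈ g x) → ∏ xs f ≈ ∏ xs g
  ∏-cong []       f≈g = refl
  ∏-cong (x ∷ xs) f≈g = *-cong (f≈g x) (∏-cong xs f≈g)

  ∏-* : ∀ (xs : List A) f g → ∏[ x ∈ xs ] (f x * g x) ≈ ∏ xs f * ∏ xs g
  ∏-* []       f g = sym (*-identityˡ 1#)
  ∏-* (x ∷ xs) f g = trans (*-congˡ (∏-* xs f g))
    (solve 4 (λ a b c d → a :* b :* (c :* d) := a :* c :* (b :* d)) refl _ _ _ _)

  ∑-concatMap : ∀ (g : A → List B) xs f → ∑ (concatMap g xs) f ≈ ∑[ x ∈ xs ] ∑ (g x) f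
  ∑-concatMap g []       f = refl
  ∑-concatMap g (x ∷ xs) f = trans (∑-++ (g x) (concatMap g xs) f) (+-congˡ (∑-concatMap g xs f))

  ∑-cartesianProduct : ∀ (xs : List A) (ys : List B) f →
                       ∑ (cartesianProduct xs ys) f ≈ ∑[ x ∈ xs ] ∑[ y ∈ ys ] f (x , y)
  ∑-cartesianProduct []       ys f = refl
  ∑-cartesianProduct (x ∷ xs) ys f =
    trans (∑-++ (map (x ,_) ys) (cartesianProduct xs ys) f)
          (+-cong (∑-map (x ,_) ys f) (∑-cartesianProduct xs ys f))

  ∑-+ : ∀ (xs : List A) f g → ∑[ x ∈ xs ] (f x + g x) ≈ ∑ xs f + ∑ xs g
  ∑-+ []       f g = sym (+-identityˡ 0#)
  ∑-+ (x ∷ xs) f g = trans (+-congˡ (∑-+ xs f g))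
    (solve 4 (λ a b c d → a :+ b :+ (c :+ d) := a :+ c :+ (b :+ d)) refl _ _ _ _)

  ∑-* : ∀ c (xs : List A) f → ∑[ x ∈ xs ] (c * f x) ≈ c * ∑ xs f
  ∑-* c []       f = sym (zeroʳ c)
  ∑-* c (x ∷ xs) f = trans (+-congˡ (∑-* c xs f)) (sym (distribˡ c _ _))

  ∑-filter : ∀ {P : A → Set} (P? : Decidable P) xs f →
             ∑ (filter P? xs) f ≈ ∑[ x ∈ xs ] (if does (P? x) then f x else 0#)
  ∑-filter P? []       f = refl
  ∑-filter P? (x ∷ xs) f with does (P? x)
  ... | true  = +-congˡ (∑-filter P? xs f)
  ... | false = trans (∑-filter P? xs f) (sym (+-identityˡ _))

  ∑-allFin : ∀ n (f : Fin (suc n) → Carrier) →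
             ∑ (allFin (suc n)) f ≈ f fzero + ∑[ i ∈ allFin n ] f (fsuc i)
  ∑-allFin n f = +-congˡ (trans
    (reflexive (≡.cong (λ xs → ∑ xs f) (≡.sym (map-tabulate {n = n} (λ i → i) fsuc))))
    (∑-map fsuc (allFin n) f))

  ∏-allFin : ∀ n (f : Fin (suc n) → Carrier) →
             ∏ (allFin (suc n)) f ≈ f fzero * ∏[ i ∈ allFin n ] f (fsuc i)
  ∏-allFin n f = *-congˡ (trans
    (reflexive (≡.cong (λ xs → ∏ xs f) (≡.sym (map-tabulate {n = n} (λ i → i) fsuc))))
    (∏-map fsuc (allFin n) f))

  [suc]! : ∀ n q → [ suc n ]! q ≈ [ n ]! q * [ suc n ] q
  [suc]! n q = begin
    ∏ (map suc (upTo (suc n))) [_]q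
      ≡⟨ ≡.cong (λ xs → ∏ xs [_]q) (≡.trans (≡.cong (map suc) (≡.sym (upTo-∷ʳ n))) (map-++ suc (upTo n) (n ∷ []))) ⟩
    ∏ (map suc (upTo n) ++ suc n ∷ []) [_]q ≈⟨ ∏-++ (map suc (upTo n)) (suc n ∷ []) [_]q ⟩
    [ n ]! q * ([ suc n ] q * 1#) ≈⟨ *-congˡ (*-identityʳ _) ⟩
    [ n ]! q * [ suc n ] q ∎
    where
    open SetoidReasoning setoid
    [_]q = λ k → [ k ] q

-- Row lists of the mixed determinants

module _ {a} {Row : Set a} where

  -- Rows above row i are of kind u, the others of kind v. The summand ℓ, the number of rows further
  -- down, turns a row length into its Toeplitz index.
  mixed : (u v : ℕ → Row) → ∀ {ℓ} → Shape ℓ → ℕ → List Row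
  mixed u v {zero}  μ i       = []
  mixed u v {suc ℓ} μ zero    = v (μ fzero ℕ.+ ℓ) ∷ mixed u v (λ j → μ (fsuc j)) zero
  mixed u v {suc ℓ} μ (suc i) = u (μ fzero ℕ.+ ℓ) ∷ mixed u v (λ j → μ (fsuc j)) i

  module _ (u v : ℕ → Row) where

    above : ∀ {ℓ} → Shape ℓ → Fin ℓ → List Row
    above {suc ℓ} μ fzero    = []
    above {suc ℓ} μ (fsuc i) = u (μ fzero ℕ.+ ℓ) ∷ above (λ j → μ (fsuc j)) i

    below : ∀ {ℓ} → Shape ℓ → Fin ℓ → List Row
    below {suc ℓ} μ fzero    = mixed u v (λ j → μ (fsuc j)) zero
    below {suc ℓ} μ (fsuc i) = below (λ j → μ (fsuc j)) i

    -- `Fin.opposite i` counts the rows below row i. Here, in `mixed-after` and in `mixed-dec` the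
    -- lists agree except in row i, which is what lets multilinearity relate the three determinants.
    mixed-at : ∀ {ℓ} (μ : Shape ℓ) i → mixed u v μ (toℕ i) ≡
               above μ i ++ v (μ i ℕ.+ toℕ (Fin.opposite i)) ∷ below μ i
    mixed-at {suc ℓ} μ fzero    rewrite Fin.toℕ-fromℕ ℓ = ≡.refl
    mixed-at {suc ℓ} μ (fsuc i) rewrite Fin.toℕ-inject₁ (Fin.opposite i) = ≡.cong (_ ∷_) (mixed-at (λ j → μ (fsuc j)) i)

    mixed-after : ∀ {ℓ} (μ : Shape ℓ) i → mixed u v μ (suc (toℕ i)) ≡
                  above μ i ++ u (μ i ℕ.+ toℕ (Fin.opposite i)) ∷ below μ i
    mixed-after {suc ℓ} μ fzero    rewrite Fin.toℕ-fromℕ ℓ = ≡.refl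
    mixed-after {suc ℓ} μ (fsuc i) rewrite Fin.toℕ-inject₁ (Fin.opposite i) = ≡.cong (_ ∷_) (mixed-after (λ j → μ (fsuc j)) i)

    mixed-dec : ∀ {ℓ} (μ : Shape ℓ) i → mixed u v (dec μ i) (toℕ i) ≡
                above μ i ++ v (pred (μ i) ℕ.+ toℕ (Fin.opposite i)) ∷ below μ i
    mixed-dec {suc ℓ} μ fzero    rewrite Fin.toℕ-fromℕ ℓ = ≡.refl
    mixed-dec {suc ℓ} μ (fsuc i) rewrite Fin.toℕ-inject₁ (Fin.opposite i) = ≡.cong (_ ∷_) (mixed-dec (λ j → μ (fsuc j)) i)

  mixed-all : ∀ (u v : ℕ → Row) {ℓ} (μ : Shape ℓ) → mixed u v μ ℓ ≡ map u (firstColumnHooks (tabulate μ))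
  mixed-all u v {zero}  μ = ≡.refl
  mixed-all u v {suc ℓ} μ = ≡.cong₂ _∷_
    (≡.cong (λ k → u (μ fzero ℕ.+ k)) (≡.sym (length-tabulate (λ j → μ (fsuc j)))))
    (mixed-all u v (λ j → μ (fsuc j)))

  mixed-none : ∀ (u u′ v : ℕ → Row) {ℓ} (μ : Shape ℓ) → mixed u v μ 0 ≡ mixed u′ v μ 0
  mixed-none u u′ v {zero}  μ = ≡.refl
  mixed-none u u′ v {suc ℓ} μ = ≡.cong (_ ∷_) (mixed-none u u′ v (λ j → μ (fsuc j)))

-- Sums over words

module WordSum {a ℓ₀} (R : CommutativeRing a ℓ₀) (q t : CommutativeRing.Carrier R)
  (inv : ℕ → CommutativeRing.Carrier R) ([suc]*inv≈1 : QNumbers.InvertsPositive R q inv)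
  (p-cancel : QNumbers.PCancellative R q) where

  open CommutativeRing R
  open QAnalogues R
  open QNumbers R q
  open JacobiTrudi R q inv [suc]*inv≈1
  open Determinant R
  open Sums R
  open Exp semiring using (^-homo-*)
  open GroupProperties +-group using () renaming (∙-cancelʳ to +-cancelʳ)
  open SetoidReasoning setoid
  open Solver commutativeSemiring using (solve; _:+_; _:*_; _:=_; con)

  -- `β` links the other two: the positive rule relates it to `α`, the negative rule to `γ`, and `α`
  -- is `γ` with both arguments scaled by q.
  α β γ : ℕ → Row
  α = toeplitzRow (h (q * 1#) (q * t))
  β = toeplitzRow (h 1# (q * t))
  γ = toeplitzRow (h 1# t)

  -- The words whose last letter is positive (resp. negative) and lies in row i are
  -- counted, up to [n]! and t, by B μ i (resp. C μ i), for μ the remaining shape of size n.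
  B C : ∀ {ℓ} → Shape ℓ → ℕ → Carrier
  B {ℓ} μ i = det ℓ (mixed α β μ i)
  C {ℓ} μ i = det ℓ (mixed γ β μ i)

  atRemovable : ∀ {ℓ} (D : ∀ {ℓ} → Shape ℓ → ℕ → Carrier) → Shape ℓ → Fin ℓ → Carrier
  atRemovable D μ i = if does (removable? μ i) then D (dec μ i) (toℕ i) else 0#

  private
    toeplitz-+ : ∀ f g e c → f 0 ≈ g 0 → (∀ m → f (suc m) ≈ g (suc m) + c * e m) →
      ∀ l k → toeplitzRow f l k ≈ toeplitzRow g l k + c * toeplitzRow e l (suc k)
    toeplitz-+ f g e c f₀ fₛ zero    zero    = trans f₀ (sym (trans (+-congˡ (zeroʳ c)) (+-identityʳ _)))
    toeplitz-+ f g e c f₀ fₛ (suc l) zero    = fₛ l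
    toeplitz-+ f g e c f₀ fₛ zero    (suc k) = sym (trans (+-congˡ (zeroʳ c)) (+-identityʳ _))
    toeplitz-+ f g e c f₀ fₛ (suc l) (suc k) = toeplitz-+ f g e c f₀ fₛ l k

    β≈α+ : ∀ l k → β l k ≈ α l k + p * β l (suc k)
    β≈α+ = toeplitz-+ _ _ _ p refl
      (λ m → trans (h-positive 1# (q * t) m) (+-congˡ (*-congʳ (*-identityʳ p))))

    γ≈β+ : ∀ l k → γ l k ≈ β l k + p * t * β l (suc k)
    γ≈β+ = toeplitz-+ _ _ _ (p * t) refl (h-negative 1# t)

    -- Shortening a row that is not removable makes it equal to the next one,
    -- or gives it a negative length.
    not-removable : ∀ u {ℓ} (μ : Shape ℓ) i → IsPartition μ → ¬ Removable μ i → ∀ k ps →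
      det k (ps ++ (λ j → β (μ i ℕ.+ toℕ (Fin.opposite i)) (suc j)) ∷ below u β μ i) ≈ 0#
    not-removable u {suc zero} μ fzero part ¬rem k ps with μ fzero
    ... | zero  = det-zeroRow k ps [] (λ _ → refl)
    ... | suc m = ⊥-elim (¬rem (s≤s z≤n , λ { fzero () }))
    not-removable u {suc (suc ℓ)} μ fzero part ¬rem k ps = begin
      det k (ps ++ (λ j → β (μ fzero ℕ.+ suc (toℕ (Fin.fromℕ ℓ))) (suc j)) ∷ β (μ (fsuc fzero) ℕ.+ ℓ) ∷ rest)
        ≡⟨ ≡.cong (λ l → det k (ps ++ (λ j → β l (suc j)) ∷ β (μ (fsuc fzero) ℕ.+ ℓ) ∷ rest)) length≡ ⟩
      det k (ps ++ β (μ (fsuc fzero) ℕ.+ ℓ) ∷ β (μ (fsuc fzero) ℕ.+ ℓ) ∷ rest)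
        ≈⟨ det-alternating k ps _ rest ⟩
      0# ∎
      where
      rest = mixed u β (λ j → μ (fsuc (fsuc j))) 0

      μ₁≮μ₀ : ¬ (μ (fsuc fzero) < μ fzero)
      μ₁≮μ₀ μ₁<μ₀ = ¬rem (ℕ.≤-<-trans z≤n μ₁<μ₀ , λ where
        (fsuc fzero)    _ → μ₁<μ₀
        (fsuc (fsuc j)) _ → ℕ.≤-<-trans (part (fsuc fzero) (fsuc (fsuc j)) (s≤s (s≤s z≤n))) μ₁<μ₀)

      length≡ : μ fzero ℕ.+ suc (toℕ (Fin.fromℕ ℓ)) ≡ suc (μ (fsuc fzero) ℕ.+ ℓ)
      length≡ = ≡.trans
        (≡.cong₂ (λ m n → m ℕ.+ suc n)
          (ℕ.≤-antisym (ℕ.≮⇒≥ μ₁≮μ₀) (part fzero (fsuc fzero) (s≤s z≤n))) (Fin.toℕ-fromℕ ℓ))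
        (ℕ.+-suc _ ℓ)
    not-removable u {suc ℓ} μ (fsuc i) part ¬rem k ps rewrite Fin.toℕ-inject₁ (Fin.opposite i) =
      not-removable u (λ j → μ (fsuc j)) i (λ i j i<j → part (fsuc i) (fsuc j) (s≤s i<j))
        (λ (0<μᵢ , max) → ¬rem (0<μᵢ , λ { (fsuc j) (s≤s i<j) → max j i<j })) k ps

    -- Shifting a row by one column lowers its index by one. For a removable row this is the
    -- determinant of the smaller shape; otherwise the determinant vanishes, in accordance with the
    -- default 0 of `atRemovable`.
    shortened : ∀ u {ℓ} (μ : Shape ℓ) i → IsPartition μ →
      det ℓ (above u β μ i ++ (λ j → β (μ i ℕ.+ toℕ (Fin.opposite i)) (suc j)) ∷ below u β μ i) ≈
      atRemovable (λ {ℓ} μ i → det ℓ (mixed u β μ i)) μ i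
    shortened u {ℓ} μ i part = split (removable? μ i)
      where
      row≡ : ∀ m → 0 < m →
        det ℓ (above u β μ i ++ (λ j → β (m ℕ.+ toℕ (Fin.opposite i)) (suc j)) ∷ below u β μ i) ≡
        det ℓ (above u β μ i ++ β (pred m ℕ.+ toℕ (Fin.opposite i)) ∷ below u β μ i)
      row≡ (suc m) _ = ≡.refl

      split : (r : Dec (Removable μ i)) →
        det ℓ (above u β μ i ++ (λ j → β (μ i ℕ.+ toℕ (Fin.opposite i)) (suc j)) ∷ below u β μ i) ≈
        (if does r then det ℓ (mixed u β (dec μ i) (toℕ i)) else 0#)
      split (no  ¬rem)      = not-removable u μ i part ¬rem ℓ (above u β μ i)
      split (yes (0<μᵢ , _)) =
        reflexive (≡.trans (row≡ (μ i) 0<μᵢ) (≡.cong (det ℓ) (≡.sym (mixed-dec u β μ i))))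

  -- Only row i changes, from `β` to `α`; their difference is p times a shifted `β` row, that is, a
  -- row with one cell less.
  B-step : ∀ {ℓ} (μ : Shape ℓ) → IsPartition μ → ∀ i →
           B μ (toℕ i) ≈ B μ (suc (toℕ i)) + p * atRemovable B μ i
  B-step {ℓ} μ part i = begin
    det ℓ (mixed α β μ (toℕ i)) ≡⟨ ≡.cong (det ℓ) (mixed-at α β μ i) ⟩
    det ℓ (above α β μ i ++ β _ ∷ below α β μ i)
      ≈⟨ det-multilinear ℓ p (β≈α+ _) (above α β μ i) (below α β μ i) ⟩
    det ℓ (above α β μ i ++ α _ ∷ below α β μ i) + p * det ℓ (above α β μ i ++ _ ∷ below α β μ i)
      ≈⟨ +-cong (reflexive (≡.cong (det ℓ) (≡.sym (mixed-after α β μ i)))) (*-congˡ (shortened α μ i part)) ⟩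
    B μ (suc (toℕ i)) + p * atRemovable B μ i ∎

  C-step : ∀ {ℓ} (μ : Shape ℓ) → IsPartition μ → ∀ i →
           C μ (suc (toℕ i)) ≈ C μ (toℕ i) + p * (t * atRemovable C μ i)
  C-step {ℓ} μ part i = begin
    det ℓ (mixed γ β μ (suc (toℕ i))) ≡⟨ ≡.cong (det ℓ) (mixed-after γ β μ i) ⟩
    det ℓ (above γ β μ i ++ γ _ ∷ below γ β μ i)
      ≈⟨ det-multilinear ℓ (p * t) (γ≈β+ _) (above γ β μ i) (below γ β μ i) ⟩
    det ℓ (above γ β μ i ++ β _ ∷ below γ β μ i) + p * t * det ℓ (above γ β μ i ++ _ ∷ below γ β μ i)
      ≈⟨ +-cong (reflexive (≡.cong (det ℓ) (≡.sym (mixed-at γ β μ i)))) (*-congˡ (shortened γ μ i part)) ⟩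
    C μ (toℕ i) + p * t * atRemovable C μ i ≈⟨ +-congˡ (*-assoc p t _) ⟩
    C μ (toℕ i) + p * (t * atRemovable C μ i) ∎

  B₀≈C₀ : ∀ {ℓ} (μ : Shape ℓ) → B μ 0 ≈ C μ 0
  B₀≈C₀ {ℓ} μ = reflexive (≡.cong (det ℓ) (mixed-none α γ β μ))

  private
    mixed-all-jt : ∀ u {ℓ} (μ : Shape ℓ) → det ℓ (mixed (toeplitzRow u) β μ ℓ) ≡ jacobiTrudi u (tabulate μ)
    mixed-all-jt u μ = ≡.cong₂ det (≡.sym (length-tabulate μ)) (mixed-all (toeplitzRow u) β μ)

  C-last : ∀ {ℓ} (μ : Shape ℓ) → C μ ℓ ≡ jacobiTrudi (h 1# t) (tabulate μ)
  C-last = mixed-all-jt (h 1# t)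

  B-last : ∀ {ℓ} (μ : Shape ℓ) → IsPartition μ → B μ ℓ ≈ q ^ size μ * C μ ℓ
  B-last {ℓ} μ part = begin
    B μ ℓ                                          ≡⟨ mixed-all-jt _ μ ⟩
    jacobiTrudi (h (q * 1#) (q * t)) (tabulate μ)  ≈⟨ jacobiTrudi-scale (isPartition⇒staircase μ part) 1# t ⟩
    q ^ size μ * jacobiTrudi (h 1# t) (tabulate μ) ≡⟨ ≡.cong (q ^ size μ *_) (C-last μ) ⟨
    q ^ size μ * C μ ℓ ∎

  step : Carrier → Carrier → ℕ → ∀ {ℓ} → Fin ℓ → Carrier
  step a b i j = if toℕ j <ᵇ i then b else a

  -- Summation by parts against a step function, for U - V; written without subtraction.
  telescope : ∀ {ℓ} (U V : ℕ → Carrier) (d : Fin ℓ → Carrier) →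
    (∀ j → U (toℕ j) + V (suc (toℕ j)) ≈ U (suc (toℕ j)) + V (toℕ j) + p * d j) →
    ∀ a b i → i ≤ ℓ →
    p * ∑[ j ∈ allFin ℓ ] (step a b i j * d j) + (a * (U ℓ + V i) + b * (U i + V 0))
      ≈ a * (U i + V ℓ) + b * (U 0 + V i)
  telescope {zero} U V d hyp a b zero i≤ℓ =
    solve 5 (λ p a b u v → p :* con 0 :+ (a :* (u :+ v) :+ b :* (u :+ v)) := a :* (u :+ v) :+ b :* (u :+ v)) refl p a b (U 0) (V 0)
  telescope {suc ℓ} U V d hyp a b zero i≤ℓ = +-cancelʳ (a * (U 1 + V 1)) _ _ (begin
    p * ∑[ j ∈ allFin (suc ℓ) ] (a * d j) + (a * (U (suc ℓ) + V 0) + b * (U 0 + V 0)) + a * (U 1 + V 1)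
      ≈⟨ +-congʳ (+-congʳ (*-congˡ (∑-allFin ℓ (λ j → a * d j)))) ⟩
    p * (a * d fzero + S) + (a * (U (suc ℓ) + V 0) + b * (U 0 + V 0)) + a * (U 1 + V 1)
      ≈⟨ solve 11 (λ p a b d S Ul Vl U0 V0 U1 V1 →
           p :* (a :* d :+ S) :+ (a :* (Ul :+ V0) :+ b :* (U0 :+ V0)) :+ a :* (U1 :+ V1) :=
           (p :* S :+ (a :* (Ul :+ V1) :+ con 0 :* (U1 :+ V1))) :+ a :* (U1 :+ V0 :+ p :* d) :+ b :* (U0 :+ V0))
           refl p a b (d fzero) S (U (suc ℓ)) (V (suc ℓ)) (U 0) (V 0) (U 1) (V 1) ⟩
    (p * S + (a * (U (suc ℓ) + V 1) + 0# * (U 1 + V 1))) + a * (U 1 + V 0 + p * d fzero) + b * (U 0 + V 0)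
      -- No index lies before a jump at 0, so the sum does not see b; the recursive call takes 0 for
      -- it and adds no boundary term in b.
      ≈⟨ +-congʳ (+-cong (telescope (λ j → U (suc j)) (λ j → V (suc j)) (λ j → d (fsuc j)) (λ j → hyp (fsuc j)) a 0# 0 z≤n)
                         (*-congˡ (sym (hyp fzero)))) ⟩
    (a * (U 1 + V (suc ℓ)) + 0# * (U 1 + V 1)) + a * (U 0 + V 1) + b * (U 0 + V 0)
      ≈⟨ solve 7 (λ a b Vl U0 V0 U1 V1 →
           (a :* (U1 :+ Vl) :+ con 0 :* (U1 :+ V1)) :+ a :* (U0 :+ V1) :+ b :* (U0 :+ V0) :=
           a :* (U0 :+ Vl) :+ b :* (U0 :+ V0) :+ a :* (U1 :+ V1))
           refl a b (V (suc ℓ)) (U 0) (V 0) (U 1) (V 1) ⟩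
    a * (U 0 + V (suc ℓ)) + b * (U 0 + V 0) + a * (U 1 + V 1) ∎)
    where S = ∑[ j ∈ allFin ℓ ] (a * d (fsuc j))
  telescope {suc ℓ} U V d hyp a b (suc i) (s≤s i≤ℓ) = +-cancelʳ (b * (U 1 + V 1)) _ _ (begin
    p * ∑[ j ∈ allFin (suc ℓ) ] (step a b (suc i) j * d j)
      + (a * (U (suc ℓ) + V (suc i)) + b * (U (suc i) + V 0)) + b * (U 1 + V 1)
      ≈⟨ +-congʳ (+-congʳ (*-congˡ (∑-allFin ℓ (λ j → step a b (suc i) j * d j)))) ⟩
    p * (b * d fzero + S) + (a * (U (suc ℓ) + V (suc i)) + b * (U (suc i) + V 0)) + b * (U 1 + V 1)
      ≈⟨ solve 11 (λ p a b d S Ul Ui Vi V0 U1 V1 →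
           p :* (b :* d :+ S) :+ (a :* (Ul :+ Vi) :+ b :* (Ui :+ V0)) :+ b :* (U1 :+ V1) :=
           (p :* S :+ (a :* (Ul :+ Vi) :+ b :* (Ui :+ V1))) :+ b :* (U1 :+ V0 :+ p :* d))
           refl p a b (d fzero) S (U (suc ℓ)) (U (suc i)) (V (suc i)) (V 0) (U 1) (V 1) ⟩
    (p * S + (a * (U (suc ℓ) + V (suc i)) + b * (U (suc i) + V 1))) + b * (U 1 + V 0 + p * d fzero)
      ≈⟨ +-cong (telescope (λ j → U (suc j)) (λ j → V (suc j)) (λ j → d (fsuc j)) (λ j → hyp (fsuc j)) a b i i≤ℓ)
                (*-congˡ (sym (hyp fzero))) ⟩
    (a * (U (suc i) + V (suc ℓ)) + b * (U 1 + V (suc i))) + b * (U 0 + V 1)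
      ≈⟨ solve 8 (λ a b Ui Vl Vi U0 U1 V1 →
           (a :* (Ui :+ Vl) :+ b :* (U1 :+ Vi)) :+ b :* (U0 :+ V1) :=
           a :* (Ui :+ Vl) :+ b :* (U0 :+ Vi) :+ b :* (U1 :+ V1))
           refl a b (U (suc i)) (V (suc ℓ)) (V (suc i)) (U 0) (U 1) (V 1) ⟩
    a * (U (suc i) + V (suc ℓ)) + b * (U 0 + V (suc i)) + b * (U 1 + V 1) ∎)
    where S = ∑[ j ∈ allFin ℓ ] (step a b i j * d (fsuc j))

  sg : Sign → Carrier
  sg Sign.+ = 1#
  sg Sign.- = t

  wt : ∀ {ℓ} → List (Letter ℓ) → Carrier
  wt w = q ^ majʷ w * t ^ negʷ w

  private
    wt-∷ : ∀ {ℓ} (b a : Letter ℓ) w →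
           wt (b ∷ a ∷ w) ≈ sg (proj₂ b) * ((if isDescent a b then q ^ length (a ∷ w) else 1#) * wt (a ∷ w))
    wt-∷ b a w = begin
      q ^ ((if isDescent a b then length (a ∷ w) else 0) ℕ.+ majʷ (a ∷ w)) * t ^ negʷ (b ∷ a ∷ w)
        ≈⟨ *-cong (^-homo-* q (if isDescent a b then length (a ∷ w) else 0) (majʷ (a ∷ w))) (neg-∷ b) ⟩
      q ^ (if isDescent a b then length (a ∷ w) else 0) * q ^ majʷ (a ∷ w) * (sg (proj₂ b) * t ^ negʷ (a ∷ w))
        ≈⟨ *-congʳ (*-congʳ (q^if (isDescent a b))) ⟩
      (if isDescent a b then q ^ length (a ∷ w) else 1#) * q ^ majʷ (a ∷ w) * (sg (proj₂ b) * t ^ negʷ (a ∷ w))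
        ≈⟨ solve 4 (λ u v w x → u :* v :* (w :* x) := w :* (u :* (v :* x))) refl _ _ _ _ ⟩
      sg (proj₂ b) * ((if isDescent a b then q ^ length (a ∷ w) else 1#) * wt (a ∷ w)) ∎
      where
      neg-∷ : ∀ b → t ^ negʷ (b ∷ a ∷ w) ≈ sg (proj₂ b) * t ^ negʷ (a ∷ w)
      neg-∷ (_ , Sign.+) = sym (*-identityˡ _)
      neg-∷ (_ , Sign.-) = refl

      q^if : ∀ d → q ^ (if d then length (a ∷ w) else 0) ≈ (if d then q ^ length (a ∷ w) else 1#)
      q^if true  = refl
      q^if false = refl

    ∑-words : ∀ {ℓ} n (μ : Shape ℓ) f → ∑ (words (suc n) μ) f ≈
      ∑[ i ∈ filter (removable? μ) (allFin ℓ) ] ∑[ s ∈ signs ] ∑[ w ∈ words n (dec μ i) ] f ((i , s) ∷ w)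
    ∑-words n μ f = begin
      ∑ (words (suc n) μ) f ≈⟨ ∑-concatMap (λ a → map (a ∷_) (words n (dec μ (proj₁ a)))) as f ⟩
      ∑[ a ∈ as ] ∑ (map (a ∷_) (words n (dec μ (proj₁ a)))) f
        ≈⟨ ∑-cong as (λ a → ∑-map (a ∷_) (words n (dec μ (proj₁ a))) f) ⟩
      ∑[ a ∈ as ] ∑[ w ∈ words n (dec μ (proj₁ a)) ] f (a ∷ w)
        ≈⟨ ∑-cartesianProduct (filter (removable? μ) (allFin _)) signs
             (λ a → ∑[ w ∈ words n (dec μ (proj₁ a)) ] f (a ∷ w)) ⟩
      _ ∎
      where as = cartesianProduct (filter (removable? μ) (allFin _)) signs

    ∑-words-cong : ∀ {ℓ} n (μ : Shape ℓ) {f g} → (∀ w → length w ≡ n → f w ≈ g w) →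
                   ∑ (words n μ) f ≈ ∑ (words n μ) g
    ∑-words-cong zero    μ f≈g = +-congʳ (f≈g [] ≡.refl)
    ∑-words-cong (suc n) μ {f} {g} f≈g = trans (∑-words n μ _) (trans
      (∑-cong (filter (removable? μ) (allFin _)) λ i → ∑-cong signs
        {λ s → ∑[ w ∈ words n (dec μ i) ] f ((i , s) ∷ w)} {λ s → ∑[ w ∈ words n (dec μ i) ] g ((i , s) ∷ w)} λ s →
        ∑-words-cong n (dec μ i) λ w ∣w∣≡n → f≈g ((i , s) ∷ w) (≡.cong suc ∣w∣≡n))
      (sym (∑-words n μ _)))

  private
    -- The extra letter on top need not describe a cell that can be added to μ: only its row and
    -- sign enter the weight. So the claim makes sense for every row i, as the induction requires.
    LastPositive LastNegative Total : ∀ {ℓ} → ℕ → Shape ℓ → Set ℓ₀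
    LastPositive n μ = ∀ i → ∑[ w ∈ words n μ ] wt ((i , Sign.+) ∷ w) ≈ [ n ]! q * B μ (toℕ i)
    LastNegative n μ = ∀ i → ∑[ w ∈ words n μ ] wt ((i , Sign.-) ∷ w) ≈ [ n ]! q * (t * C μ (toℕ i))
    Total {ℓ} n μ = ∑[ w ∈ words n μ ] wt w ≈ [ n ]! q * C μ ℓ

    collect : ∀ {ℓ} m (μ : Shape ℓ) (κ : Letter ℓ → Carrier) →
      (∀ i → Removable μ i → LastPositive m (dec μ i) × LastNegative m (dec μ i)) →
      ∑[ i ∈ filter (removable? μ) (allFin ℓ) ] ∑[ s ∈ signs ] (κ (i , s) * ∑[ w ∈ words m (dec μ i) ] wt ((i , s) ∷ w))
      ≈ [ m ]! q * (∑[ i ∈ allFin ℓ ] (κ (i , Sign.+) * atRemovable B μ i)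
                  + ∑[ i ∈ allFin ℓ ] (κ (i , Sign.-) * (t * atRemovable C μ i)))
    collect {ℓ} m μ κ ih = begin
      ∑[ i ∈ filter (removable? μ) (allFin ℓ) ] G i ≈⟨ ∑-filter (removable? μ) (allFin ℓ) G ⟩
      ∑[ i ∈ allFin ℓ ] (if does (removable? μ i) then G i else 0#)
        ≈⟨ ∑-cong (allFin ℓ) (λ i → split i (removable? μ i)) ⟩
      ∑[ i ∈ allFin ℓ ] ([ m ]! q * (κ (i , Sign.+) * atRemovable B μ i + κ (i , Sign.-) * (t * atRemovable C μ i)))
        ≈⟨ ∑-* ([ m ]! q) (allFin ℓ) _ ⟩
      [ m ]! q * ∑[ i ∈ allFin ℓ ] (κ (i , Sign.+) * atRemovable B μ i + κ (i , Sign.-) * (t * atRemovable C μ i))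
        ≈⟨ *-congˡ (∑-+ (allFin ℓ) _ _) ⟩
      _ ∎
      where
      G : Fin ℓ → Carrier
      G i = ∑[ s ∈ signs ] (κ (i , s) * ∑[ w ∈ words m (dec μ i) ] wt ((i , s) ∷ w))

      split : ∀ i (r : Dec (Removable μ i)) → (if does r then G i else 0#) ≈
        [ m ]! q * (κ (i , Sign.+) * (if does r then B (dec μ i) (toℕ i) else 0#)
                  + κ (i , Sign.-) * (t * (if does r then C (dec μ i) (toℕ i) else 0#)))
      split i (no _)    = solve 4 (λ f k l t → con 0 := f :* (k :* con 0 :+ l :* (t :* con 0))) refl _ _ _ t
      split i (yes rem) = trans
        (+-cong (*-congˡ (proj₁ (ih i rem) i)) (+-congʳ (*-congˡ (proj₂ (ih i rem) i))))
        (solve 6 (λ f k l t b c → k :* (f :* b) :+ (l :* (f :* (t :* c)) :+ con 0) := f :* (k :* b :+ l :* (t :* c)))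
          refl _ _ _ t _ _)

    -- The largest entry of μ is `suc m`, so a descent between its letter and b contributes q^(m+1),
    -- whatever the smaller entries are.
    ∑-step : ∀ {ℓ} m (μ : Shape ℓ) (b : Letter ℓ) →
      (∀ i → Removable μ i → LastPositive m (dec μ i) × LastNegative m (dec μ i)) →
      ∑[ w ∈ words (suc m) μ ] wt (b ∷ w) ≈
      sg (proj₂ b) * ([ m ]! q *
        (∑[ i ∈ allFin ℓ ] ((if isDescent (i , Sign.+) b then q ^ suc m else 1#) * atRemovable B μ i)
       + ∑[ i ∈ allFin ℓ ] ((if isDescent (i , Sign.-) b then q ^ suc m else 1#) * (t * atRemovable C μ i))))
    ∑-step {ℓ} m μ b ih = begin
      ∑[ w ∈ words (suc m) μ ] wt (b ∷ w) ≈⟨ ∑-words m μ _ ⟩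
      ∑[ i ∈ is ] ∑[ s ∈ signs ] ∑[ w ∈ words m (dec μ i) ] wt (b ∷ (i , s) ∷ w)
        ≈⟨ ∑-cong is (λ i → ∑-cong signs {λ s → ∑[ w ∈ words m (dec μ i) ] wt (b ∷ (i , s) ∷ w)}
             {λ s → sg (proj₂ b) * K i s} λ s → extract i s) ⟩
      ∑[ i ∈ is ] ∑[ s ∈ signs ] (sg (proj₂ b) * K i s)
        ≈⟨ trans (∑-cong is (λ i → ∑-* (sg (proj₂ b)) signs (K i))) (∑-* (sg (proj₂ b)) is (λ i → ∑ signs (K i))) ⟩
      sg (proj₂ b) * ∑[ i ∈ is ] ∑[ s ∈ signs ] K i s
        ≈⟨ *-congˡ (collect m μ κ ih) ⟩
      _ ∎
      where
      is = filter (removable? μ) (allFin ℓ)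
      κ  = λ a → if isDescent a b then q ^ suc m else 1#

      K : Fin ℓ → Sign → Carrier
      K i s = κ (i , s) * ∑[ w ∈ words m (dec μ i) ] wt ((i , s) ∷ w)

      extract : ∀ i s → ∑[ w ∈ words m (dec μ i) ] wt (b ∷ (i , s) ∷ w) ≈ sg (proj₂ b) * K i s
      extract i s = begin
        ∑[ w ∈ words m (dec μ i) ] wt (b ∷ (i , s) ∷ w)
          ≈⟨ ∑-words-cong m (dec μ i) {g = λ w → sg (proj₂ b) * κ (i , s) * wt ((i , s) ∷ w)}
               (λ { w ≡.refl → trans (wt-∷ b (i , s) w) (sym (*-assoc _ _ _)) }) ⟩
        ∑[ w ∈ words m (dec μ i) ] (sg (proj₂ b) * κ (i , s) * wt ((i , s) ∷ w))
          ≈⟨ ∑-* (sg (proj₂ b) * κ (i , s)) (words m (dec μ i)) (λ w → wt ((i , s) ∷ w)) ⟩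
        sg (proj₂ b) * κ (i , s) * ∑[ w ∈ words m (dec μ i) ] wt ((i , s) ∷ w) ≈⟨ *-assoc _ _ _ ⟩
        sg (proj₂ b) * K i s ∎

    finish : ∀ n {S S′ X X′ Y Y′ K} → p * S + X ≈ X′ → p * S′ + Y ≈ Y′ →
             X′ + Y′ ≈ X + Y + p * ([ n ] q * K) →
             p * (S + S′) ≈ p * ([ n ] q * K)
    finish n {S} {S′} {X} {X′} {Y} {Y′} {K} e e′ bal = +-cancelʳ (X + Y) _ _ (begin
      p * (S + S′) + (X + Y)       ≈⟨ solve 5 (λ p s s′ x y → p :* (s :+ s′) :+ (x :+ y) := p :* s :+ x :+ (p :* s′ :+ y)) refl p S S′ X Y ⟩
      p * S + X + (p * S′ + Y)     ≈⟨ +-cong e e′ ⟩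
      X′ + Y′                      ≈⟨ bal ⟩
      X + Y + p * ([ n ] q * K)    ≈⟨ +-comm _ _ ⟩
      p * ([ n ] q * K) + (X + Y) ∎)

    module Step {ℓ} m (μ : Shape ℓ) (part : IsPartition μ) (size≡ : size μ ≡ suc m)
      (ih : ∀ i → Removable μ i → LastPositive m (dec μ i) × LastNegative m (dec μ i)) where

      n = suc m
      Q = q ^ suc m
      N = [ suc m ] q

      Bₗ≈ : B μ ℓ ≈ Q * C μ ℓ
      Bₗ≈ = trans (B-last μ part) (*-congʳ (reflexive (≡.cong (q ^_) size≡)))

      -- `B-step` expresses a decrease along the rows and `C-step` an increase; hence B takes the
      -- place of U in `telescope`, and C that of V.
      B-sum : ∀ a b i → i ≤ ℓ → p * ∑[ j ∈ allFin ℓ ] (step a b i j * atRemovable B μ j)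
        + (a * (B μ ℓ + 0#) + b * (B μ i + 0#)) ≈ a * (B μ i + 0#) + b * (B μ 0 + 0#)
      B-sum = telescope (B μ) (λ _ → 0#) _ λ j →
        trans (+-identityʳ _) (trans (B-step μ part j) (+-congʳ (sym (+-identityʳ _))))

      C-sum : ∀ a b i → i ≤ ℓ → p * ∑[ j ∈ allFin ℓ ] (step a b i j * (t * atRemovable C μ j))
        + (a * (0# + C μ i) + b * (0# + C μ 0)) ≈ a * (0# + C μ ℓ) + b * (0# + C μ i)
      C-sum = telescope (λ _ → 0#) (C μ) _ λ j →
        trans (+-identityˡ _) (trans (C-step μ part j) (+-congʳ (sym (+-identityˡ _))))

      split-1 : ∀ x {r r′} → r ≈ r′ → 1# * x + r ≈ (p * N + Q) * x + r′
      split-1 x r≈r′ = +-cong (*-congʳ (sym (p*[k]+q^k≈1 n))) r≈r′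

      factorials : ∀ {S K} → p * S ≈ p * (N * K) → [ m ]! q * S ≈ [ n ]! q * K
      factorials {S} {K} eq = begin
        [ m ]! q * S        ≈⟨ *-congˡ (p-cancel eq) ⟩
        [ m ]! q * (N * K)  ≈⟨ sym (*-assoc _ _ _) ⟩
        [ m ]! q * N * K    ≈⟨ *-congʳ (sym ([suc]! m q)) ⟩
        [ n ]! q * K ∎

      descent-coefficient : ∀ s s′ a b → (∀ (i j : Fin ℓ) → (if isDescent (i , s) (j , s′) then Q else 1#) ≡ step a b (toℕ j) i) →
        ∀ j (d : Fin ℓ → Carrier) →
        ∑[ i ∈ allFin ℓ ] ((if isDescent (i , s) (j , s′) then Q else 1#) * d i) ≈ ∑[ i ∈ allFin ℓ ] (step a b (toℕ j) i * d i)
      descent-coefficient s s′ a b eq j d = ∑-cong (allFin ℓ) λ i → *-congʳ (reflexive (eq i j))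

      positive-step : LastPositive n μ
      positive-step i = begin
        ∑[ w ∈ words n μ ] wt ((i , Sign.+) ∷ w) ≈⟨ ∑-step m μ (i , Sign.+) ih ⟩
        1# * ([ m ]! q * _) ≈⟨ *-identityˡ _ ⟩
        [ m ]! q * _
          -- When the next entry is positive and in row i, a negative entry always is a descent, a
          -- positive one exactly when it lies in a higher row.
          ≈⟨ *-congˡ (+-cong (descent-coefficient Sign.+ Sign.+ 1# Q pos-pos i _) (descent-coefficient Sign.- Sign.+ Q Q neg-pos i _)) ⟩
        [ m ]! q * (∑[ j ∈ allFin ℓ ] (step 1# Q (toℕ i) j * atRemovable B μ j)
                  + ∑[ j ∈ allFin ℓ ] (step Q Q (toℕ i) j * (t * atRemovable C μ j)))
          ≈⟨ factorials (finish n (B-sum 1# Q (toℕ i) i≤ℓ) (C-sum Q Q (toℕ i) i≤ℓ) balance) ⟩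
        [ n ]! q * B μ (toℕ i) ∎
        where
        i≤ℓ = ℕ.<⇒≤ (Fin.toℕ<n i)

        pos-pos : ∀ (i j : Fin ℓ) → (if isDescent (i , Sign.+) (j , Sign.+) then Q else 1#) ≡ step 1# Q (toℕ j) i
        pos-pos i j with toℕ i <ᵇ toℕ j
        ... | true  = ≡.refl
        ... | false = ≡.refl

        neg-pos : ∀ (i j : Fin ℓ) → (if isDescent (i , Sign.-) (j , Sign.+) then Q else 1#) ≡ step Q Q (toℕ j) i
        neg-pos i j with toℕ i <ᵇ toℕ j
        ... | true  = ≡.refl
        ... | false = ≡.refl

        -- With subtraction: Q (B_0 - B_i) + (B_i - B_ℓ) + Q (C_ℓ - C_0) = (1 - Q) B_i, by B_0 = C_0
        -- and B_ℓ = Q C_ℓ.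
        balance : 1# * (B μ (toℕ i) + 0#) + Q * (B μ 0 + 0#) + (Q * (0# + C μ ℓ) + Q * (0# + C μ (toℕ i)))
          ≈ 1# * (B μ ℓ + 0#) + Q * (B μ (toℕ i) + 0#) + (Q * (0# + C μ (toℕ i)) + Q * (0# + C μ 0))
            + p * (N * B μ (toℕ i))
        balance = begin
          _ ≈⟨ solve 5 (λ Q bᵢ b₀ cₗ cᵢ → con 1 :* (bᵢ :+ con 0) :+ Q :* (b₀ :+ con 0) :+ (Q :* (con 0 :+ cₗ) :+ Q :* (con 0 :+ cᵢ))
                 := con 1 :* bᵢ :+ (Q :* b₀ :+ Q :* cₗ :+ Q :* cᵢ)) refl Q _ _ _ _ ⟩
          1# * B μ (toℕ i) + (Q * B μ 0 + Q * C μ ℓ + Q * C μ (toℕ i))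
            ≈⟨ split-1 _ (+-congʳ (+-cong (*-congˡ (B₀≈C₀ μ)) (sym Bₗ≈))) ⟩
          (p * N + Q) * B μ (toℕ i) + (Q * C μ 0 + B μ ℓ + Q * C μ (toℕ i))
            ≈⟨ solve 7 (λ p N Q bᵢ c₀ bₗ cᵢ → (p :* N :+ Q) :* bᵢ :+ (Q :* c₀ :+ bₗ :+ Q :* cᵢ) :=
                 con 1 :* (bₗ :+ con 0) :+ Q :* (bᵢ :+ con 0) :+ (Q :* (con 0 :+ cᵢ) :+ Q :* (con 0 :+ c₀)) :+ p :* (N :* bᵢ))
                 refl p N Q _ _ _ _ ⟩
          _ ∎

      negative-step : LastNegative n μ
      negative-step i = begin
        ∑[ w ∈ words n μ ] wt ((i , Sign.-) ∷ w) ≈⟨ ∑-step m μ (i , Sign.-) ih ⟩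
        t * ([ m ]! q * _)
          -- When the next entry is negative and in row i, a positive entry never is a descent, a
          -- negative one exactly when it lies in row i or lower.
          ≈⟨ *-congˡ (*-congˡ (+-cong (descent-coefficient Sign.+ Sign.- 1# 1# pos-neg i _) (descent-coefficient Sign.- Sign.- Q 1# neg-neg i _))) ⟩
        t * ([ m ]! q * (∑[ j ∈ allFin ℓ ] (step 1# 1# (toℕ i) j * atRemovable B μ j)
                       + ∑[ j ∈ allFin ℓ ] (step Q 1# (toℕ i) j * (t * atRemovable C μ j))))
          ≈⟨ *-congˡ (factorials (finish n (B-sum 1# 1# (toℕ i) i≤ℓ) (C-sum Q 1# (toℕ i) i≤ℓ) balance)) ⟩
        t * ([ n ]! q * C μ (toℕ i)) ≈⟨ solve 3 (λ t f c → t :* (f :* c) := f :* (t :* c)) refl t _ _ ⟩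
        [ n ]! q * (t * C μ (toℕ i)) ∎
        where
        i≤ℓ = ℕ.<⇒≤ (Fin.toℕ<n i)

        pos-neg : ∀ (i j : Fin ℓ) → (if isDescent (i , Sign.+) (j , Sign.-) then Q else 1#) ≡ step 1# 1# (toℕ j) i
        pos-neg i j with toℕ i <ᵇ toℕ j
        ... | true  = ≡.refl
        ... | false = ≡.refl

        neg-neg : ∀ (i j : Fin ℓ) → (if isDescent (i , Sign.-) (j , Sign.-) then Q else 1#) ≡ step Q 1# (toℕ j) i
        neg-neg i j with toℕ i <ᵇ toℕ j
        ... | true  = ≡.refl
        ... | false = ≡.refl

        -- With subtraction: (B_0 - B_ℓ) + (C_i - C_0) + Q (C_ℓ - C_i) = (1 - Q) C_i.
        balance : 1# * (B μ (toℕ i) + 0#) + 1# * (B μ 0 + 0#) + (Q * (0# + C μ ℓ) + 1# * (0# + C μ (toℕ i)))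
          ≈ 1# * (B μ ℓ + 0#) + 1# * (B μ (toℕ i) + 0#) + (Q * (0# + C μ (toℕ i)) + 1# * (0# + C μ 0))
            + p * (N * C μ (toℕ i))
        balance = begin
          _ ≈⟨ solve 5 (λ Q bᵢ b₀ cₗ cᵢ → con 1 :* (bᵢ :+ con 0) :+ con 1 :* (b₀ :+ con 0) :+ (Q :* (con 0 :+ cₗ) :+ con 1 :* (con 0 :+ cᵢ))
                 := con 1 :* cᵢ :+ (bᵢ :+ b₀ :+ Q :* cₗ)) refl Q _ _ _ _ ⟩
          1# * C μ (toℕ i) + (B μ (toℕ i) + B μ 0 + Q * C μ ℓ)
            ≈⟨ split-1 _ (+-cong (+-congˡ (B₀≈C₀ μ)) (sym Bₗ≈)) ⟩
          (p * N + Q) * C μ (toℕ i) + (B μ (toℕ i) + C μ 0 + B μ ℓ)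
            ≈⟨ solve 7 (λ p N Q bᵢ c₀ bₗ cᵢ → (p :* N :+ Q) :* cᵢ :+ (bᵢ :+ c₀ :+ bₗ) :=
                 con 1 :* (bₗ :+ con 0) :+ con 1 :* (bᵢ :+ con 0) :+ (Q :* (con 0 :+ cᵢ) :+ con 1 :* (con 0 :+ c₀)) :+ p :* (N :* cᵢ))
                 refl p N Q _ _ _ _ ⟩
          _ ∎

      total-step : Total n μ
      total-step = begin
        ∑[ w ∈ words n μ ] wt w ≈⟨ ∑-words m μ wt ⟩
        ∑[ i ∈ is ] ∑[ s ∈ signs ] ∑[ w ∈ words m (dec μ i) ] wt ((i , s) ∷ w)
          ≈⟨ ∑-cong is (λ i → ∑-cong signs {λ s → ∑[ w ∈ words m (dec μ i) ] wt ((i , s) ∷ w)}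
               {λ s → 1# * ∑[ w ∈ words m (dec μ i) ] wt ((i , s) ∷ w)} λ s → sym (*-identityˡ _)) ⟩
        ∑[ i ∈ is ] ∑[ s ∈ signs ] (1# * ∑[ w ∈ words m (dec μ i) ] wt ((i , s) ∷ w))
          ≈⟨ collect m μ (λ _ → 1#) ih ⟩
        [ m ]! q * (∑[ j ∈ allFin ℓ ] (1# * atRemovable B μ j) + ∑[ j ∈ allFin ℓ ] (1# * (t * atRemovable C μ j)))
          ≈⟨ factorials (finish n (B-sum 1# 1# 0 z≤n) (C-sum 1# 1# 0 z≤n) balance) ⟩
        [ n ]! q * C μ ℓ ∎
        where
        is = filter (removable? μ) (allFin ℓ)

        -- With subtraction: (B_0 - B_ℓ) + (C_ℓ - C_0) = (1 - Q) C_ℓ.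
        balance : 1# * (B μ 0 + 0#) + 1# * (B μ 0 + 0#) + (1# * (0# + C μ ℓ) + 1# * (0# + C μ 0))
          ≈ 1# * (B μ ℓ + 0#) + 1# * (B μ 0 + 0#) + (1# * (0# + C μ 0) + 1# * (0# + C μ 0)) + p * (N * C μ ℓ)
        balance = begin
          _ ≈⟨ solve 3 (λ b₀ cₗ c₀ → con 1 :* (b₀ :+ con 0) :+ con 1 :* (b₀ :+ con 0) :+ (con 1 :* (con 0 :+ cₗ) :+ con 1 :* (con 0 :+ c₀))
                 := con 1 :* cₗ :+ (b₀ :+ b₀ :+ c₀)) refl _ _ _ ⟩
          1# * C μ ℓ + (B μ 0 + B μ 0 + C μ 0)
            ≈⟨ split-1 _ (+-congʳ (+-congˡ (B₀≈C₀ μ))) ⟩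
          (p * N + Q) * C μ ℓ + (B μ 0 + C μ 0 + C μ 0)
            ≈⟨ solve 6 (λ p N Q b₀ c₀ cₗ → (p :* N :+ Q) :* cₗ :+ (b₀ :+ c₀ :+ c₀) :=
                 con 1 :* (Q :* cₗ :+ con 0) :+ con 1 :* (b₀ :+ con 0) :+ (con 1 :* (con 0 :+ c₀) :+ con 1 :* (con 0 :+ c₀)) :+ p :* (N :* cₗ))
                 refl p N Q _ _ _ ⟩
          1# * (Q * C μ ℓ + 0#) + 1# * (B μ 0 + 0#) + (1# * (0# + C μ 0) + 1# * (0# + C μ 0)) + p * (N * C μ ℓ)
            ≈⟨ +-congʳ (+-congʳ (+-congʳ (*-congˡ (+-congʳ (sym Bₗ≈))))) ⟩
          _ ∎

    -- Without removable cells the step rules make `B μ` and `C μ` constant in i. Their values at ℓ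
    -- are found from the hook formula, whose products are trivial here.
    module Empty {ℓ} (μ : Shape ℓ) (part : IsPartition μ) (size≡0′ : size μ ≡ 0) where

      atRemovable≈0 : ∀ (D : ∀ {ℓ} → Shape ℓ → ℕ → Carrier) i → atRemovable D μ i ≈ 0#
      atRemovable≈0 D i = split (removable? μ i)
        where
        split : (r : Dec (Removable μ i)) → (if does r then D (dec μ i) (toℕ i) else 0#) ≈ 0#
        split (no _)            = refl
        split (yes (0<μᵢ , _)) = ⊥-elim (ℕ.n≮0 (≡.subst (0 <_) (size≡0 μ size≡0′ i) 0<μᵢ))

      constant : ∀ {ℓ} (X : ℕ → Carrier) → (∀ (j : Fin ℓ) → X (toℕ j) ≈ X (suc (toℕ j))) →
                 ∀ i → i ≤ ℓ → X i ≈ X ℓ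
      constant {zero}  X h zero    _         = refl
      constant {suc ℓ} X h zero    _         = trans (h fzero) (constant (λ i → X (suc i)) (λ j → h (fsuc j)) 0 z≤n)
      constant {suc ℓ} X h (suc i) (s≤s i≤ℓ) = constant (λ i → X (suc i)) (λ j → h (fsuc j)) i i≤ℓ

      products : ∀ {ℓ} (μ : Shape ℓ) → (∀ i → μ i ≡ 0) → ∀ x →
                 hookProduct (tabulate μ) ≈ 1# × contentProduct x t (tabulate μ) ≈ 1#
      products {zero}  μ μ≡0 x = refl , refl
      products {suc ℓ} μ μ≡0 x rewrite μ≡0 fzero =
        let h≈1 , c≈1 = products (λ i → μ (fsuc i)) (λ i → μ≡0 (fsuc i)) (q * x) in
        trans (*-identityˡ _) h≈1 , trans (*-identityˡ _) c≈1

      Cₗ≈1 : C μ ℓ ≈ 1#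
      Cₗ≈1 = begin
        C μ ℓ                                                        ≡⟨ C-last μ ⟩
        jacobiTrudi (h 1# t) (tabulate μ)                            ≈⟨ *-identityʳ _ ⟨
        jacobiTrudi (h 1# t) (tabulate μ) * 1#                       ≈⟨ *-congˡ (proj₁ (products μ (size≡0 μ size≡0′) 1#)) ⟨
        jacobiTrudi (h 1# t) (tabulate μ) * hookProduct (tabulate μ) ≈⟨ jacobiTrudi≈content/hook (isPartition⇒staircase μ part) 1# t ⟩
        contentProduct 1# t (tabulate μ)                             ≈⟨ proj₂ (products μ (size≡0 μ size≡0′) 1#) ⟩
        1# ∎

      C≈1 : ∀ i → i ≤ ℓ → C μ i ≈ 1#
      C≈1 i i≤ℓ = trans (constant (C μ) (λ j → sym (trans (C-step μ part j)
        (trans (+-congˡ (trans (*-congˡ (trans (*-congˡ (atRemovable≈0 C j)) (zeroʳ t))) (zeroʳ p))) (+-identityʳ _)))) i i≤ℓ) Cₗ≈1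

      B≈1 : ∀ i → i ≤ ℓ → B μ i ≈ 1#
      B≈1 i i≤ℓ = begin
        B μ i              ≈⟨ constant (B μ) (λ j → trans (B-step μ part j)
                                (trans (+-congˡ (trans (*-congˡ (atRemovable≈0 B j)) (zeroʳ p))) (+-identityʳ _))) i i≤ℓ ⟩
        B μ ℓ              ≈⟨ B-last μ part ⟩
        q ^ size μ * C μ ℓ ≈⟨ *-cong (reflexive (≡.cong (q ^_) size≡0′)) Cₗ≈1 ⟩
        1# * 1#            ≈⟨ *-identityˡ 1# ⟩
        1# ∎

  ∑-wt-words : ∀ {ℓ} n (μ : Shape ℓ) → IsPartition μ → size μ ≡ n →
               LastPositive n μ × LastNegative n μ × Total n μ
  ∑-wt-words zero μ part size≡ =
    (λ i → trans (solve 0 (con 1 :* con 1 :+ con 0 := con 1) refl) (sym (trans (*-identityˡ _) (B≈1 (toℕ i) (i≤ℓ i))))) ,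
    (λ i → trans (solve 1 (λ t → con 1 :* (t :* con 1) :+ con 0 := t) refl t)
             (sym (trans (*-identityˡ _) (trans (*-congˡ (C≈1 (toℕ i) (i≤ℓ i))) (*-identityʳ t))))) ,
    trans (solve 0 (con 1 :* con 1 :+ con 0 := con 1) refl) (sym (trans (*-identityˡ _) Cₗ≈1))
    where
    open Empty μ part size≡
    i≤ℓ : ∀ i → toℕ i ≤ _
    i≤ℓ i = ℕ.<⇒≤ (Fin.toℕ<n i)
  ∑-wt-words (suc m) μ part size≡ = positive-step , negative-step , total-step
    where
    ih : ∀ i → Removable μ i → LastPositive m (dec μ i) × LastNegative m (dec μ i)
    ih i rem@(0<μᵢ , _) =
      let pos , neg , _ = ∑-wt-words m (dec μ i) (dec-isPartition part rem)
                            (ℕ.suc-injective (≡.trans (≡.sym (size-dec μ i 0<μᵢ)) size≡)) in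
      pos , neg
    open Step m μ part size≡ ih

  ∑-wt-words*hooks : ∀ {ℓ} (μ : Shape ℓ) → IsPartition μ →
    ∑ (words (size μ) μ) wt * hookProduct (tabulate μ) ≈ [ size μ ]! q * contentProduct 1# t (tabulate μ)
  ∑-wt-words*hooks {ℓ} μ part = begin
    ∑ (words (size μ) μ) wt * hookProduct (tabulate μ)
      ≈⟨ *-congʳ (proj₂ (proj₂ (∑-wt-words (size μ) μ part ≡.refl))) ⟩
    [ size μ ]! q * C μ ℓ * hookProduct (tabulate μ)
      ≡⟨ ≡.cong (λ x → [ size μ ]! q * x * hookProduct (tabulate μ)) (C-last μ) ⟩
    [ size μ ]! q * jacobiTrudi (h 1# t) (tabulate μ) * hookProduct (tabulate μ) ≈⟨ *-assoc _ _ _ ⟩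
    [ size μ ]! q * (jacobiTrudi (h 1# t) (tabulate μ) * hookProduct (tabulate μ))
      ≈⟨ *-congˡ (jacobiTrudi≈content/hook (isPartition⇒staircase μ part) 1# t) ⟩
    [ size μ ]! q * contentProduct 1# t (tabulate μ) ∎

-- Standard signed tableaux and words

module WordTableaux where
  open ≡ using (refl; sym; trans; cong; cong₂; subst; subst₂)

  data IsWord {ℓ} : ℕ → Shape ℓ → List (Letter ℓ) → Set where
    []  : ∀ {μ} → (∀ i → μ i ≡ 0) → IsWord 0 μ []
    _∷_ : ∀ {n μ i s w} → Removable μ i → IsWord n (dec μ i) w → IsWord (suc n) μ ((i , s) ∷ w)

  isWord-length : ∀ {ℓ n} {μ : Shape ℓ} {w} → IsWord n μ w → length w ≡ n
  isWord-length ([] _)   = refl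
  isWord-length (_ ∷ iw) = cong suc (isWord-length iw)

  private
    ∷-words : ∀ {ℓ} → (Letter ℓ → List (List (Letter ℓ))) → Letter ℓ → List (List (Letter ℓ))
    ∷-words f a = map (a ∷_) (f a)

    lastLetters : ∀ {ℓ} → Shape ℓ → List (Letter ℓ)
    lastLetters μ = cartesianProduct (filter (removable? μ) (allFin _)) signs

  ∈-words⁻ : ∀ {ℓ} n {μ : Shape ℓ} {w} → size μ ≡ n → w ∈ words n μ → IsWord n μ w
  ∈-words⁻ zero    {μ} size≡ (here refl) = [] (size≡0 μ size≡)
  ∈-words⁻ (suc n) {μ} size≡ w∈
    with (i , s) , a∈ , aw∈ ← find (∈-concatMap⁻ (∷-words λ a → words n (dec μ (proj₁ a))) {xs = lastLetters μ} w∈)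
    with w , w∈ , refl ← ∈-map⁻ ((i , s) ∷_) aw∈
    with _ , rem ← ∈-filter⁻ (removable? μ) {xs = allFin _} (proj₁ (∈-cartesianProduct⁻ (filter (removable? μ) (allFin _)) signs a∈))
    = rem ∷ ∈-words⁻ n (ℕ.suc-injective (trans (sym (size-dec μ i (proj₁ rem))) size≡)) w∈

  ∈-words⁺ : ∀ {ℓ n} {μ : Shape ℓ} {w} → IsWord n μ w → w ∈ words n μ
  ∈-words⁺ ([] _) = here refl
  ∈-words⁺ {n = suc n} {μ} (_∷_ {i = i} {s} rem iw) =
    ∈-concatMap⁺ (∷-words λ a → words n (dec μ (proj₁ a))) {xs = lastLetters μ}
      (lose (∈-cartesianProduct⁺ (∈-filter⁺ (removable? μ) (∈-allFin i) rem) (∈-signs s)) (∈-map⁺ ((i , s) ∷_) (∈-words⁺ iw)))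
    where
    ∈-signs : ∀ s → s ∈ signs
    ∈-signs Sign.+ = here refl
    ∈-signs Sign.- = there (here refl)

  words! : ∀ {ℓ} n (μ : Shape ℓ) → Unique (words n μ)
  words! zero    μ = [] ∷ []
  words! {ℓ} (suc n) μ = blocks (Unique.cartesianProduct⁺ (Unique.filter⁺ (removable? μ) (Unique.allFin⁺ _)) (((λ ()) ∷ []) ∷ [] ∷ []))
    where
    f : Letter ℓ → List (List (Letter ℓ))
    f a = words n (dec μ (proj₁ a))

    blocks : ∀ {as} → Unique as → Unique (concatMap (∷-words f) as)
    blocks [] = []
    blocks {a ∷ as} (a∉ ∷ as!) = Unique.++⁺
      (Unique.map⁺ (λ { refl → refl }) (words! n (dec μ (proj₁ a))))
      (blocks as!)
      λ (w∈ , w∈′) → disjoint w∈ w∈′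
      where
      disjoint : ∀ {w} → w ∈ ∷-words f a → w ∈ concatMap (∷-words f) as → _
      disjoint w∈ w∈′
        with _ , _ , refl ← ∈-map⁻ (a ∷_) w∈
        with b , b∈ , bw∈ ← find (∈-concatMap⁻ (∷-words f) {xs = as} w∈′)
        with _ , _ , refl ← ∈-map⁻ (b ∷_) bw∈
        = All.lookup a∉ b∈ refl

  -- The label (counted from 0) and the sign that a word puts into column c of row r of
  -- the shape μ; junk outside μ.
  content : ∀ {ℓ} → List (Letter ℓ) → Shape ℓ → Fin ℓ → ℕ → ℕ × Sign
  content []            μ r c = 0 , Sign.+
  content ((i , s) ∷ w) μ r c =
    if does (c ℕ.<? dec μ i r) then content w (dec μ i) r c else (length w , s)

  label′ : ∀ {ℓ} → List (Letter ℓ) → Shape ℓ → Fin ℓ → ℕ → ℕ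
  label′ w μ r c = proj₁ (content w μ r c)

  module _ {ℓ} {μ : Shape ℓ} {i : Fin ℓ} {s : Sign} {w : List (Letter ℓ)} {r : Fin ℓ} {c : ℕ} where

    content-inner : c < dec μ i r → content ((i , s) ∷ w) μ r c ≡ content w (dec μ i) r c
    content-inner c< rewrite dec-true (c ℕ.<? dec μ i r) c< = refl

    content-corner : ¬ c < dec μ i r → content ((i , s) ∷ w) μ r c ≡ (length w , s)
    content-corner c≮ rewrite dec-false (c ℕ.<? dec μ i r) c≮ = refl

  corner : ∀ {ℓ} {μ : Shape ℓ} {i r c} → c < μ r → ¬ c < dec μ i r → r ≡ i × suc c ≡ μ r
  corner {μ = μ} {i} {r} {c} c<μᵣ c≮ with r Fin.≟ i
  ... | no  r≢i  = contradiction (subst (c <_) (sym (dec-≢ μ r≢i)) c<μᵣ) c≮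
  ... | yes refl = refl , ℕ.≤-antisym c<μᵣ (ℕ.≮⇒≥ λ 1+c<μᵣ →
    c≮ (subst (c <_) (sym (dec-at μ i)) (ℕ.<-≤-trans (ℕ.n<1+n c) (ℕ.pred-mono-≤ 1+c<μᵣ))))

  label-bound : ∀ {ℓ n} {μ : Shape ℓ} {w r c} → IsWord n μ w → c < μ r → label′ w μ r c < n
  label-bound {r = r} ([] μ≡0) c< = contradiction (subst (_ <_) (μ≡0 r) c<) ℕ.n≮0
  label-bound {μ = μ} {r = r} {c} (_∷_ {n = n} {i = i} {s} {w} rem iw) c< = go (c ℕ.<? dec μ i r)
    where
    go : Dec (c < dec μ i r) → label′ ((i , s) ∷ w) μ r c < suc n
    go (yes c<′) rewrite content-inner {μ = μ} {i} {s} {w} c<′ = ℕ.m<n⇒m<1+n (label-bound iw c<′)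
    go (no  c≮) rewrite content-corner {μ = μ} {i} {s} {w} c≮  = ℕ.≤-reflexive (cong suc (isWord-length iw))

  label-corner : ∀ {ℓ n} {μ : Shape ℓ} {i s w r c} → IsWord n (dec μ i) w →
                 ¬ c < dec μ i r → label′ ((i , s) ∷ w) μ r c ≡ n
  label-corner {μ = μ} {i} {s} {w} iw c≮ =
    trans (cong proj₁ (content-corner {μ = μ} {i} {s} {w} c≮)) (isWord-length iw)

  label-inner< : ∀ {ℓ n} {μ : Shape ℓ} {i s w r c} → IsWord n (dec μ i) w →
                 c < dec μ i r → label′ ((i , s) ∷ w) μ r c < n
  label-inner< {n = n} {μ} {i} {s} {w} iw c< =
    subst (_< n) (sym (cong proj₁ (content-inner {μ = μ} {i} {s} {w} c<))) (label-bound iw c<)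

  private
    proj₁-resp-< : ∀ {x x′ y y′ : ℕ × Sign} → x ≡ x′ → y ≡ y′ → proj₁ x′ < proj₁ y′ → proj₁ x < proj₁ y
    proj₁-resp-< refl refl x<y = x<y

  -- If the cell further right is the removed corner, it carries the largest label; otherwise both
  -- cells survive the removal. The same dichotomy proves `label-columns`.
  label-rows : ∀ {ℓ n} {μ : Shape ℓ} {w r c c′} → IsWord n μ w → c < c′ → c′ < μ r →
               label′ w μ r c < label′ w μ r c′
  label-rows {r = r} ([] μ≡0) _ c′< = contradiction (subst (_ <_) (μ≡0 r) c′<) ℕ.n≮0
  label-rows {μ = μ} {r = r} {c} {c′} (_∷_ {i = i} {s} {w} rem iw) c<c′ c′< = go (c′ ℕ.<? dec μ i r)
    where
    go : Dec (c′ < dec μ i r) → _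
    go (yes c′<′) = proj₁-resp-< (content-inner {μ = μ} {i} {s} {w} (ℕ.<-trans c<c′ c′<′)) (content-inner {μ = μ} {i} {s} {w} c′<′)
                            (label-rows iw c<c′ c′<′)
    go (no c′≮) with refl , 1+c′≡ ← corner {μ = μ} c′< c′≮ =
      subst (label′ ((i , s) ∷ w) μ i c <_) (sym (label-corner {μ = μ} {i} {s} iw c′≮)) (label-inner< {s = s} iw
        (subst (c <_) (sym (trans (dec-at μ i) (cong pred (sym 1+c′≡)))) c<c′))

  label-columns : ∀ {ℓ n} {μ : Shape ℓ} {w r r′ c} → IsPartition μ → IsWord n μ w → r Fin.< r′ → c < μ r′ →
                  label′ w μ r c < label′ w μ r′ c
  label-columns {r′ = r′} _ ([] μ≡0) _ c< = contradiction (subst (_ <_) (μ≡0 r′) c<) ℕ.n≮0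
  label-columns {μ = μ} {r = r} {r′} {c} part (_∷_ {i = i} {s} {w} rem iw) r<r′ c< = go (c ℕ.<? dec μ i r′)
    where
    part′ = dec-isPartition part rem
    go : Dec (c < dec μ i r′) → _
    go (yes c<′) = proj₁-resp-< (content-inner {μ = μ} {i} {s} {w} (ℕ.<-≤-trans c<′ (part′ r r′ r<r′))) (content-inner {μ = μ} {i} {s} {w} c<′)
                           (label-columns part′ iw r<r′ c<′)
    go (no c≮) with refl , _ ← corner {μ = μ} c< c≮ =
      subst (label′ ((i , s) ∷ w) μ r c <_) (sym (label-corner {μ = μ} {i} {s} iw c≮)) (label-inner< {s = s} iw
        (subst (c <_) (sym (dec-≢ μ λ { refl → ℕ.<-irrefl refl r<r′ })) (ℕ.<-≤-trans c< (part r i r<r′))))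

  label-injective : ∀ {ℓ n} {μ : Shape ℓ} {w r c r′ c′} → IsWord n μ w → c < μ r → c′ < μ r′ →
                    label′ w μ r c ≡ label′ w μ r′ c′ → r ≡ r′ × c ≡ c′
  label-injective {r = r} ([] μ≡0) c< = contradiction (subst (_ <_) (μ≡0 r) c<) ℕ.n≮0
  label-injective {μ = μ} {r = r} {c} {r′} {c′} (_∷_ {i = i} {s} {w} rem iw) c< c′< eq
    = go (c ℕ.<? dec μ i r) (c′ ℕ.<? dec μ i r′)
    where
    go : Dec (c < dec μ i r) → Dec (c′ < dec μ i r′) → _
    go (yes c<′) (yes c′<′) = label-injective iw c<′ c′<′
      (trans (sym (cong proj₁ (content-inner {μ = μ} {i} {s} {w} c<′)))
        (trans eq (cong proj₁ (content-inner {μ = μ} {i} {s} {w} c′<′))))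
    go (yes c<′) (no c′≮) = contradiction
      (label-inner< {s = s} iw c<′) (ℕ.<-irrefl (trans eq (label-corner {s = s} iw c′≮)))
    go (no c≮) (yes c′<′) = contradiction
      (label-inner< {s = s} iw c′<′) (ℕ.<-irrefl (trans (sym eq) (label-corner {s = s} iw c≮)))
    go (no c≮) (no c′≮)
      with refl , 1+c≡ ← corner {μ = μ} c< c≮ | refl , 1+c′≡ ← corner {μ = μ} c′< c′≮
      = refl , ℕ.suc-injective (trans 1+c≡ (sym 1+c′≡))

  label-surjective : ∀ {ℓ n} {μ : Shape ℓ} {w} → IsWord n μ w → ∀ {k} → k < n →
                     ∃₂ λ r c → c < μ r × label′ w μ r c ≡ k
  label-surjective {n = suc n} {μ} (_∷_ {i = i} {s} {w} rem iw) {k} k<1+n with k ℕ.≟ n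
  ... | yes refl = i , pred (μ i) , ℕ.≤-reflexive (ℕ.suc-pred (μ i) {{ℕ.>-nonZero (proj₁ rem)}}) ,
    label-corner {s = s} iw (subst (λ m → ¬ pred (μ i) < m) (sym (dec-at μ i)) (ℕ.<-irrefl refl))
  ... | no  k≢n with r , c , c< , eq ← label-surjective iw (ℕ.≤∧≢⇒< (ℕ.≤-pred k<1+n) k≢n) =
    r , c , ℕ.<-≤-trans c< (dec-≤ μ i r) , trans (cong proj₁ (content-inner {μ = μ} {i} {s} {w} c<)) eq

  -- LetterAt w k a: the entry with label k (counted from 0) is described by a.
  data LetterAt {ℓ} : List (Letter ℓ) → ℕ → Letter ℓ → Set where
    here  : ∀ {a w} → LetterAt (a ∷ w) (length w) a
    there : ∀ {a w k b} → LetterAt w k b → LetterAt (a ∷ w) k b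

  letterAt-bound : ∀ {ℓ w k} {a : Letter ℓ} → LetterAt w k a → k < length w
  letterAt-bound here      = ℕ.≤-refl
  letterAt-bound (there l) = ℕ.m<n⇒m<1+n (letterAt-bound l)

  letterAt-functional : ∀ {ℓ w k} {a b : Letter ℓ} → LetterAt w k a → LetterAt w k b → a ≡ b
  letterAt-functional l m = go l m refl
    where
    go : ∀ {ℓ w k k′} {a b : Letter ℓ} → LetterAt w k a → LetterAt w k′ b → k ≡ k′ → a ≡ b
    go here      here      _    = refl
    go here      (there m) refl = contradiction (letterAt-bound m) (ℕ.<-irrefl refl)
    go (there l) here      refl = contradiction (letterAt-bound l) (ℕ.<-irrefl refl)
    go (there l) (there m) eq   = go l m eq

  content-letter : ∀ {ℓ n} {μ : Shape ℓ} {w r c} → IsWord n μ w → c < μ r →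
                   LetterAt w (label′ w μ r c) (r , proj₂ (content w μ r c))
  content-letter {r = r} ([] μ≡0) c< = contradiction (subst (_ <_) (μ≡0 r) c<) ℕ.n≮0
  content-letter {μ = μ} {r = r} {c} (_∷_ {i = i} {s} {w} rem iw) c< = go (c ℕ.<? dec μ i r)
    where
    Goal : ℕ × Sign → Set
    Goal x = LetterAt ((i , s) ∷ w) (proj₁ x) (r , proj₂ x)

    go : Dec (c < dec μ i r) → Goal (content ((i , s) ∷ w) μ r c)
    go (yes c<′) = subst Goal (sym (content-inner {μ = μ} {i} {s} {w} c<′)) (there (content-letter iw c<′))
    go (no  c≮) with refl , _ ← corner {μ = μ} c< c≮ = subst Goal (sym (content-corner {μ = μ} {i} {s} {w} c≮)) here

  -- The last cell of row i is the corner removed by the first word, so it has the largest label in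
  -- both contents. In the second word only its own corner has that label, so the heads have the
  -- same row and, by the sign there, the same sign.
  content-determines : ∀ {ℓ n} {μ : Shape ℓ} {w w′} → IsWord n μ w → IsWord n μ w′ →
    (∀ r c → c < μ r → content w μ r c ≡ content w′ μ r c) → w ≡ w′
  content-determines ([] _) ([] _) eq = refl
  content-determines {n = suc n} {μ} (_∷_ {i = i} {s} {w} rem iw) (_∷_ {i = i′} {s′} {w′} rem′ iw′) eq =
    go (pred (μ i) ℕ.<? dec μ i′ i)
    where
    c = pred (μ i)

    c<μᵢ : c < μ i
    c<μᵢ = ℕ.≤-reflexive (ℕ.suc-pred (μ i) {{ℕ.>-nonZero (proj₁ rem)}})

    c≮ : ¬ c < dec μ i i
    c≮ = subst (λ m → ¬ c < m) (sym (dec-at μ i)) (ℕ.<-irrefl refl)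

    at-corner : content ((i′ , s′) ∷ w′) μ i c ≡ (n , s)
    at-corner = trans (sym (eq i c c<μᵢ))
      (trans (content-corner {μ = μ} {i} {s} {w} c≮) (cong (_, s) (isWord-length iw)))

    go : Dec (c < dec μ i′ i) → (i , s) ∷ w ≡ (i′ , s′) ∷ w′
    go (yes c<′) = contradiction (subst (_< n) (cong proj₁ at-corner) (label-inner< {s = s′} iw′ c<′)) (ℕ.<-irrefl refl)
    go (no c≮′)
      with refl , _ ← corner {μ = μ} c<μᵢ c≮′
      with refl ← trans (sym (cong proj₂ (content-corner {μ = μ} {i′} {s′} {w′} c≮′))) (cong proj₂ at-corner)
      = cong (_ ∷_) (content-determines iw iw′ λ r c c< →
          trans (sym (content-inner {μ = μ} {i} {s} {w} c<))
            (trans (eq r c (ℕ.<-≤-trans c< (dec-≤ μ i r))) (content-inner {μ = μ} {i} {s} {w′} c<)))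

  fill : ∀ {A : Set} {λs} → (Cell λs → A) → Filling A λs
  fill {λs = []}     f = []
  fill {λs = k ∷ λs} f = Vec.tabulate (λ c → f ⟨ fzero , c ⟩) ∷ fill {λs = λs} (λ (⟨ r , c ⟩) → f ⟨ fsuc r , c ⟩)

  fill-at : ∀ {A : Set} {λs} (f : Cell λs → A) x → fill f at x ≡ f x
  fill-at {λs = k ∷ λs} f ⟨ fzero  , c ⟩ = Vec.lookup∘tabulate (λ c → f ⟨ fzero , c ⟩) c
  fill-at {λs = k ∷ λs} f ⟨ fsuc r , c ⟩ = fill-at {λs = λs} (λ (⟨ r , c ⟩) → f ⟨ fsuc r , c ⟩) ⟨ r , c ⟩

  at-injective : ∀ {A : Set} {λs} (T T′ : Filling A λs) → (∀ x → T at x ≡ T′ at x) → T ≡ T′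
  at-injective []      []        eq = refl
  at-injective (v ∷ T) (v′ ∷ T′) eq = cong₂ _∷_
    (trans (sym (Vec.tabulate∘lookup v))
      (trans (Vec.tabulate-cong (λ c → eq ⟨ fzero , c ⟩)) (Vec.tabulate∘lookup v′)))
    (at-injective T T′ (λ (⟨ r , c ⟩) → eq ⟨ fsuc r , c ⟩))

  cell≡ : ∀ {λs} {x y : Cell λs} → Cell.rowIx x ≡ Cell.rowIx y →
          toℕ (Cell.colIx x) ≡ toℕ (Cell.colIx y) → x ≡ y
  cell≡ {x = ⟨ r , c ⟩} {⟨ r , c′ ⟩} refl eq = cong ⟨ r ,_⟩ (Fin.toℕ-injective eq)

  module _ {n : ℕ} {λs : List ℕ} where

    open Cell
    private
      μ₀ = lookup λs

    Encodes : SignedFilling n λs → List (Letter (length λs)) → Set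
    Encodes T w = ∀ x → (toℕ (label T x) , sign T x) ≡ content w μ₀ (rowIx x) (toℕ (colIx x))

    encodes-unique : ∀ {T T′ w} → Encodes T w → Encodes T′ w → T ≡ T′
    encodes-unique {T} {T′} e e′ = at-injective T T′ λ x →
      let eq = trans (e x) (sym (e′ x)) in
      cong₂ _,_ (Fin.toℕ-injective (cong proj₁ eq)) (cong proj₂ eq)

    encodes-functional : ∀ {T w w′} → IsWord n μ₀ w → IsWord n μ₀ w′ → Encodes T w → Encodes T w′ → w ≡ w′
    encodes-functional {T} {w} {w′} iw iw′ e e′ = content-determines iw iw′ λ r c c< →
      subst (λ c → content w μ₀ r c ≡ content w′ μ₀ r c) (Fin.toℕ-fromℕ< c<)
        (trans (sym (e ⟨ r , fromℕ< c< ⟩)) (e′ ⟨ r , fromℕ< c< ⟩))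

    decode : IsPartition μ₀ → ∀ {w} → IsWord n μ₀ w → ∃ λ T → IsStandard T × Encodes T w
    decode part {w} iw = T , standard (inj , surj) rows columns , encodes
      where
      bound : ∀ x → label′ w μ₀ (rowIx x) (toℕ (colIx x)) < n
      bound x = label-bound iw (Fin.toℕ<n (colIx x))

      T : SignedFilling n λs
      T = fill λ x → fromℕ< (bound x) , proj₂ (content w μ₀ (rowIx x) (toℕ (colIx x)))

      encodes : Encodes T w
      encodes x = cong₂ _,_
        (trans (cong (toℕ ∘ proj₁) (fill-at _ x)) (Fin.toℕ-fromℕ< (bound x))) (cong proj₂ (fill-at _ x))

      label≡ : ∀ x → toℕ (label T x) ≡ label′ w μ₀ (rowIx x) (toℕ (colIx x))
      label≡ x = cong proj₁ (encodes x)

      inj : ∀ {x y} → label T x ≡ label T y → x ≡ y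
      inj {x} {y} eq =
        let r≡ , c≡ = label-injective iw (Fin.toℕ<n (colIx x)) (Fin.toℕ<n (colIx y))
                        (trans (sym (label≡ x)) (trans (cong toℕ eq) (label≡ y))) in
        cell≡ r≡ c≡

      surj : ∀ k → ∃ λ x → ∀ {z} → z ≡ x → label T z ≡ k
      surj k with r , c , c< , eq ← label-surjective iw (Fin.toℕ<n k) =
        ⟨ r , fromℕ< c< ⟩ , λ { refl → Fin.toℕ-injective (trans (label≡ _)
          (trans (cong (label′ w μ₀ r) (Fin.toℕ-fromℕ< c<)) eq)) }

      rows : ∀ x y → row x ≡ row y → col x < col y → entry T x < entry T y
      rows x y r≡ (s≤s c<) = s≤s (subst₂ _<_ (sym (label≡ x)) (sym (label≡ y))
        (subst (λ r → label′ w μ₀ r (toℕ (colIx x)) < label′ w μ₀ (rowIx y) (toℕ (colIx y)))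
          (sym (Fin.toℕ-injective (ℕ.suc-injective r≡))) (label-rows iw c< (Fin.toℕ<n (colIx y)))))

      columns : ∀ x y → col x ≡ col y → row x < row y → entry T x < entry T y
      columns x y c≡ (s≤s r<) = s≤s (subst₂ _<_ (sym (label≡ x)) (sym (label≡ y))
        (subst (λ c → label′ w μ₀ (rowIx x) c < label′ w μ₀ (rowIx y) (toℕ (colIx y)))
          (sym (ℕ.suc-injective c≡)) (label-columns part iw r< (Fin.toℕ<n (colIx y)))))

    module _ {T : SignedFilling n λs} (std : IsStandard T) where

      open IsStandard std

      cellAt : ∀ {k} → k < n → ∃ λ x → toℕ (label T x) ≡ k
      cellAt k<n = let x , eq = proj₂ bijective (fromℕ< k<n) in
        x , trans (cong toℕ (eq refl)) (Fin.toℕ-fromℕ< k<n)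

      label-inj : ∀ {x y} → toℕ (label T x) ≡ toℕ (label T y) → x ≡ y
      label-inj eq = proj₁ bijective (Fin.toℕ-injective eq)

      -- The cells with label below k form the shape μ; remove the one with label k - 1.
      encodeUpTo : ∀ k μ → k ≤ n → (∀ r → μ r ≤ μ₀ r) →
        (∀ x → toℕ (label T x) < k → toℕ (colIx x) < μ (rowIx x)) →
        (∀ x → toℕ (colIx x) < μ (rowIx x) → toℕ (label T x) < k) →
        ∃ λ w → IsWord k μ w × (∀ x → toℕ (label T x) < k →
          (toℕ (label T x) , sign T x) ≡ content w μ (rowIx x) (toℕ (colIx x)))
      encodeUpTo zero μ _ μ≤ into from = [] , [] μ≡0 , λ _ ()
        where
        μ≡0 : ∀ r → μ r ≡ 0
        μ≡0 r with μ r in eq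
        ... | zero  = refl
        ... | suc _ = contradiction
          (from ⟨ r , fromℕ< 0<λᵣ ⟩ (subst (_< μ r) (sym (Fin.toℕ-fromℕ< 0<λᵣ)) 0<μᵣ)) ℕ.n≮0
          where
          0<μᵣ : 0 < μ r
          0<μᵣ = subst (0 <_) (sym eq) (s≤s z≤n)
          0<λᵣ = ℕ.<-≤-trans 0<μᵣ (μ≤ r)
      encodeUpTo (suc k) μ k<n μ≤ into from
        with ⟨ r₀ , c₀ ⟩ , label≡k ← cellAt k<n = remove
        where
        x₀ : Cell λs
        x₀ = ⟨ r₀ , c₀ ⟩

        entry₀< : ∀ {y} → entry T x₀ < entry T y → ¬ toℕ (label T y) < suc k
        entry₀< (s≤s k<) y≤k = ℕ.<-irrefl refl (ℕ.<-≤-trans k< (subst (_ ≤_) (sym label≡k) (ℕ.≤-pred y≤k)))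

        c₀<μ : toℕ c₀ < μ r₀
        c₀<μ = into x₀ (ℕ.≤-reflexive (cong suc label≡k))

        beyond : ∀ r c → c < μ r → ∃ λ y → rowIx y ≡ r × toℕ (colIx y) ≡ c × toℕ (label T y) < suc k
        beyond r c c<μᵣ = ⟨ r , fromℕ< c<λᵣ ⟩ , refl , Fin.toℕ-fromℕ< c<λᵣ ,
          from _ (subst (_< μ r) (sym (Fin.toℕ-fromℕ< c<λᵣ)) c<μᵣ)
          where c<λᵣ = ℕ.<-≤-trans c<μᵣ (μ≤ r)

        -- A cell of μ to the right of x₀ would have a label above k, although the labels in μ are
        -- at most k. The same argument downwards gives `rem`.
        last : suc (toℕ c₀) ≡ μ r₀
        last with suc (toℕ c₀) ℕ.<? μ r₀
        ... | no  ≮μ = ℕ.≤-antisym c₀<μ (ℕ.≮⇒≥ ≮μ)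
        ... | yes <μ with y , refl , c≡ , y<k ← beyond r₀ (suc (toℕ c₀)) <μ =
          contradiction y<k (entry₀< (rows x₀ y refl (s≤s (ℕ.≤-reflexive (sym c≡)))))

        rem : Removable μ r₀
        rem = ℕ.≤-<-trans z≤n c₀<μ , λ r r₀<r → subst (μ r <_) last (s≤s (ℕ.≮⇒≥ λ c₀<μᵣ → ≮below r r₀<r c₀<μᵣ))
          where
          ≮below : ∀ r → r₀ Fin.< r → ¬ toℕ c₀ < μ r
          ≮below r r₀<r c₀<μᵣ with y , refl , c≡ , y<k ← beyond r (toℕ c₀) c₀<μᵣ =
            contradiction y<k (entry₀< (columns x₀ y (cong suc (sym c≡)) (s≤s r₀<r)))

        μ₀≡ : dec μ r₀ r₀ ≡ toℕ c₀
        μ₀≡ = trans (dec-at μ r₀) (cong pred (sym last))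

        into′ : ∀ x → toℕ (label T x) < k → toℕ (colIx x) < dec μ r₀ (rowIx x)
        into′ x x<k with rowIx x Fin.≟ r₀
        ... | no  r≢  = subst (_ <_) (sym (dec-≢ μ r≢)) (into x (ℕ.m<n⇒m<1+n x<k))
        ... | yes refl = subst (_ <_) (sym μ₀≡) (ℕ.≤∧≢⇒< (ℕ.≤-pred (subst (_ <_) (sym last) (into x (ℕ.m<n⇒m<1+n x<k))))
          λ c≡ → ℕ.<-irrefl (trans (cong (toℕ ∘ label T) (cell≡ refl c≡)) label≡k) x<k)

        from′ : ∀ x → toℕ (colIx x) < dec μ r₀ (rowIx x) → toℕ (label T x) < k
        from′ x c< = ℕ.≤∧≢⇒< (ℕ.≤-pred (from x (ℕ.<-≤-trans c< (dec-≤ μ r₀ (rowIx x))))) λ x≡k →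
          not₀ (label-inj (trans x≡k (sym label≡k))) c<
          where
          not₀ : ∀ {x} → x ≡ x₀ → ¬ toℕ (colIx x) < dec μ r₀ (rowIx x)
          not₀ refl = ℕ.<-irrefl (sym μ₀≡)

        remove : _
        remove with w , iw , h ← encodeUpTo k (dec μ r₀) (ℕ.<⇒≤ k<n)
                      (λ r → ℕ.≤-trans (dec-≤ μ r₀ r) (μ≤ r)) into′ from′ =
          (r₀ , sign T x₀) ∷ w , rem ∷ iw , λ x x<1+k → go x (toℕ (label T x) ℕ.<? k) (ℕ.≤-pred x<1+k)
          where
          go : ∀ x → Dec (toℕ (label T x) < k) → toℕ (label T x) ≤ k →
               (toℕ (label T x) , sign T x) ≡ content ((r₀ , sign T x₀) ∷ w) μ (rowIx x) (toℕ (colIx x))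
          go x (yes x<k) _ = trans (h x x<k) (sym (content-inner {μ = μ} {r₀} {sign T x₀} {w} (into′ x x<k)))
          go x (no x≮k) x≤k with refl ← label-inj {x} {x₀} (trans (ℕ.≤-antisym x≤k (ℕ.≮⇒≥ x≮k)) (sym label≡k)) =
            trans (cong (_, sign T x₀) (trans label≡k (sym (isWord-length iw))))
              (sym (content-corner {μ = μ} {r₀} {sign T x₀} {w} (ℕ.<-irrefl (sym μ₀≡))))

      encode : ∃ λ w → IsWord n μ₀ w × Encodes T w
      encode with w , iw , h ← encodeUpTo n μ₀ ℕ.≤-refl (λ _ → ℕ.≤-refl) (λ x _ → Fin.toℕ<n (colIx x)) (λ x _ → Fin.toℕ<n (label T x)) =
        w , iw , λ x → h x (Fin.toℕ<n (label T x))

  [1‥suc] : ∀ n → [1‥ suc n ] ≡ [1‥ n ] ++ suc n ∷ []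
  [1‥suc] n = trans (cong (map suc) (sym (upTo-∷ʳ n))) (map-++ suc (upTo n) (n ∷ []))

  module _ {P : ℕ → Set} (P? : Decidable P) where

    sum-filter-last : ∀ n → sum (filter P? [1‥ suc n ]) ≡
                      (if does (P? (suc n)) then suc n else 0) ℕ.+ sum (filter P? [1‥ n ])
    sum-filter-last n = trans (cong (sum ∘ filter P?) ([1‥suc] n)) (trans (cong sum (filter-++ P? [1‥ n ] _))
      (trans (sum-++ (filter P? [1‥ n ]) _) (trans (ℕ.+-comm (sum (filter P? [1‥ n ])) _) (cong (ℕ._+ sum (filter P? [1‥ n ])) single))))
      where
      single : sum (filter P? (suc n ∷ [])) ≡ (if does (P? (suc n)) then suc n else 0)
      single with does (P? (suc n))
      ... | true  = ℕ.+-identityʳ (suc n)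
      ... | false = refl

    length-filter-last : ∀ n → length (filter P? [1‥ suc n ]) ≡
                         (if does (P? (suc n)) then 1 else 0) ℕ.+ length (filter P? [1‥ n ])
    length-filter-last n = trans (cong (length ∘ filter P?) ([1‥suc] n)) (trans (cong length (filter-++ P? [1‥ n ] _))
      (trans (length-++ (filter P? [1‥ n ])) (trans (ℕ.+-comm (length (filter P? [1‥ n ])) _) (cong (ℕ._+ length (filter P? [1‥ n ])) single))))
      where
      single : length (filter P? (suc n ∷ [])) ≡ (if does (P? (suc n)) then 1 else 0)
      single with does (P? (suc n))
      ... | true  = refl
      ... | false = refl

    majʷ-filter : ∀ {ℓ} (w : List (Letter ℓ)) →
      (∀ {k a b} → LetterAt w k a → LetterAt w (suc k) b → does (P? (suc k)) ≡ isDescent a b) →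
      sum (filter P? [1‥ length w ∸ 1 ]) ≡ majʷ w
    majʷ-filter []          h = refl
    majʷ-filter (a ∷ [])    h = refl
    majʷ-filter (b ∷ a ∷ w) h = trans (sum-filter-last (length w)) (cong₂ ℕ._+_
      (cong (λ d → if d then suc (length w) else 0) (h (there here) here))
      (majʷ-filter (a ∷ w) (λ l m → h (there l) (there m))))

    negʷ-filter : ∀ {ℓ} (w : List (Letter ℓ)) →
      (∀ {k i s} → LetterAt w k (i , s) → does (P? (suc k)) ≡ does (s Sign.≟ Sign.-)) →
      length (filter P? [1‥ length w ]) ≡ negʷ w
    negʷ-filter []            h = refl
    negʷ-filter ((i , s) ∷ w) h = trans (length-filter-last (length w)) (trans (cong₂ ℕ._+_
      (cong (λ d → if d then 1 else 0) (h here)) (negʷ-filter w (h ∘ there))) (add s))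
      where
      add : ∀ s → (if does (s Sign.≟ Sign.-) then 1 else 0) ℕ.+ negʷ w ≡ negʷ ((i , s) ∷ w)
      add Sign.+ = refl
      add Sign.- = refl

  module _ {n : ℕ} {λs : List ℕ} {T : SignedFilling n λs} {w} (std : IsStandard T)
    (iw : IsWord n (lookup λs) w) (e : Encodes T w) where

    open Cell

    private
      letterAt-cell : ∀ x → LetterAt w (toℕ (label T x)) (rowIx x , sign T x)
      letterAt-cell x = subst (λ (k , s) → LetterAt w k (rowIx x , s)) (sym (e x))
                              (content-letter iw (Fin.toℕ<n (colIx x)))

      cellOf : ∀ {k i s} → LetterAt w k (i , s) → ∃ λ x → entry T x ≡ suc k × rowIx x ≡ i × sign T x ≡ s
      cellOf l with x , refl ← cellAt std (subst (_ <_) (isWord-length iw) (letterAt-bound l))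
               with refl ← letterAt-functional l (letterAt-cell x) = x , refl , refl , refl

      letterOf : ∀ {k i s} → LetterAt w k (i , s) → ∀ x → entry T x ≡ suc k → rowIx x ≡ i × sign T x ≡ s
      letterOf l x refl with refl ← letterAt-functional l (letterAt-cell x) = refl , refl

      neg⁺ : ∀ {k i} → LetterAt w k (i , Sign.-) → Neg T (suc k)
      neg⁺ l = let x , x≡ , _ , s≡ = cellOf l in x , x≡ , s≡

      neg⁻ : ∀ {k i} → LetterAt w k (i , Sign.+) → ¬ Neg T (suc k)
      neg⁻ l (x , x≡ , s≡) with () ← trans (sym s≡) (proj₂ (letterOf l x x≡))

      lower⁺ : ∀ {k i s j s′} → LetterAt w k (i , s) → LetterAt w (suc k) (j , s′) →
               toℕ i < toℕ j → Lower T (suc k) (suc (suc k))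
      lower⁺ l m i<j with x , x≡ , refl , _ ← cellOf l | y , y≡ , refl , _ ← cellOf m = x , y , x≡ , y≡ , s≤s i<j

      lower⁻ : ∀ {k i s j s′} → LetterAt w k (i , s) → LetterAt w (suc k) (j , s′) →
               Lower T (suc k) (suc (suc k)) → toℕ i < toℕ j
      lower⁻ l m (x , y , x≡ , y≡ , s≤s r<) with refl , _ ← letterOf l x x≡ | refl , _ ← letterOf m y y≡ = r<

      does-descent : ∀ {k a b} → LetterAt w k a → LetterAt w (suc k) b →
                     does (descent? T (suc k)) ≡ isDescent a b
      does-descent {k} {i , s} {j , s′} l m = go s s′ l m (toℕ i ℕ.<? toℕ j)
        where
        go : ∀ s s′ → LetterAt w k (i , s) → LetterAt w (suc k) (j , s′) → Dec (toℕ i < toℕ j) →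
             does (descent? T (suc k)) ≡ isDescent (i , s) (j , s′)
        go s Sign.+ l m (yes i<j) rewrite dec-true (toℕ i ℕ.<? toℕ j) i<j =
          dec-true (descent? T (suc k)) (inj₁ (neg⁻ m , lower⁺ l m i<j))
        go s Sign.- l m (yes i<j) rewrite dec-true (toℕ i ℕ.<? toℕ j) i<j =
          dec-false (descent? T (suc k)) λ where
            (inj₁ (¬neg , _))   → ¬neg (neg⁺ m)
            (inj₂ (_ , ¬lower)) → ¬lower (lower⁺ l m i<j)
        go Sign.+ s′ l m (no i≮j) rewrite dec-false (toℕ i ℕ.<? toℕ j) i≮j =
          dec-false (descent? T (suc k)) λ where
            (inj₁ (_ , lower)) → i≮j (lower⁻ l m lower)
            (inj₂ (neg , _))   → neg⁻ l neg
        go Sign.- s′ l m (no i≮j) rewrite dec-false (toℕ i ℕ.<? toℕ j) i≮j =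
          dec-true (descent? T (suc k)) (inj₂ (neg⁺ l , i≮j ∘ lower⁻ l m))

      does-neg : ∀ {k i s} → LetterAt w k (i , s) → does (neg? T (suc k)) ≡ does (s Sign.≟ Sign.-)
      does-neg {s = Sign.+} l = dec-false (neg? T _) (neg⁻ l)
      does-neg {s = Sign.-} l = dec-true (neg? T _) (neg⁺ l)

    maj≡majʷ : maj T ≡ majʷ w
    maj≡majʷ = trans (cong (λ m → sum (filter (descent? T) [1‥ m ∸ 1 ])) (sym (isWord-length iw)))
                     (majʷ-filter (descent? T) w does-descent)

    neg≡negʷ : neg T ≡ negʷ w
    neg≡negʷ = trans (cong (λ m → length (filter (neg? T) [1‥ m ])) (sym (isWord-length iw)))
                     (negʷ-filter (neg? T) w does-neg)

open WordTableaux

-- Hooks and cells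

private variable A B : Set

-- Hooks in different shapes are filters by different predicates; counting their Boolean decisions
-- makes them comparable pointwise.
count : (A → Bool) → List A → ℕ
count b []       = 0
count b (x ∷ xs) = (if b x then 1 else 0) ℕ.+ count b xs

count-filter : ∀ {P : A → Set} (P? : Decidable P) xs → length (filter P? xs) ≡ count (does ∘ P?) xs
count-filter P? []       = ≡.refl
count-filter P? (x ∷ xs) with does (P? x)
... | true  = ≡.cong suc (count-filter P? xs)
... | false = count-filter P? xs

count-cong : ∀ {b b′ : A → Bool} → (∀ x → b x ≡ b′ x) → ∀ xs → count b xs ≡ count b′ xs
count-cong b≡b′ []       = ≡.refl
count-cong b≡b′ (x ∷ xs) = ≡.cong₂ (λ d n → (if d then 1 else 0) ℕ.+ n) (b≡b′ x) (count-cong b≡b′ xs)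

count-++ : ∀ (b : A → Bool) xs ys → count b (xs ++ ys) ≡ count b xs ℕ.+ count b ys
count-++ b []       ys = ≡.refl
count-++ b (x ∷ xs) ys = ≡.trans (≡.cong ((if b x then 1 else 0) ℕ.+_) (count-++ b xs ys)) (≡.sym (ℕ.+-assoc (if b x then 1 else 0) _ _))

count-map : ∀ (b : B → Bool) (f : A → B) xs → count b (map f xs) ≡ count (b ∘ f) xs
count-map b f []       = ≡.refl
count-map b f (x ∷ xs) = ≡.cong ((if b (f x) then 1 else 0) ℕ.+_) (count-map b f xs)

count-false : ∀ (xs : List A) → count (λ _ → false) xs ≡ 0
count-false []       = ≡.refl
count-false (_ ∷ xs) = count-false xs

count-allFin : ∀ k (b : Fin (suc k) → Bool) →
               count b (allFin (suc k)) ≡ (if b fzero then 1 else 0) ℕ.+ count (b ∘ fsuc) (allFin k)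
count-allFin k b = ≡.cong ((if b fzero then 1 else 0) ℕ.+_)
  (≡.trans (≡.cong (count b) (≡.sym (map-tabulate {n = k} (λ i → i) fsuc))) (count-map b fsuc (allFin k)))

count-true : ∀ k → count (λ (_ : Fin k) → true) (allFin k) ≡ k
count-true zero    = ≡.refl
count-true (suc k) = ≡.trans (count-allFin k (λ _ → true)) (≡.cong suc (count-true k))

-- The arm of a cell together with the cell itself. `c <ᵇ suc c′` is the form to which the decision
-- of `col x ≤ col y` reduces.
count-≥ : ∀ k c → count (λ (c′ : Fin k) → c <ᵇ suc (toℕ c′)) (allFin k) ≡ k ∸ c
count-≥ k       zero    = count-true k
count-≥ zero    (suc c) = ≡.refl
count-≥ (suc k) (suc c) = ≡.trans (count-allFin k (λ c′ → suc c <ᵇ suc (toℕ c′))) (count-≥ k c)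

count-≡ : ∀ k c → count (λ (c′ : Fin k) → toℕ c′ ≡ᵇ c) (allFin k) ≡ (if c <ᵇ k then 1 else 0)
count-≡ zero    c       = ≡.refl
count-≡ (suc k) zero    = ≡.trans (count-allFin k (λ c′ → toℕ c′ ≡ᵇ 0)) (≡.cong suc (count-false (allFin k)))
count-≡ (suc k) (suc c) = ≡.trans (count-allFin k (λ c′ → toℕ c′ ≡ᵇ suc c)) (count-≡ k c)

down : ∀ {k λs} → Cell λs → Cell (k ∷ λs)
down ⟨ r , c ⟩ = ⟨ fsuc r , c ⟩

cells-∷ : ∀ k λs → cells (k ∷ λs) ≡ map ⟨ fzero ,_⟩ (allFin k) ++ map down (cells λs)
cells-∷ k λs = ≡.cong (map ⟨ fzero ,_⟩ (allFin k) ++_) (≡.trans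
  (≡.cong (concatMap rowCells) (≡.sym (map-tabulate {n = length λs} (λ i → i) fsuc)))
  (≡.trans (concatMap-map rowCells fsuc (allFin (length λs)))
    (≡.trans (concatMap-cong (λ r → map-∘ (allFin (lookup λs r))) (allFin (length λs)))
      (≡.sym (map-concatMap down (λ r → map ⟨ r ,_⟩ (allFin (lookup λs r))) (allFin (length λs)))))))
  where
  rowCells : Fin (suc (length λs)) → List (Cell (k ∷ λs))
  rowCells r = map ⟨ r ,_⟩ (allFin (lookup (k ∷ λs) r))

count-cells : ∀ k λs (b : Cell (k ∷ λs) → Bool) →
  count b (cells (k ∷ λs)) ≡ count (λ c → b ⟨ fzero , c ⟩) (allFin k) ℕ.+ count (b ∘ down) (cells λs)
count-cells k λs b = ≡.trans (≡.cong (count b) (cells-∷ k λs)) (≡.trans (count-++ b (map ⟨ fzero ,_⟩ (allFin k)) _)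
  (≡.cong₂ ℕ._+_ (count-map b ⟨ fzero ,_⟩ (allFin k)) (count-map b down (cells λs))))

hook-down : ∀ {k λs} (x : Cell λs) → hook (down {k} x) ≡ hook x
hook-down {k} {λs} x = begin
  hook (down {k} x)                                       ≡⟨ count-filter (inHook? (down {k} x)) (cells (k ∷ λs)) ⟩
  count (does ∘ inHook? (down {k} x)) (cells (k ∷ λs))    ≡⟨ count-cells k λs _ ⟩
  _ ℕ.+ count (does ∘ inHook? x) (cells λs)
    ≡⟨ ≡.cong (ℕ._+ count (does ∘ inHook? x) (cells λs)) (≡.trans (count-cong none (allFin k)) (count-false (allFin k))) ⟩
  count (does ∘ inHook? x) (cells λs)                     ≡⟨ count-filter (inHook? x) (cells λs) ⟨
  hook x ∎
  where
  open ≡.≡-Reasoning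
  none : ∀ c → does (inHook? (down {k} x) ⟨ fzero , c ⟩) ≡ false
  none c with toℕ c ≡ᵇ toℕ (Cell.colIx x)
  ... | true  = ≡.refl
  ... | false = ≡.refl

count-column : ∀ c λs → count (λ y → toℕ (Cell.colIx y) ≡ᵇ c) (cells λs) ≡ rowsLonger c λs
count-column c []       = ≡.refl
count-column c (k ∷ λs) = ≡.trans (count-cells k λs _) (≡.cong₂ ℕ._+_ (count-≡ k c) (count-column c λs))

hook-firstRow : ∀ {k λs} (c : Fin k) → hook {k ∷ λs} ⟨ fzero , c ⟩ ≡ (k ∸ toℕ c) ℕ.+ rowsLonger (toℕ c) λs
hook-firstRow {k} {λs} c = begin
  hook {k ∷ λs} ⟨ fzero , c ⟩                            ≡⟨ count-filter (inHook? x) (cells (k ∷ λs)) ⟩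
  count (does ∘ inHook? x) (cells (k ∷ λs))              ≡⟨ count-cells k λs _ ⟩
  count (λ c′ → does (inHook? x ⟨ fzero , c′ ⟩)) (allFin k) ℕ.+ count (does ∘ inHook? x ∘ down) (cells λs)
    ≡⟨ ≡.cong₂ ℕ._+_
         (≡.trans (count-cong (λ c′ → arm (toℕ c) (toℕ c′)) (allFin k)) (count-≥ k (toℕ c)))
         (≡.trans (count-cong (λ y → ∧-identityʳ _) (cells λs)) (count-column (toℕ c) λs)) ⟩
  (k ∸ toℕ c) ℕ.+ rowsLonger (toℕ c) λs ∎
  where
  open ≡.≡-Reasoning
  x : Cell (k ∷ λs)
  x = ⟨ fzero , c ⟩

  -- In its own row, x is the only cell that meets the column condition, and the row condition
  -- already counts it.
  arm : ∀ c c′ → (c <ᵇ suc c′) Bool.∨ ((c′ ≡ᵇ c) Bool.∧ true) ≡ (c <ᵇ suc c′)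
  arm zero    c′       = ≡.refl
  arm (suc c) zero     = ≡.refl
  arm (suc c) (suc c′) = arm c c′

lookup-isPartition : ∀ {λs} → Linked _≥_ λs → IsPartition (lookup λs)
lookup-isPartition = go ∘ Linked⇒AllPairs (λ y≤x z≤y → ℕ.≤-trans z≤y y≤x)
  where
  go : ∀ {λs} → AllPairs _≥_ λs → IsPartition (lookup λs)
  go (≥s ∷ _)  fzero    (fsuc j) _         = All.lookup ≥s (∈-lookup j)
  go (_ ∷ dec) (fsuc i) (fsuc j) (s≤s i<j) = go dec i j i<j

module CellProducts {a ℓ} (R : CommutativeRing a ℓ) (q : CommutativeRing.Carrier R) where
  open CommutativeRing R
  open QAnalogues R
  open QNumbers R q
  open Sums R
  open SetoidReasoning setoid
  open Solver commutativeSemiring using (solve; _:*_; _:=_)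

  ∏-cells : ∀ k λs (f : Cell (k ∷ λs) → Carrier) →
            ∏ (cells (k ∷ λs)) f ≈ ∏[ c ∈ allFin k ] f ⟨ fzero , c ⟩ * ∏[ x ∈ cells λs ] f (down x)
  ∏-cells k λs f = begin
    ∏ (cells (k ∷ λs)) f ≡⟨ ≡.cong (λ xs → ∏ xs f) (cells-∷ k λs) ⟩
    ∏ (map ⟨ fzero ,_⟩ (allFin k) ++ map down (cells λs)) f ≈⟨ ∏-++ (map ⟨ fzero ,_⟩ (allFin k)) (map down (cells λs)) f ⟩
    ∏ (map ⟨ fzero ,_⟩ (allFin k)) f * ∏ (map down (cells λs)) f
      ≈⟨ *-cong (∏-map ⟨ fzero ,_⟩ (allFin k) f) (∏-map down (cells λs) f) ⟩
    _ ∎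

  ∏-toℕ : ∀ k (f : ℕ → Carrier) → ∏[ c ∈ allFin k ] f (toℕ c) ≈ ∏↑ k f
  ∏-toℕ zero    f = refl
  ∏-toℕ (suc k) f = trans (∏-allFin k (λ c → f (toℕ c))) (*-congˡ (∏-toℕ k (λ c → f (suc c))))

  ∏-hooks : ∀ λs → ∏[ x ∈ cells λs ] ([ hook x ] q) ≈ hookProduct λs
  ∏-hooks []       = refl
  ∏-hooks (k ∷ λs) = begin
    ∏[ x ∈ cells (k ∷ λs) ] ([ hook x ] q) ≈⟨ ∏-cells k λs _ ⟩
    ∏[ c ∈ allFin k ] ([ hook {k ∷ λs} ⟨ fzero , c ⟩ ] q) * ∏[ x ∈ cells λs ] ([ hook (down {k} x) ] q)
      ≈⟨ *-cong (∏-cong (allFin k) λ c → reflexive (≡.cong (λ i → [ i ] q) (hook-firstRow {λs = λs} c)))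
                (∏-cong (cells λs) λ x → reflexive (≡.cong (λ i → [ i ] q) (hook-down {k} x))) ⟩
    ∏[ c ∈ allFin k ] ([ (k ∸ toℕ c) ℕ.+ rowsLonger (toℕ c) λs ] q) * ∏[ x ∈ cells λs ] ([ hook x ] q)
      ≈⟨ *-cong (∏-toℕ k (λ c → [ (k ∸ c) ℕ.+ rowsLonger c λs ] q)) (∏-hooks λs) ⟩
    hookProduct (k ∷ λs) ∎

  ∏-contents : ∀ x y λs → ∏[ z ∈ cells λs ] (x * q ^ (row z ∸ 1) + y * q ^ (col z ∸ 1)) ≈ contentProduct x y λs
  ∏-contents x y []       = refl
  ∏-contents x y (k ∷ λs) = begin
    ∏[ z ∈ cells (k ∷ λs) ] (x * q ^ (row z ∸ 1) + y * q ^ (col z ∸ 1)) ≈⟨ ∏-cells k λs _ ⟩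
    ∏[ c ∈ allFin k ] (x * 1# + y * q ^ toℕ c) * ∏[ z ∈ cells λs ] (x * (q * q ^ (row z ∸ 1)) + y * q ^ (col z ∸ 1))
      ≈⟨ *-cong (∏-cong (allFin k) λ c → +-congʳ (*-identityʳ x))
                (∏-cong (cells λs) λ z → +-congʳ (solve 3 (λ x q Q → x :* (q :* Q) := q :* x :* Q) refl x q _)) ⟩
    ∏[ c ∈ allFin k ] (x + y * q ^ toℕ c) * ∏[ z ∈ cells λs ] (q * x * q ^ (row z ∸ 1) + y * q ^ (col z ∸ 1))
      ≈⟨ *-cong (∏-toℕ k (λ c → x + y * q ^ c)) (∏-contents (q * x) y λs) ⟩
    contentProduct x y (k ∷ λs) ∎

module Bijection {a ℓ} (R : CommutativeRing a ℓ) where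
  open CommutativeRing R
  open QAnalogues R
  open SetoidReasoning setoid
  open Solver commutativeSemiring using (solve; _:+_; _:=_)

  private
    remove : ∀ {y : B} {ys} → y ∈ ys → Unique ys → ∃ λ ys′ → Unique ys′ × (∀ g → ∑ ys g ≈ g y + ∑ ys′ g) ×
             (∀ {z} → z ∈ ys′ → z ∈ ys × z ≢ y) × (∀ {z} → z ∈ ys → z ≢ y → z ∈ ys′)
    remove {ys = y ∷ ys} (here ≡.refl) (y∉ ∷ ys!) = ys , ys! , (λ g → refl) ,
      (λ z∈ → there z∈ , λ { ≡.refl → All.lookup y∉ z∈ ≡.refl }) ,
      λ { (here z≡y) z≢y → contradiction z≡y z≢y ; (there z∈) _ → z∈ }
    remove {ys = x ∷ ys} (there y∈) (x∉ ∷ ys!) with ys′ , ys′! , sum≈ , ⊆ys , ⊇ys ← remove y∈ ys! =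
      x ∷ ys′ , All.tabulate (λ z∈ → All.lookup x∉ (proj₁ (⊆ys z∈))) ∷ ys′! ,
      (λ g → trans (+-congˡ (sum≈ g)) (solve 3 (λ a b c → a :+ (b :+ c) := b :+ (a :+ c)) refl _ _ _)) ,
      (λ { (here ≡.refl) → here ≡.refl , (λ { ≡.refl → All.lookup x∉ y∈ ≡.refl })
         ; (there z∈)  → let z∈ys , z≢y = ⊆ys z∈ in there z∈ys , z≢y }) ,
      λ { (here z≡x) _ → here z≡x ; (there z∈) z≢y → there (⊇ys z∈ z≢y) }

  -- A relation replaces a pair of inverse maps, because `encode` and `decode` deliver each value
  -- together with a proof that it is related to the argument. Induction removes the head of one
  -- list and its partner from the other.
  ∑-bijection : ∀ (_∼_ : A → B → Set) {f g} →
    (∀ {x x′ y} → x ∼ y → x′ ∼ y → x ≡ x′) →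
    {xs : List A} {ys : List B} → Unique xs → Unique ys →
    (∀ {x y y′} → x ∈ xs → y ∈ ys → y′ ∈ ys → x ∼ y → x ∼ y′ → y ≡ y′) →
    (∀ {x} → x ∈ xs → ∃ λ y → y ∈ ys × x ∼ y) → (∀ {y} → y ∈ ys → ∃ λ x → x ∈ xs × x ∼ y) →
    (∀ {x y} → x ∈ xs → y ∈ ys → x ∼ y → f x ≈ g y) →
    ∑ xs f ≈ ∑ ys g
  ∑-bijection _∼_ injective {[]} {[]}     _ _ _ _ _ _ = refl
  ∑-bijection _∼_ injective {[]} {y ∷ ys} _ _ _ _ surjective _ with () ← proj₁ (proj₂ (surjective (here ≡.refl)))
  ∑-bijection _∼_ {f} {g} injective {x ∷ xs} {ys} (x∉ ∷ xs!) ys! functional total surjective f≈g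
    with y , y∈ , x∼y ← total (here ≡.refl)
    with ys′ , ys′! , sum≈ , ⊆ys , ⊇ys ← remove y∈ ys!
    = begin
    f x + ∑ xs f  ≈⟨ +-cong (f≈g (here ≡.refl) y∈ x∼y) (∑-bijection _∼_ injective xs! ys′!
                       (λ z∈ u∈ v∈ → functional (there z∈) (proj₁ (⊆ys u∈)) (proj₁ (⊆ys v∈)))
                       total′ surjective′
                       (λ z∈ u∈ → f≈g (there z∈) (proj₁ (⊆ys u∈)))) ⟩
    g y + ∑ ys′ g ≈⟨ sum≈ g ⟨
    ∑ ys g ∎
    where
    total′ : ∀ {z} → z ∈ xs → ∃ λ u → u ∈ ys′ × z ∼ u
    total′ z∈ with u , u∈ , z∼u ← total (there z∈) =
      u , ⊇ys u∈ (λ { ≡.refl → All.lookup x∉ z∈ (injective x∼y z∼u) }) , z∼u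

    surjective′ : ∀ {u} → u ∈ ys′ → ∃ λ z → z ∈ xs × z ∼ u
    surjective′ u∈ with z , z∈ , z∼u ← surjective (proj₁ (⊆ys u∈)) | z∈
    ... | there z∈ = z , z∈ , z∼u
    ... | here ≡.refl = contradiction (functional (here ≡.refl) (proj₁ (⊆ys u∈)) y∈ z∼u x∼y) (proj₂ (⊆ys u∈))

module InvertibleQNumbers {a ℓ₀} (R : CommutativeRing a ℓ₀) (q t : CommutativeRing.Carrier R)
  (inv : ℕ → CommutativeRing.Carrier R) ([suc]*inv≈1 : QNumbers.InvertsPositive R q inv)
  (p-cancel : QNumbers.PCancellative R q) where

  open CommutativeRing R
  open QAnalogues R
  open QNumbers R q
  open WordSum R q t inv [suc]*inv≈1 p-cancel using (wt; ∑-wt-words*hooks)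
  open CellProducts R q
  open Bijection R
  open Sums R
  open SetoidReasoning setoid

  module _ {n} (Λ : Partition n) where

    private
      λs = parts Λ
      μ₀ = lookup λs
      part = lookup-isPartition (decreasing Λ)

      size≡ : size μ₀ ≡ n
      size≡ = ≡.trans (≡.cong sum (tabulate-lookup λs)) (sum≡n Λ)

      standard⇔ : ∀ {T} → T ∈ SYT± Λ → IsStandard T
      standard⇔ = Equivalence.to (∈-SYT± Λ)

    ∑-SYT± : ∑[ T ∈ SYT± Λ ] (q ^ maj T * t ^ neg T) ≈ ∑ (words n μ₀) wt
    ∑-SYT± = ∑-bijection Encodes (λ {T} {T′} {w} e e′ → encodes-unique {w = w} e e′) (SYT±! Λ) (words! n μ₀)
      (λ {T} _ w∈ w′∈ → encodes-functional {T = T} (∈-words⁻ n size≡ w∈) (∈-words⁻ n size≡ w′∈))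
      (λ T∈ → let w , iw , e = encode (standard⇔ T∈) in w , ∈-words⁺ iw , e)
      (λ w∈ → let T , std , e = decode part (∈-words⁻ n size≡ w∈) in T , Equivalence.from (∈-SYT± Λ) std , e)
      λ T∈ w∈ e → reflexive (≡.cong₂ (λ i j → q ^ i * t ^ j)
        (maj≡majʷ (standard⇔ T∈) (∈-words⁻ n size≡ w∈) e)
        (neg≡negʷ (standard⇔ T∈) (∈-words⁻ n size≡ w∈) e))

    ∑-SYT±*hooks : ∑[ T ∈ SYT± Λ ] (q ^ maj T * t ^ neg T) * ∏[ x ∈ cells λs ] ([ hook x ] q)
      ≈ [ n ]! q * ∏[ x ∈ cells λs ] (q ^ (row x ∸ 1) + t * q ^ (col x ∸ 1))
    ∑-SYT±*hooks = begin
      ∑[ T ∈ SYT± Λ ] (q ^ maj T * t ^ neg T) * ∏[ x ∈ cells λs ] ([ hook x ] q)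
        ≈⟨ *-cong ∑-SYT± (∏-hooks λs) ⟩
      ∑ (words n μ₀) wt * hookProduct λs
        ≡⟨ ≡.cong₂ (λ n xs → ∑ (words n μ₀) wt * hookProduct xs) size≡ (tabulate-lookup λs) ⟨
      ∑ (words (size μ₀) μ₀) wt * hookProduct (tabulate μ₀)
        ≈⟨ ∑-wt-words*hooks μ₀ part ⟩
      [ size μ₀ ]! q * contentProduct 1# t (tabulate μ₀)
        ≡⟨ ≡.cong₂ (λ n xs → [ n ]! q * contentProduct 1# t xs) size≡ (tabulate-lookup λs) ⟩
      [ n ]! q * contentProduct 1# t λs
        ≈⟨ *-congˡ (∏-contents 1# t λs) ⟨
      [ n ]! q * ∏[ x ∈ cells λs ] (1# * q ^ (row x ∸ 1) + t * q ^ (col x ∸ 1))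
        ≈⟨ *-congˡ (∏-cong (cells λs) λ x → +-congʳ (*-identityˡ _)) ⟩
      [ n ]! q * ∏[ x ∈ cells λs ] (q ^ (row x ∸ 1) + t * q ^ (col x ∸ 1)) ∎

-- Power series and evaluation of polynomials

module PowerSeries {a ℓ} (R : CommutativeRing a ℓ) where
  open CommutativeRing R
  open SetoidReasoning setoid
  open Solver commutativeSemiring using (solve; _:+_; _:*_; _:=_)

  Series : Set a
  Series = ℕ → Carrier

  infix 4 _≋_
  infixl 7 _⊗_ _·_
  infixl 6 _⊕_

  _≋_ : Series → Series → Set ℓ
  f ≋ g = ∀ n → f n ≈ g n

  constant : Carrier → Series
  constant c zero    = c
  constant c (suc n) = 0#

  tail shift : Series → Series
  tail f n = f (suc n)
  shift f zero    = 0#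
  shift f (suc n) = f n

  0ˢ 1ˢ z : Series
  0ˢ n = 0#
  1ˢ   = constant 1#
  z    = shift 1ˢ

  _⊕_ _⊗_ : Series → Series → Series
  (f ⊕ g) n       = f n + g n
  (f ⊗ g) zero    = f 0 * g 0
  (f ⊗ g) (suc n) = f 0 * g (suc n) + (tail f ⊗ g) n

  _·_ : Carrier → Series → Series
  (c · f) n = c * f n

  ⊖_ : Series → Series
  (⊖ f) n = - f n

  ⊗-cong : ∀ {f f′ g g′} → f ≋ f′ → g ≋ g′ → f ⊗ g ≋ f′ ⊗ g′
  ⊗-cong f≋ g≋ zero    = *-cong (f≋ 0) (g≋ 0)
  ⊗-cong f≋ g≋ (suc n) = +-cong (*-cong (f≋ 0) (g≋ (suc n))) (⊗-cong (λ n → f≋ (suc n)) g≋ n)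

  ⊗-zeroˡ : ∀ {f} g → f ≋ 0ˢ → f ⊗ g ≋ 0ˢ
  ⊗-zeroˡ g f≋0 zero    = trans (*-congʳ (f≋0 0)) (zeroˡ _)
  ⊗-zeroˡ g f≋0 (suc n) = trans
    (+-cong (trans (*-congʳ (f≋0 0)) (zeroˡ _)) (⊗-zeroˡ g (λ n → f≋0 (suc n)) n)) (+-identityʳ 0#)

  ⊗-distribʳ-⊕ : ∀ h f g → (f ⊕ g) ⊗ h ≋ f ⊗ h ⊕ g ⊗ h
  ⊗-distribʳ-⊕ h f g zero    = distribʳ _ _ _
  ⊗-distribʳ-⊕ h f g (suc n) = trans (+-congˡ (⊗-distribʳ-⊕ h (tail f) (tail g) n))
    (solve 5 (λ f g h u v → (f :+ g) :* h :+ (u :+ v) := f :* h :+ u :+ (g :* h :+ v)) refl (f 0) (g 0) _ _ _)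

  ·-⊗ : ∀ c f g → (c · f) ⊗ g ≋ c · (f ⊗ g)
  ·-⊗ c f g zero    = *-assoc _ _ _
  ·-⊗ c f g (suc n) = trans (+-cong (*-assoc _ _ _) (·-⊗ c (tail f) g n)) (sym (distribˡ c _ _))

  -- The recursion of the product from its other end; compared with the defining recursion it yields
  -- commutativity.
  ⊗-last : ∀ f g n → (f ⊗ g) (suc n) ≈ (f ⊗ tail g) n + f (suc n) * g 0
  ⊗-last f g zero    = refl
  ⊗-last f g (suc n) = trans (+-congˡ (⊗-last (tail f) g n)) (sym (+-assoc _ _ _))

  ⊗-comm : ∀ f g → f ⊗ g ≋ g ⊗ f
  ⊗-comm f g zero    = *-comm _ _
  ⊗-comm f g (suc n) = begin
    f 0 * g (suc n) + (tail f ⊗ g) n ≈⟨ +-comm _ _ ⟩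
    (tail f ⊗ g) n + f 0 * g (suc n) ≈⟨ +-cong (⊗-comm (tail f) g n) (*-comm _ _) ⟩
    (g ⊗ tail f) n + g (suc n) * f 0 ≈⟨ ⊗-last g f n ⟨
    (g ⊗ f) (suc n) ∎

  ⊗-assoc : ∀ f g h → (f ⊗ g) ⊗ h ≋ f ⊗ (g ⊗ h)
  ⊗-assoc f g h zero    = *-assoc _ _ _
  ⊗-assoc f g h (suc n) = begin
    f 0 * g 0 * h (suc n) + ((f 0 · tail g ⊕ tail f ⊗ g) ⊗ h) n
      ≈⟨ +-congˡ (⊗-distribʳ-⊕ h (f 0 · tail g) (tail f ⊗ g) n) ⟩
    f 0 * g 0 * h (suc n) + (((f 0 · tail g) ⊗ h) n + ((tail f ⊗ g) ⊗ h) n)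
      ≈⟨ +-congˡ (+-cong (·-⊗ (f 0) (tail g) h n) (⊗-assoc (tail f) g h n)) ⟩
    f 0 * g 0 * h (suc n) + (f 0 * (tail g ⊗ h) n + (tail f ⊗ (g ⊗ h)) n)
      ≈⟨ solve 5 (λ f g h u v → f :* g :* h :+ (f :* u :+ v) := f :* (g :* h :+ u) :+ v) refl (f 0) (g 0) _ _ _ ⟩
    f 0 * (g 0 * h (suc n) + (tail g ⊗ h) n) + (tail f ⊗ (g ⊗ h)) n ∎

  ⊗-identityˡ : ∀ f → 1ˢ ⊗ f ≋ f
  ⊗-identityˡ f zero    = *-identityˡ _
  ⊗-identityˡ f (suc n) = trans (+-cong (*-identityˡ _) (⊗-zeroˡ f (λ _ → refl) n)) (+-identityʳ _)

  seriesRing : CommutativeRing a ℓ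
  seriesRing = record
    { Carrier = Series ; _≈_ = _≋_ ; _+_ = _⊕_ ; _*_ = _⊗_ ; -_ = ⊖_ ; 0# = 0ˢ ; 1# = 1ˢ
    ; isCommutativeRing = record
      { isRing = record
        { +-isAbelianGroup = record
          { isGroup = record
            { isMonoid = record
              { isSemigroup = record
                { isMagma = record
                  { isEquivalence = record
                    { refl = λ n → refl ; sym = λ f≋g n → sym (f≋g n) ; trans = λ f≋g g≋h n → trans (f≋g n) (g≋h n) }
                  ; ∙-cong = λ f≋ g≋ n → +-cong (f≋ n) (g≋ n) }
                ; assoc = λ f g h n → +-assoc _ _ _ }
              ; identity = (λ f n → +-identityˡ _) , (λ f n → +-identityʳ _) }
            ; inverse = (λ f n → -‿inverseˡ _) , (λ f n → -‿inverseʳ _)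
            ; ⁻¹-cong = λ f≋g n → -‿cong (f≋g n) }
          ; comm = λ f g n → +-comm _ _ }
        ; *-cong = ⊗-cong
        ; *-assoc = ⊗-assoc
        ; *-identity = ⊗-identityˡ , λ f n → trans (⊗-comm f 1ˢ n) (⊗-identityˡ f n)
        ; distrib = (λ h f g n → begin
            (h ⊗ (f ⊕ g)) n           ≈⟨ ⊗-comm h (f ⊕ g) n ⟩
            ((f ⊕ g) ⊗ h) n           ≈⟨ ⊗-distribʳ-⊕ h f g n ⟩
            (f ⊗ h) n + (g ⊗ h) n     ≈⟨ +-cong (⊗-comm f h n) (⊗-comm g h n) ⟩
            (h ⊗ f) n + (h ⊗ g) n ∎) , ⊗-distribʳ-⊕ }
      ; *-comm = ⊗-comm } }

  shift-⊗ : ∀ f → z ⊗ f ≋ shift f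
  shift-⊗ f zero    = zeroˡ _
  shift-⊗ f (suc n) = trans (+-cong (zeroˡ _) (⊗-identityˡ f n)) (+-identityˡ _)

  -- The inverse of 1 - zf is the limit of the partial sums of the geometric series.
  partialSum : Series → ℕ → Series
  partialSum f zero    = 1ˢ
  partialSum f (suc k) = 1ˢ ⊕ shift (f ⊗ partialSum f k)

  geometric : Series → Series
  geometric f n = partialSum f n n

  private
    ⊗-local : ∀ f {g h} m → (∀ n → n ≤ m → g n ≈ h n) → ∀ n → n ≤ m → (f ⊗ g) n ≈ (f ⊗ h) n
    ⊗-local f m g≈h zero    n≤m = *-congˡ (g≈h 0 n≤m)
    ⊗-local f m g≈h (suc n) n≤m = +-cong (*-congˡ (g≈h (suc n) n≤m)) (⊗-local (tail f) m g≈h n (ℕ.<⇒≤ n≤m))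

    step-local : ∀ f {g h} m → (∀ n → n ≤ m → g n ≈ h n) →
                 ∀ n → n ≤ suc m → (1ˢ ⊕ shift (f ⊗ g)) n ≈ (1ˢ ⊕ shift (f ⊗ h)) n
    step-local f m g≈h zero    _         = refl
    step-local f m g≈h (suc n) (s≤s n≤m) = +-congˡ (⊗-local f m g≈h n n≤m)

    -- Each iteration passes through a shift, so an error in degrees above k moves to degrees above
    -- k + 1. Hence the diagonal in `geometric` is the limit.
    stable : ∀ f k n → n ≤ k → partialSum f k n ≈ partialSum f (suc k) n
    stable f zero    zero _   = sym (+-identityʳ 1#)
    stable f (suc k)          = step-local f k (stable f k)

    geometric-partialSum : ∀ f k n → n ≤ k → geometric f n ≈ partialSum f k n
    geometric-partialSum f k n n≤k = go k (ℕ.≤⇒≤′ n≤k)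
      where
      go : ∀ k → n ℕ.≤′ k → geometric f n ≈ partialSum f k n
      go k       (ℕ.≤′-reflexive ≡.refl) = refl
      go (suc k) (ℕ.≤′-step n≤′k)        = trans (go k n≤′k) (stable f k n (ℕ.≤′⇒≤ n≤′k))

  geometric-unfold : ∀ f → geometric f ≋ 1ˢ ⊕ shift (f ⊗ geometric f)
  geometric-unfold f n = begin
    geometric f n                             ≈⟨ geometric-partialSum f (suc n) n (ℕ.n≤1+n n) ⟩
    (1ˢ ⊕ shift (f ⊗ partialSum f n)) n       ≈⟨ step-local f n (geometric-partialSum f n) n (ℕ.n≤1+n n) ⟨
    (1ˢ ⊕ shift (f ⊗ geometric f)) n ∎

module _ {a ℓ} (R : CommutativeRing a ℓ) where
  open PowerSeries R
  private module S = CommutativeRing seriesRing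
  open QAnalogues seriesRing
  open QNumbers seriesRing z
  open RingProperties S.ring using (-‿distribˡ-*; -‿distribʳ-*; -‿involutive)
  open SetoidReasoning S.setoid

  [1-zf]*geometric : ∀ f → (1ˢ ⊕ ⊖ (z ⊗ f)) ⊗ geometric f ≋ 1ˢ
  [1-zf]*geometric f = begin
    (1ˢ ⊕ ⊖ (z ⊗ f)) ⊗ G             ≈⟨ S.distribʳ G 1ˢ (⊖ (z ⊗ f)) ⟩
    1ˢ ⊗ G ⊕ ⊖ (z ⊗ f) ⊗ G           ≈⟨ S.+-cong (S.*-identityˡ G) (S.sym (-‿distribˡ-* (z ⊗ f) G)) ⟩
    G ⊕ ⊖ (z ⊗ f ⊗ G)                ≈⟨ S.+-cong (geometric-unfold f) (S.-‿cong (S.trans (S.*-assoc z f G) (shift-⊗ (f ⊗ G)))) ⟩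
    1ˢ ⊕ shift (f ⊗ G) ⊕ ⊖ shift (f ⊗ G) ≈⟨ S.+-assoc 1ˢ _ _ ⟩
    1ˢ ⊕ (shift (f ⊗ G) ⊕ ⊖ shift (f ⊗ G)) ≈⟨ S.+-congˡ {1ˢ} (S.-‿inverseʳ (shift (f ⊗ G))) ⟩
    1ˢ ⊕ 0ˢ                          ≈⟨ S.+-identityʳ 1ˢ ⟩
    1ˢ ∎
    where G = geometric f

  -- From [k+1] = 1 + z [k] = 1 - z (-[k]).
  1/[suc_] : ℕ → Series
  1/[suc k ] = geometric (⊖ [ k ] z)

  [suc]*1/[suc]≋1 : ∀ k → [ suc k ] z ⊗ 1/[suc k ] ≋ 1ˢ
  [suc]*1/[suc]≋1 k = begin
    [ suc k ] z ⊗ 1/[suc k ]                    ≈⟨ S.*-congʳ ([suc]≈ k) ⟩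
    (1ˢ ⊕ z ⊗ [ k ] z) ⊗ 1/[suc k ]
      ≈⟨ S.*-congʳ (S.+-congˡ {1ˢ} (S.trans (S.sym (-‿involutive _)) (S.-‿cong (-‿distribʳ-* z ([ k ] z))))) ⟩
    (1ˢ ⊕ ⊖ (z ⊗ ⊖ [ k ] z)) ⊗ 1/[suc k ]       ≈⟨ [1-zf]*geometric (⊖ [ k ] z) ⟩
    1ˢ ∎

  -- Here p is 1 - z, a unit whose inverse is the series 1 + z + z² + ⋯.
  p-cancel : ∀ {f g} → p ⊗ f ≋ p ⊗ g → f ≋ g
  p-cancel {f} {g} eq = begin
    f             ≈⟨ undo f ⟨
    G ⊗ (p ⊗ f)   ≈⟨ S.*-congˡ eq ⟩
    G ⊗ (p ⊗ g)   ≈⟨ undo g ⟩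
    g ∎
    where
    G = geometric 1ˢ
    undo : ∀ h → G ⊗ (p ⊗ h) ≋ h
    undo h = begin
      G ⊗ (p ⊗ h)                 ≈⟨ S.*-assoc G p h ⟨
      G ⊗ p ⊗ h                   ≈⟨ S.*-congʳ (S.*-comm G p) ⟩
      p ⊗ G ⊗ h                   ≈⟨ S.*-congʳ (S.*-congʳ (S.+-congˡ {1ˢ} (S.-‿cong (S.sym (S.*-identityʳ z))))) ⟩
      (1ˢ ⊕ ⊖ (z ⊗ 1ˢ)) ⊗ G ⊗ h   ≈⟨ S.*-congʳ ([1-zf]*geometric 1ˢ) ⟩
      1ˢ ⊗ h                      ≈⟨ S.*-identityˡ h ⟩
      h ∎

module Evaluation {a ℓ} (R : CommutativeRing a ℓ) (q : CommutativeRing.Carrier R) where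
  open CommutativeRing R
  open PowerSeries R
  open SetoidReasoning setoid
  open Solver commutativeSemiring using (solve; _:+_; _:*_; _:=_)
  private
    module S = CommutativeRing seriesRing
    module QR = QAnalogues R
    module QS = QAnalogues seriesRing

  -- f is a polynomial with value v at q.
  infix 4 _⇓_
  data _⇓_ : Series → Carrier → Set (a ⊔ ℓ) where
    none   : ∀ {f v} → f ≋ 0ˢ → v ≈ 0# → f ⇓ v
    horner : ∀ {f v w} → tail f ⇓ w → v ≈ f 0 + q * w → f ⇓ v

  ⇓-resp : ∀ {f g v w} → f ≋ g → v ≈ w → f ⇓ v → g ⇓ w
  ⇓-resp f≋g v≈w (none f≋0 v≈0)   = none (λ n → trans (sym (f≋g n)) (f≋0 n)) (trans (sym v≈w) v≈0)
  ⇓-resp f≋g v≈w (horner f⇓ v≈)   =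
    horner (⇓-resp (λ n → f≋g (suc n)) refl f⇓) (trans (sym v≈w) (trans v≈ (+-congʳ (f≋g 0))))

  ⇓-zero : ∀ {f v} → f ≋ 0ˢ → f ⇓ v → v ≈ 0#
  ⇓-zero f≋0 (none _ v≈0)   = v≈0
  ⇓-zero f≋0 (horner f⇓ v≈) = trans v≈ (trans
    (+-cong (f≋0 0) (trans (*-congˡ (⇓-zero (λ n → f≋0 (suc n)) f⇓)) (zeroʳ q))) (+-identityʳ 0#))

  -- The transfer principle: an identity of series whose sides are polynomials passes to their
  -- values at q. The two derivations may stop at different degrees, in which case the longer one
  -- ends in zero coefficients.
  ⇓-functional : ∀ {f g v w} → f ≋ g → f ⇓ v → g ⇓ w → v ≈ w
  ⇓-functional f≋g (none f≋0 v≈0) g⇓ = trans v≈0 (sym (⇓-zero (λ n → trans (sym (f≋g n)) (f≋0 n)) g⇓))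
  ⇓-functional f≋g (horner f⇓ v≈) (none g≋0 w≈0) =
    trans (⇓-zero (λ n → trans (f≋g n) (g≋0 n)) (horner f⇓ v≈)) (sym w≈0)
  ⇓-functional f≋g (horner f⇓ v≈) (horner g⇓ w≈) = trans v≈ (trans
    (+-cong (f≋g 0) (*-congˡ (⇓-functional (λ n → f≋g (suc n)) f⇓ g⇓))) (sym w≈))

  ⇓-constant : ∀ c → constant c ⇓ c
  ⇓-constant c = horner (none (λ _ → refl) refl) (sym (trans (+-congˡ (zeroʳ q)) (+-identityʳ c)))

  ⇓-shift : ∀ {f v} → f ⇓ v → shift f ⇓ q * v
  ⇓-shift f⇓ = horner f⇓ (sym (+-identityˡ _))

  ⇓-z : z ⇓ q
  ⇓-z = ⇓-resp (λ _ → refl) (*-identityʳ q) (⇓-shift (⇓-constant 1#))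

  ⇓-⊕ : ∀ {f g v w} → f ⇓ v → g ⇓ w → f ⊕ g ⇓ v + w
  ⇓-⊕ (none f≋0 v≈0) g⇓ = ⇓-resp
    (λ n → sym (trans (+-congʳ (f≋0 n)) (+-identityˡ _))) (sym (trans (+-congʳ v≈0) (+-identityˡ _))) g⇓
  ⇓-⊕ f⇓@(horner _ _) (none g≋0 w≈0) = ⇓-resp
    (λ n → sym (trans (+-congˡ (g≋0 n)) (+-identityʳ _))) (sym (trans (+-congˡ w≈0) (+-identityʳ _))) f⇓
  ⇓-⊕ (horner f⇓ v≈) (horner g⇓ w≈) = horner (⇓-⊕ f⇓ g⇓) (trans (+-cong v≈ w≈)
    (solve 5 (λ a b c d q → a :+ q :* b :+ (c :+ q :* d) := a :+ c :+ q :* (b :+ d)) refl _ _ _ _ q))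

  ⇓-· : ∀ c {f v} → f ⇓ v → c · f ⇓ c * v
  ⇓-· c (none f≋0 v≈0) = none (λ n → trans (*-congˡ (f≋0 n)) (zeroʳ c)) (trans (*-congˡ v≈0) (zeroʳ c))
  ⇓-· c (horner f⇓ v≈) = horner (⇓-· c f⇓) (trans (*-congˡ v≈)
    (solve 4 (λ c a q w → c :* (a :+ q :* w) := c :* a :+ q :* (c :* w)) refl c _ q _))

  ⇓-⊗ : ∀ {f g v w} → f ⇓ v → g ⇓ w → f ⊗ g ⇓ v * w
  ⇓-⊗ {g = g} (none f≋0 v≈0) g⇓ = none (⊗-zeroˡ g f≋0) (trans (*-congʳ v≈0) (zeroˡ _))
  ⇓-⊗ {f} {g} {w = w} (horner {w = v′} f⇓ v≈) g⇓ = ⇓-resp split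
    (trans (solve 4 (λ a w q v → a :* w :+ q :* (v :* w) := (a :+ q :* v) :* w) refl (f 0) w q v′) (*-congʳ (sym v≈)))
    (⇓-⊕ (⇓-· (f 0) g⇓) (⇓-shift (⇓-⊗ f⇓ g⇓)))
    where
    split : f 0 · g ⊕ shift (tail f ⊗ g) ≋ f ⊗ g
    split zero    = +-identityʳ _
    split (suc n) = refl

  ⇓-^ : ∀ {f v} n → f ⇓ v → f QS.^ n ⇓ v QR.^ n
  ⇓-^ zero    f⇓ = ⇓-constant 1#
  ⇓-^ (suc n) f⇓ = ⇓-⊗ f⇓ (⇓-^ n f⇓)

  ⇓-∑ : ∀ {A : Set} (xs : List A) {f g} → (∀ x → f x ⇓ g x) → QS.∑ xs f ⇓ QR.∑ xs g
  ⇓-∑ []       f⇓ = none (λ _ → refl) refl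
  ⇓-∑ (x ∷ xs) f⇓ = ⇓-⊕ (f⇓ x) (⇓-∑ xs f⇓)

  ⇓-∏ : ∀ {A : Set} (xs : List A) {f g} → (∀ x → f x ⇓ g x) → QS.∏ xs f ⇓ QR.∏ xs g
  ⇓-∏ []       f⇓ = ⇓-constant 1#
  ⇓-∏ (x ∷ xs) f⇓ = ⇓-⊗ (f⇓ x) (⇓-∏ xs f⇓)

  ⇓-[] : ∀ k → QS.[ k ] z ⇓ QR.[ k ] q
  ⇓-[] k = ⇓-∑ (upTo k) (λ i → ⇓-^ i ⇓-z)

  ⇓-[]! : ∀ n → QS.[ n ]! z ⇓ QR.[ n ]! q
  ⇓-[]! n = ⇓-∏ [1‥ n ] ⇓-[]

-- The identity at an arbitrary q, and division by the hooks

module _ {a ℓ} (R : CommutativeRing a ℓ) where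
  open CommutativeRing R
  open QAnalogues R
  open PowerSeries R using (seriesRing; z; constant)

  ∑-SYT±*hooks : ∀ q t {n} (Λ : Partition n) →
    ∑[ T ∈ SYT± Λ ] (q ^ maj T * t ^ neg T) * ∏[ x ∈ cells (parts Λ) ] ([ hook x ] q)
    ≈ [ n ]! q * ∏[ x ∈ cells (parts Λ) ] (q ^ (row x ∸ 1) + t * q ^ (col x ∸ 1))
  ∑-SYT±*hooks q t {n} Λ = ⇓-functional
    (InvertibleQNumbers.∑-SYT±*hooks seriesRing z (constant t) (1/[suc_] R) ([suc]*1/[suc]≋1 R) (p-cancel R) Λ)
    (⇓-⊗ (⇓-∑ (SYT± Λ) λ T → ⇓-⊗ (⇓-^ (maj T) ⇓-z) (⇓-^ (neg T) (⇓-constant t)))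
         (⇓-∏ (cells (parts Λ)) λ x → ⇓-[] (hook x)))
    (⇓-⊗ (⇓-[]! n) (⇓-∏ (cells (parts Λ)) λ x →
      ⇓-⊕ (⇓-^ (row x ∸ 1) ⇓-z) (⇓-⊗ (⇓-constant t) (⇓-^ (col x ∸ 1) ⇓-z))))
    where open Evaluation R q

theorem1p6 :
    ∀ {a ℓ} (R : CommutativeRing a ℓ) →
    let open CommutativeRing R
        open QAnalogues R in
    (q t : Carrier) {n : ℕ} (Λ : Partition n)
    (1/[h_] : Cell (parts Λ) → Carrier) →
    (∀ x → [ hook x ] q * 1/[h x ] ≈ 1#) →
    ∑[ T ∈ SYT± Λ ] (q ^ maj T * t ^ neg T)
      ≈ [ n ]! q * ∏[ x ∈ cells (parts Λ) ] ((q ^ (row x ∸ 1) + t * q ^ (col x ∸ 1)) * 1/[h x ])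
theorem1p6 R q t {n} Λ 1/[h_] [h]*1/[h]≈1 = begin
  F                     ≈⟨ *-identityʳ F ⟨
  F * 1#                ≈⟨ *-congˡ (inverses (cells (parts Λ))) ⟨
  F * (H * I)           ≈⟨ *-assoc F H I ⟨
  F * H * I             ≈⟨ *-congʳ (∑-SYT±*hooks R q t Λ) ⟩
  [ n ]! q * N * I      ≈⟨ *-assoc _ N I ⟩
  [ n ]! q * (N * I)    ≈⟨ *-congˡ (∏-* (cells (parts Λ)) _ 1/[h_]) ⟨
  [ n ]! q * ∏[ x ∈ cells (parts Λ) ] ((q ^ (row x ∸ 1) + t * q ^ (col x ∸ 1)) * 1/[h x ]) ∎
  where
  open CommutativeRing R
  open QAnalogues R
  open Sums R
  open SetoidReasoning setoid

  F = ∑[ T ∈ SYT± Λ ] (q ^ maj T * t ^ neg T)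
  H = ∏[ x ∈ cells (parts Λ) ] ([ hook x ] q)
  I = ∏ (cells (parts Λ)) 1/[h_]
  N = ∏[ x ∈ cells (parts Λ) ] (q ^ (row x ∸ 1) + t * q ^ (col x ∸ 1))

  inverses : ∀ xs → ∏[ x ∈ xs ] ([ hook x ] q) * ∏ xs 1/[h_] ≈ 1#
  inverses []       = *-identityˡ 1#
  inverses (x ∷ xs) = begin
    [ hook x ] q * ∏[ x ∈ xs ] ([ hook x ] q) * (1/[h x ] * ∏ xs 1/[h_])
      ≈⟨ ∏-* (x ∷ xs) (λ x → [ hook x ] q) 1/[h_] ⟨
    [ hook x ] q * 1/[h x ] * ∏[ x ∈ xs ] ([ hook x ] q * 1/[h x ])
      ≈⟨ *-cong ([h]*1/[h]≈1 x) (trans (∏-* xs (λ x → [ hook x ] q) 1/[h_]) (inverses xs)) ⟩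
    1# * 1# ≈⟨ *-identityˡ 1# ⟩
    1# ∎
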